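{- Assume LSH for $\mathrm{2SAT}_3$. Then there is no deterministic algorithm that, given an instance $x$ of $\mathrm{Max\mbox{ - }HPP}$ and an approximation parameter $k\in\mathbb{N}^{+}$, runs in polynomial time using $O(k^{1/3}\log m_{col}(x))$ space and outputs a $(1+\frac1k)$-approximate solution of $(\mathrm{Max\mbox{ - }HPP}, m_{col})$ for $x$.
   Context: Turing machines are multi-tape with a read-only input tape; space counts work tapes only. A polylogarithmic function is $\ell(n)=p(\log n)$ for a polynomial $p$. $\mathrm{2SAT}_3$: instances are 2CNF formulas in which each variable $v$ has at most 3 occurrences in total of the literals $v,\overline v$; question: is it satisfiable? $m_{vbl}(x)$ = number of variables. LSH for $\mathrm{2SAT}_3$: for every $\varepsilon\in(0,1)$ and every polylogarithmic $\ell$, no deterministic TM solves $\mathrm{2SAT}_3$ simultaneously in polynomial time using at most $m_{vbl}(x)^\varepsilon\ell(|x|)$ space on every instance $x$. $\mathrm{Max\mbox{ - }HPP}$ (maximum hot potato problem), a maximization problem: an instance is $(A,d,i_1)$ where $A$ is an $n\times n$ matrix ($n\ge1$) with entries from $[n]=\{1,\dots,n\}$, $d\in[n]$, and $i_1\in[n]$; a solution is an index sequence $\mathcal{S}=(i_1,i_2,\dots,i_d)$ with all $i_j\in[n]$; its measure is $w(\mathcal{S})=\sum_{j=1}^{d-1}A_{i_ji_{j+1}}$. Size parameter $m_{col}(A,d,i_1)=n$. With $w^*(x)$ the maximum measure over solutions for $x$, the performance ratio of a solution $y$ is $R(x,y)=\max\{w^*(x)/w(y),\,w(y)/w^*(x)\}$,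 and $y$ is a $(1+\frac1k)$-approximate solution if $R(x,y)\le 1+\frac1k$. -}

module Defs where

open import Data.Bool using (Bool; true; false; if_then_else_)
open import Data.Nat using (ℕ; zero; suc; _+_; _*_; _^_; _≤_; _<_; _≡ᵇ_)
open import Data.Nat.Properties using (_≟_)
open import Data.Nat.Logarithm using (⌊log₂_⌋)
open import Data.Nat.Binary.Base using (ℕᵇ; 2[1+_]; 1+[2_]) renaming (zero to zeroᵇ; fromℕ to toℕᵇ)
open import Data.Fin using (Fin; toℕ)
import Data.Fin
import Data.Nat
open import Data.List using (List; []; _∷_; _++_; length; map; concat; concatMap; sum; deduplicate; filter)
open import Data.List.Relation.Unary.All using (All)
open import Data.List.Relation.Unary.Any using (Any)
open import Data.Vec using (Vec)
import Data.Vec as V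
open import Data.Maybe using (Maybe; just; nothing)
open import Data.Product using (Σ; _×_; _,_; proj₁; proj₂)
open import Relation.Binary.PropositionalEquality using (_≡_)
open import Relation.Nullary using (¬_)
open import Relation.Nullary.Decidable using (⌊_⌋)

data Sym : Set where
  s0 s1 sep : Sym

-- self-delimiting-free binary-like code of a natural number
-- (bijective base-2, least significant digit first; length O(log n))
encℕᵇ : ℕᵇ → List Sym
encℕᵇ zeroᵇ     = []
encℕᵇ 1+[2 b ]  = s0 ∷ encℕᵇ b
encℕᵇ 2[1+ b ]  = s1 ∷ encℕᵇ b

encℕ : ℕ → List Sym
encℕ n = encℕᵇ (toℕᵇ n)

encNum : ℕ → List Sym
encNum n = encℕ n ++ (sep ∷ [])

-- Multi-tape deterministic Turing machines with a read-only input tape,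
-- work tapes (space counted) and a write-only one-way output tape.

data Move : Set where
  L S R : Move

record TM : Set where
  field
    nQ     : ℕ
    nΓ     : ℕ                 -- work alphabet is Fin (suc nΓ), zero = blank
    tapes  : ℕ
    start  : Fin nQ
    halt   : Fin nQ → Bool
    accept : Fin nQ → Bool
    -- transition: state, input symbol (nothing = blank/end), work symbols
    --   ↦ new state, input move, (write, move) per work tape, output symbol
    δ      : Fin nQ → Maybe Sym → Vec (Fin (suc nΓ)) tapes →
             Fin nQ × Move × Vec (Fin (suc nΓ) × Move) tapes × Maybe Sym

record Tape (Γ : Set) : Set where
  constructor mkTape
  field
    cells  : ℕ → Γ
    pos    : ℕ
    maxpos : ℕ

move : Move → ℕ → ℕ
move L zero    = zero
move L (suc p) = p
move S p       = p
move R p       = suc p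

-- input head is confined to cells 0 .. length w (cell length w = blank)
moveIn : ℕ → Move → ℕ → ℕ
moveIn len R p = if p ≡ᵇ len then p else suc p
moveIn len m p = move m p

readIn : List Sym → ℕ → Maybe Sym
readIn []       _       = nothing
readIn (x ∷ xs) zero    = just x
readIn (x ∷ xs) (suc p) = readIn xs p

maxℕ : ℕ → ℕ → ℕ
maxℕ = Data.Nat._⊔_

updTape : ∀ {Γ : Set} → Tape Γ → Γ × Move → Tape Γ
updTape (mkTape c p mx) (a , m) =
  let p' = move m p in
  mkTape (λ q → if q ≡ᵇ p then a else c q) p' (maxℕ mx p')

record Config (M : TM) : Set where
  constructor mkConfig
  open TM M
  field
    state : Fin nQ
    inPos : ℕ
    work  : Vec (Tape (Fin (suc nΓ))) tapes
    out   : List Sym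

module _ (M : TM) where
  open TM M

  initConfig : Config M
  initConfig = mkConfig start zero (V.replicate tapes (mkTape (λ _ → Data.Fin.zero) zero zero)) []

  headSym : Tape (Fin (suc nΓ)) → Fin (suc nΓ)
  headSym t = Tape.cells t (Tape.pos t)

  outApp : List Sym → Maybe Sym → List Sym
  outApp o nothing  = o
  outApp o (just s) = o ++ (s ∷ [])

  step : List Sym → Config M → Config M
  step w (mkConfig q ip ts o) with halt q
  ... | true  = mkConfig q ip ts o
  ... | false with δ q (readIn w ip) (V.map headSym ts)
  ...   | (q' , mi , acts , os) =
          mkConfig q' (moveIn (length w) mi ip) (V.zipWith updTape ts acts) (outApp o os)

  run : List Sym → ℕ → Config M
  run w zero    = initConfig
  run w (suc t) = step w (run w t)

  space : Config M → ℕ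
  space c = V.foldr (λ _ → ℕ) (λ t s → suc (Tape.maxpos t) + s) 0 (Config.work c)

  Halted : Config M → Set
  Halted c = halt (Config.state c) ≡ true

  Accepted : Config M → Set
  Accepted c = accept (Config.state c) ≡ true

  SpaceWithin : List Sym → ℕ → Set
  SpaceWithin w s = ∀ t → space (run w t) ≤ s

-- a literal: (variable index, polarity); (v , true) is v, (v , false) is ¬v
Literal : Set
Literal = ℕ × Bool

Clause : Set
Clause = List Literal

CNF : Set
CNF = List Clause

vars : CNF → List ℕ
vars φ = map proj₁ (concat φ)

occ : ℕ → CNF → ℕ
occ v φ = length (filter (λ u → u ≟ v) (vars φ))

Is2SAT₃ : CNF → Set
Is2SAT₃ φ = All (λ C → (1 ≤ length C) × (length C ≤ 2)) φ × (∀ v → occ v φ ≤ 3)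

Satisfiable : CNF → Set
Satisfiable φ = Σ (ℕ → Bool) λ σ → All (Any (λ l → σ (proj₁ l) ≡ proj₂ l)) φ

m-vbl : CNF → ℕ
m-vbl φ = length (deduplicate _≟_ (vars φ))

encBool : Bool → Sym
encBool true  = s1
encBool false = s0

encLit : Literal → List Sym
encLit (v , b) = encBool b ∷ encNum v

encClause : Clause → List Sym
encClause C = concatMap encLit C ++ (sep ∷ [])

encCNF : CNF → List Sym
encCNF φ = concatMap encClause φ

polylog : ℕ → ℕ → ℕ
polylog c n = c * ⌊log₂ n ⌋ ^ c + c

polyBound : ℕ → ℕ → ℕ
polyBound c n = c * n ^ c + c

-- M solves 2SAT₃ in polynomial time and space (1+m_vbl(x))^(a/b) · ℓ_c(|x|)
Solves2SAT₃ : TM → (a b c : ℕ) → Set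
Solves2SAT₃ M a b c =
  Σ ℕ λ p → ∀ φ → Is2SAT₃ φ →
    let w = encCNF φ
        fin = run M w (polyBound p (length w)) in
    Halted M fin
    × (Accepted M fin → Satisfiable φ) × (Satisfiable φ → Accepted M fin)
    × (∀ t → space M (run M w t) ^ b ≤ suc (m-vbl φ) ^ a * polylog c (length w) ^ b)

-- Linear Space Hypothesis for 2SAT₃ (ε = a/b ∈ (0,1))
LSH : Set
LSH = ∀ (a b : ℕ) → 0 < a → a < b → ∀ (c : ℕ) → ¬ Σ TM λ M → Solves2SAT₃ M a b c

-- instance (A, d, i₁) with n = suc n'; indices [n] are represented by Fin n
record HPP : Set where
  field
    n'      : ℕ
    A       : Fin (suc n') → Fin (suc n') → ℕ
    A-range : ∀ i j → (1 ≤ A i j) × (A i j ≤ suc n')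
    d       : ℕ
    d-range : (1 ≤ d) × (d ≤ suc n')
    i₁      : Fin (suc n')

m-col : HPP → ℕ
m-col x = suc (HPP.n' x)

-- a solution (i₁, i₂, …, i_d) is given by its tail (i₂, …, i_d)
Solution : HPP → Set
Solution x = Σ (List (Fin (suc (HPP.n' x)))) λ js → suc (length js) ≡ HPP.d x

weightFrom : (x : HPP) → Fin (suc (HPP.n' x)) → List (Fin (suc (HPP.n' x))) → ℕ
weightFrom x i []       = 0
weightFrom x i (j ∷ js) = HPP.A x i j + weightFrom x j js

weight : (x : HPP) → Solution x → ℕ
weight x (js , _) = weightFrom x (HPP.i₁ x) js

IsOptValue : (x : HPP) → ℕ → Set
IsOptValue x v = Σ (Solution x) (λ y → weight x y ≡ v) × (∀ y → weight x y ≤ v)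

-- R(x,y) ≤ 1 + 1/k, i.e. w*/w(y) ≤ (k+1)/k and w(y)/w* ≤ (k+1)/k
Approx : (x : HPP) → (k : ℕ) → Solution x → Set
Approx x k y = ∀ v → IsOptValue x v →
  (k * v ≤ suc k * weight x y) × (k * weight x y ≤ suc k * v)

encIdx : ∀ {n} → Fin n → List Sym
encIdx i = encNum (suc (toℕ i))     -- 1-based, as in [n]

encRow : ∀ {n} → (Fin n → ℕ) → List Sym
encRow {n} r = concatMap (λ j → encNum (r j)) (Data.List.allFin n)

encHPP : HPP → List Sym
encHPP x = encNum (m-col x) ++ encNum (HPP.d x) ++ encIdx (HPP.i₁ x)
           ++ concatMap (λ i → encRow (HPP.A x i)) (Data.List.allFin (m-col x))

encSolution : (x : HPP) → Solution x → List Sym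
encSolution x (js , _) = concatMap encIdx (HPP.i₁ x ∷ js)

encInput : HPP → ℕ → List Sym
encInput x k = encHPP x ++ encNum k

-- M, on input (x,k), runs in time polynomial in |x| + k, uses
-- O(k^{1/3} log m_col(x)) space, and outputs a (1+1/k)-approximate solution
ApproxHPP : TM → Set
ApproxHPP M =
  Σ ℕ λ p → Σ ℕ λ c → ∀ (x : HPP) (k : ℕ) → 1 ≤ k →
    let w = encInput x k
        fin = run M w (polyBound p (length w + k)) in
    Halted M fin
    × Σ (Solution x) (λ y → Config.out fin ≡ encSolution x y × Approx x k y)
    × (∀ t → space M (run M w t) ^ 3 ≤ c * k * suc ⌊log₂ m-col x ⌋ ^ 3)

module Submission where

-- Let φ have N clauses.  In the implication graph of φ, φ is unsatisfiable iff
-- some literal l satisfies l →* ¬l →* l, with both paths of length at most 2N.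
-- We build an instance whose vertices blk x y p remember the start x of such a
-- closed walk, its current occurrence y, and whether ¬x was already passed.
-- Ordinary edges weigh 4, the entrance to the graph 3, the edge that closes the
-- walk 6, and everything else 1; a vertex "idle" offers a walk of weight 4D,
-- D = 4N + 1.  If φ is unsatisfiable the optimum is 4D + 1; if φ is satisfiable,
-- a satisfying assignment gives a potential showing that every walk avoiding
-- idle on its first step weighs at most 4D - 1.  With k = 4D + 4 a
-- (1 + 1/k)-approximate solution therefore moves to idle exactly if φ is
-- satisfiable, which a finite automaton reads off the first symbols of the output.
--
-- The instance has O(N²) vertices and k = O(N) = O(m), so an approximation
-- algorithm in space O(k^{1/3} log n) solves 2SAT₃ in space O(m^{1/3} log |φ|):
-- its input is not stored, but each symbol it reads is recomputed from φ with a
-- constant number of binary counters.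

open import Defs
open import Data.Bool using (Bool; true; false; if_then_else_; not; _∧_; _∨_; _xor_)
import Data.Bool as 𝔹
import Data.Bool.Properties as BP
open import Data.Empty using (⊥; ⊥-elim)
open import Data.Fin using (Fin; zero; suc; toℕ)
import Data.Fin as F
import Data.Fin.Properties as FP
open import Data.List using (List; []; _∷_; _++_; length; map; concat; concatMap; allFin; lookup; reverse; _ʳ++_; take; drop; fromMaybe; tabulate; foldl; replicate; filter; deduplicate)
open import Data.List.Properties using (++-assoc; ++-identityʳ; ++-cancelˡ; ∷-injectiveˡ; ∷-injectiveʳ; ʳ++-defn; length-reverse; length-++; length-ʳ++; length-tabulate; length-map; length-take; length-drop; length-replicate; foldl-++; map-tabulate; tabulate-lookup; concatMap-++; concatMap-cong; concatMap-map; filter-accept; filter-reject)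
open import Data.List.Membership.Propositional using (_∈_; lose)
open import Data.List.Membership.Propositional.Properties using (∈-map⁺; ∈-++⁺ˡ; ∈-++⁺ʳ; ∈-concatMap⁺; ∈-allFin; ∈-lookup; ∈-filter⁻; ∈-deduplicate⁺)
open import Data.List.Relation.Unary.All using (All; []; _∷_)
import Data.List.Relation.Unary.All as All
open import Data.List.Relation.Unary.All.Properties using (++⁺)
open import Data.List.Relation.Unary.Any using (Any; here; there; index)
import Data.List.Relation.Unary.Any as Any
open import Data.List.Relation.Unary.Any.Properties using (lookup-index)
open import Data.Maybe using (Maybe; just; nothing; is-just)
open import Data.Nat using (ℕ; zero; suc; _+_; _*_; _∸_; _^_; _⊔_; _⊓_; _≤_; _<_; _≡ᵇ_; _≤ᵇ_; z≤n; s≤s; pred)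
open import Data.Nat.Binary.Base using (ℕᵇ; 2[1+_]; 1+[2_]) renaming (zero to 0ᵇ; fromℕ to toBin; toℕ to ofBin)
open import Data.Nat.Binary.Properties using () renaming (toℕ-fromℕ to ofBin-toBin; fromℕ-toℕ to toBin-ofBin)
open import Data.Nat.Induction using (<-wellFounded)
open import Data.Nat.ListAction using (sum)
open import Data.Nat.Logarithm using (⌊log₂_⌋; ⌊log₂⌋-mono-≤; ⌊log₂[2^n]⌋≡n)
open import Data.Nat.Properties
open import Data.Nat.Tactic.RingSolver using (solve-∀)
open import Data.Product using (Σ; _×_; _,_; proj₁; proj₂)
open import Data.Product.Properties using (≡-dec)
open import Data.Sum using (_⊎_; inj₁; inj₂)
open import Data.Unit using (⊤; tt)
open import Data.Vec using (Vec; []; _∷_; _[_]≔_)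
import Data.Vec as V
import Data.Vec.Properties as VP
open import Data.Vec.Relation.Binary.Pointwise.Inductive using (Pointwise; []; _∷_)
open import Function using (_∘_; case_of_)
open import Induction.WellFounded using (Acc; acc)
open import Relation.Binary.PropositionalEquality hiding (J)
open import Relation.Nullary using (¬_; Dec; yes; no; contradiction; ¬?)
open import Relation.Nullary.Decidable using (⌊_⌋; does; map′; _⊎-dec_)

-- The two parameters are not equally expensive: `n` enters the space bound only through a
-- logarithm, `k` through a power. A vertex can therefore afford to carry two occurrences and a
-- phase, but the optimum must stay linear in N, because one unit of weight has to exceed the
-- tolerance of a (1 + 1/k)-approximation. Hence the certificate of unsatisfiability is one closed
-- walk of linear length. The weights 3 and 6 are to be compared with the norm of 4 per edge.
-- Entering the graph loses one unit and closing the walk gains two, so a completed walk beats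
-- idling by exactly one unit, while under a satisfying assignment the unit lost at the entrance is
-- never recovered. On the machine side, the obstacle is that an algorithm for 2SAT must be
-- exhibited as a Turing machine with proven time and space. It is written in a small language whose
-- running time can be read off the program text. Its space follows from one common bound on all
-- register values and from a cell by cell copy of the work tapes of `M`, so that the correctness
-- proofs mention register contents only.

record Finite (A : Set) : Set where
  field
    elems    : List A
    complete : ∀ a → a ∈ elems

open Finite ⦃ ... ⦄ public

Σ-finite : {A : Set} {B : A → Set} → Finite A → (∀ a → Finite (B a)) → Finite (Σ A B)
Σ-finite fA fB .elems = concatMap (λ a → map (a ,_) (Finite.elems (fB a))) (Finite.elems fA)
Σ-finite fA fB .complete (a , b) =
  ∈-concatMap⁺ _ (lose (Finite.complete fA a) (∈-map⁺ (a ,_) (Finite.complete (fB a) b)))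

instance
  ⊤-finite : Finite ⊤
  ⊤-finite .elems = tt ∷ []
  ⊤-finite .complete tt = here refl

  Bool-finite : Finite Bool
  Bool-finite .elems = true ∷ false ∷ []
  Bool-finite .complete true  = here refl
  Bool-finite .complete false = there (here refl)

  Fin-finite : ∀ {n} → Finite (Fin n)
  Fin-finite .elems = allFin _
  Fin-finite .complete = ∈-allFin

  Sym-finite : Finite Sym
  Sym-finite .elems = s0 ∷ s1 ∷ sep ∷ []
  Sym-finite .complete s0  = here refl
  Sym-finite .complete s1  = there (here refl)
  Sym-finite .complete sep = there (there (here refl))

  Move-finite : Finite Move
  Move-finite .elems = L ∷ S ∷ R ∷ []
  Move-finite .complete L = here refl
  Move-finite .complete S = there (here refl)
  Move-finite .complete R = there (there (here refl))

  Maybe-finite : {A : Set} → ⦃ Finite A ⦄ → Finite (Maybe A)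
  Maybe-finite .elems = nothing ∷ map just elems
  Maybe-finite .complete nothing  = here refl
  Maybe-finite .complete (just a) = there (∈-map⁺ just (complete a))

  ⊎-finite : {A B : Set} → ⦃ Finite A ⦄ → ⦃ Finite B ⦄ → Finite (A ⊎ B)
  ⊎-finite .elems = map inj₁ elems ++ map inj₂ elems
  ⊎-finite .complete (inj₁ a) = ∈-++⁺ˡ (∈-map⁺ inj₁ (complete a))
  ⊎-finite .complete (inj₂ b) = ∈-++⁺ʳ (map inj₁ elems) (∈-map⁺ inj₂ (complete b))

  ×-finite : {A B : Set} → ⦃ Finite A ⦄ → ⦃ Finite B ⦄ → Finite (A × B)
  ×-finite ⦃ a ⦄ ⦃ b ⦄ = Σ-finite a (λ _ → b)

  Vec-finite : {A : Set} {n : ℕ} → ⦃ Finite A ⦄ → Finite (Vec A n)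
  Vec-finite {n = zero}  .elems = [] ∷ []
  Vec-finite {n = zero}  .complete [] = here refl
  Vec-finite {n = suc n} .elems = map (λ p → proj₁ p ∷ proj₂ p) (×-finite {B = Vec _ n} .elems)
  Vec-finite {n = suc n} .complete (x ∷ v) =
    ∈-map⁺ (λ p → proj₁ p ∷ proj₂ p) (×-finite .complete (x , v))

-- Only a section of `lookup` is needed to number the states and symbols of a machine, so
-- enumerations may repeat elements.
encode : {A : Set} {xs : List A} → (∀ a → a ∈ xs) → A → Fin (length xs)
encode all a = index (all a)

decode-encode : {A : Set} {xs : List A} (all : ∀ a → a ∈ xs) (a : A) → lookup xs (encode all a) ≡ a
decode-encode all a = sym (lookup-index (all a))

sum-∈ : {A : Set} (f : A → ℕ) {xs : List A} {a : A} → a ∈ xs → f a ≤ sum (map f xs)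
sum-∈ f {x ∷ xs} (here refl) = m≤m+n (f x) _
sum-∈ f {x ∷ xs} (there p)   = ≤-trans (sum-∈ f p) (m≤n+m _ (f x))

-- Polynomially bounded functions

-- The base 2 + v absorbs constant factors into the exponent.
Poly : (ℕ → ℕ) → Set
Poly f = Σ ℕ λ c → ∀ v → f v ≤ (2 + v) ^ c

n≤2^n : ∀ n → n ≤ 2 ^ n
n≤2^n zero    = z≤n
n≤2^n (suc n) = begin
  1 + n          ≤⟨ +-mono-≤ (m^n>0 2 n) (n≤2^n n) ⟩
  2 ^ n + 2 ^ n  ≡⟨ cong (2 ^ n +_) (sym (+-identityʳ _)) ⟩
  2 ^ suc n      ∎
  where open ≤-Reasoning

poly-const : ∀ a → Poly (λ _ → a)
poly-const a = a , λ v → ≤-trans (n≤2^n a) (^-monoˡ-≤ a (m≤m+n 2 v))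

poly-id : Poly (λ v → v)
poly-id = 1 , λ v → ≤-trans (m≤n+m v 2) (≤-reflexive (sym (*-identityʳ (2 + v))))

poly-* : ∀ {f g} → Poly f → Poly g → Poly (λ v → f v * g v)
poly-* (c , hf) (d , hg) = c + d , λ v →
  ≤-trans (*-mono-≤ (hf v) (hg v)) (≤-reflexive (sym (^-distribˡ-+-* (2 + v) c d)))

poly-+ : ∀ {f g} → Poly f → Poly g → Poly (λ v → f v + g v)
poly-+ {f} {g} (c , hf) (d , hg) = suc (c ⊔ d) , λ v → begin
  f v + g v                                    ≤⟨ +-mono-≤ (hf v) (hg v) ⟩
  (2 + v) ^ c + (2 + v) ^ d                    ≤⟨ +-mono-≤ (^-monoʳ-≤ (2 + v) (m≤m⊔n c d))
                                                            (^-monoʳ-≤ (2 + v) (m≤n⊔m c d)) ⟩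
  (2 + v) ^ (c ⊔ d) + (2 + v) ^ (c ⊔ d)        ≡⟨ cong ((2 + v) ^ (c ⊔ d) +_) (sym (+-identityʳ _)) ⟩
  2 * (2 + v) ^ (c ⊔ d)                        ≤⟨ *-monoˡ-≤ ((2 + v) ^ (c ⊔ d)) (m≤m+n 2 v) ⟩
  (2 + v) ^ suc (c ⊔ d)                        ∎
  where open ≤-Reasoning

poly-∘ : ∀ {f g} → Poly f → Poly g → Poly (λ v → f (g v))
poly-∘ {f} {g} (c , hf) pg with poly-+ (poly-const 2) pg
... | d , h = d * c , λ v → begin
  f (g v)               ≤⟨ hf (g v) ⟩
  (2 + g v) ^ c         ≤⟨ ^-monoˡ-≤ c (h v) ⟩
  ((2 + v) ^ d) ^ c     ≡⟨ ^-*-assoc (2 + v) d c ⟩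
  (2 + v) ^ (d * c)     ∎
  where open ≤-Reasoning

poly-^ : ∀ {f} c → Poly f → Poly (λ v → f v ^ c)
poly-^ zero    pf = poly-const 1
poly-^ (suc c) pf = poly-* pf (poly-^ c pf)

poly-sum : {A : Set} (xs : List A) {f : A → ℕ → ℕ} → (∀ a → Poly (f a)) →
           Poly (λ v → sum (map (λ a → f a v) xs))
poly-sum []       h = poly-const 0
poly-sum (x ∷ xs) h = poly-+ (h x) (poly-sum xs h)

-- Structured programs over multi-tape memories and their running time

module Machine (T nΓ : ℕ) where

  Γ = Fin (suc nΓ)
  Obs = Maybe Sym × Vec Γ T
  Act = Move × Vec (Γ × Move) T
  Mem = ℕ × Vec (Tape Γ) T

  hd : Tape Γ → Γ
  hd t = Tape.cells t (Tape.pos t)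

  -- Intermediate results of `bind` and `iter` are kept in the finite control, so their types must
  -- be finite; unbounded data has to live on the tapes. In `iter`, `inj₁` starts another round and
  -- `inj₂` leaves the loop.
  data Prog : Set → Set₁ where
    ret  : {B : Set} → B → Prog B
    stp  : {B : Set} → (Obs → Act × B) → Prog B
    bind : {A B : Set} → ⦃ Finite A ⦄ → Prog A → (A → Prog B) → Prog B
    iter : {A B : Set} → ⦃ Finite A ⦄ → (A → Prog (A ⊎ B)) → A → Prog B

  -- A program counter. The result of a program is not among its states: it is delivered by the last
  -- transition, which in a `bind` or `iter` at once enters the program that follows.
  State : {B : Set} → Prog B → Set
  State (ret b)          = ⊤
  State (stp f)          = ⊤
  State (bind {A} P g)   = State P ⊎ Σ A λ a → State (g a)
  State (iter {A} body a) = Σ A λ a → State (body a)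

  State-finite : {B : Set} (P : Prog B) → Finite (State P)
  State-finite (ret b)               = ⊤-finite
  State-finite (stp f)               = ⊤-finite
  State-finite (bind ⦃ fA ⦄ P g)     = ⊎-finite ⦃ State-finite P ⦄ ⦃ Σ-finite fA (λ a → State-finite (g a)) ⦄
  State-finite (iter ⦃ fA ⦄ body a)  = Σ-finite fA (λ a → State-finite (body a))

  entry : {B : Set} (P : Prog B) → State P
  entry (ret b)       = tt
  entry (stp f)       = tt
  entry (bind P g)    = inj₁ (entry P)
  entry (iter body a) = a , entry (body a)

  noAct : Vec Γ T → Act
  noAct γs = S , V.map (_, S) γs

  liftL : {A B : Set} ⦃ _ : Finite A ⦄ (P : Prog A) (g : A → Prog B) →
          Act × (State P ⊎ A) → Act × (State (bind P g) ⊎ B)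
  liftL P g (α , inj₁ s) = α , inj₁ (inj₁ s)
  liftL P g (α , inj₂ a) = α , inj₁ (inj₂ (a , entry (g a)))

  liftR : {A B : Set} ⦃ _ : Finite A ⦄ (P : Prog A) (g : A → Prog B) (a : A) →
          Act × (State (g a) ⊎ B) → Act × (State (bind P g) ⊎ B)
  liftR P g a (α , inj₁ s) = α , inj₁ (inj₂ (a , s))
  liftR P g a (α , inj₂ b) = α , inj₂ b

  liftI : {A B : Set} (body : A → Prog (A ⊎ B)) (a : A) →
          Act × (State (body a) ⊎ (A ⊎ B)) → Act × ((Σ A λ a → State (body a)) ⊎ B)
  liftI body a (α , inj₁ s)         = α , inj₁ (a , s)
  liftI body a (α , inj₂ (inj₁ a')) = α , inj₁ (a' , entry (body a'))
  liftI body a (α , inj₂ (inj₂ b))  = α , inj₂ b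

  trans-of : {B : Set} (P : Prog B) → State P → Obs → Act × (State P ⊎ B)
  trans-of (ret b)       tt             o = noAct (proj₂ o) , inj₂ b
  trans-of (stp f)       tt             o = proj₁ (f o) , inj₂ (proj₂ (f o))
  trans-of (bind P g)    (inj₁ s)       o = liftL P g (trans-of P s o)
  trans-of (bind P g)    (inj₂ (a , s)) o = liftR P g a (trans-of (g a) s o)
  trans-of (iter body _) (a , s)        o = liftI body a (trans-of (body a) s o)

  -- The sums range over all possible intermediate results although only one of them occurs. The
  -- bound thus depends on the program text and `v` alone, and polynomials are closed under such
  -- sums.
  cost : {B : Set} → Prog B → ℕ → ℕ
  cost (ret b)       v = 1
  cost (stp f)       v = 1
  cost (bind P g)    v = cost P v + sum (map (λ a → cost (g a) v) elems)
  cost (iter body a) v = v * sum (map (λ a → cost (body a) v) elems)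

  cost-poly : {B : Set} (P : Prog B) → Poly (cost P)
  cost-poly (ret b)       = poly-const 1
  cost-poly (stp f)       = poly-const 1
  cost-poly (bind P g)    = poly-+ (cost-poly P) (poly-sum elems (λ a → cost-poly (g a)))
  cost-poly (iter body a) = poly-* poly-id (poly-sum elems (λ a → cost-poly (body a)))

  module Run (w : List Sym) where

    obs : Mem → Obs
    obs (ip , ts) = readIn w ip , V.map hd ts

    apply : Act → Mem → Mem
    apply (mi , acts) (ip , ts) = moveIn (length w) mi ip , V.zipWith updTape ts acts

    -- Exhausted fuel is an impossibility and not a default result, so a derivation certifies that
    -- the loop ended in time.
    Iter : {A B : Set} → (A → Mem → A ⊎ B → Mem → Set) → ℕ → A → Mem → B → Mem → Set
    Iter body zero    a m b m' = ⊥
    Iter {A} body (suc n) a m b m' =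
      body a m (inj₂ b) m' ⊎ Σ A λ a' → Σ Mem λ m₁ → body a m (inj₁ a') m₁ × Iter body n a' m₁ b m'

    -- v bounds the number of iterations of every loop; the running time is
    -- then at most cost P v, so that specifications need not mention time.
    Exec : ℕ → {B : Set} → Prog B → Mem → B → Mem → Set
    Exec v (ret b')      m b m' = b' ≡ b × apply (noAct (proj₂ (obs m))) m ≡ m'
    Exec v (stp f)       m b m' = proj₂ (f (obs m)) ≡ b × apply (proj₁ (f (obs m))) m ≡ m'
    Exec v (bind {A} P g) m b m' = Σ A λ a → Σ Mem λ m₁ → Exec v P m a m₁ × Exec v (g a) m₁ b m'
    Exec v (iter body a) m b m' = Iter (λ a → Exec v (body a)) v a m b m'

    data Reach {B : Set} (P : Prog B) : State P → Mem → ℕ → B → Mem → Set where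
      exit : ∀ {s m α b} → trans-of P s (obs m) ≡ (α , inj₂ b) → Reach P s m 1 b (apply α m)
      next : ∀ {s m α s' n b m'} → trans-of P s (obs m) ≡ (α , inj₁ s') →
             Reach P s' (apply α m) n b m' → Reach P s m (suc n) b m'

    module _ {A B : Set} ⦃ _ : Finite A ⦄ {P : Prog A} {g : A → Prog B} where
      reachR : ∀ {a s m n b m'} → Reach (g a) s m n b m' → Reach (bind P g) (inj₂ (a , s)) m n b m'
      reachR {a} (exit e)   = exit (cong (liftR P g a) e)
      reachR {a} (next e r) = next (cong (liftR P g a) e) (reachR r)

      reachL : ∀ {s m n a m₁ k b m'} → Reach P s m n a m₁ → Reach (g a) (entry (g a)) m₁ k b m' →
               Reach (bind P g) (inj₁ s) m (n + k) b m'
      reachL (exit e)   r' = next (cong (liftL P g) e) (reachR r')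
      reachL (next e r) r' = next (cong (liftL P g) e) (reachL r r')

    module _ {A B : Set} ⦃ _ : Finite A ⦄ {body : A → Prog (A ⊎ B)} {a₀ : A} where
      reach-last : ∀ {a s m n b m'} → Reach (body a) s m n (inj₂ b) m' → Reach (iter body a₀) (a , s) m n b m'
      reach-last {a} (exit e)   = exit (cong (liftI body a) e)
      reach-last {a} (next e r) = next (cong (liftI body a) e) (reach-last r)

      reach-more : ∀ {a s m n a' m₁ k b m'} → Reach (body a) s m n (inj₁ a') m₁ →
                   Reach (iter body a₀) (a' , entry (body a')) m₁ k b m' →
                   Reach (iter body a₀) (a , s) m (n + k) b m'
      reach-more {a} (exit e)   r' = next (cong (liftI body a) e) r'
      reach-more {a} (next e r) r' = next (cong (liftI body a) e) (reach-more r r')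

    Timed : {B : Set} → Prog B → Mem → B → Mem → ℕ → Set
    Timed P m b m' k = Σ ℕ λ n → n ≤ k × Reach P (entry P) m n b m'

    -- The branch actually taken contributes one summand of `cost`, and `sum-∈` bounds it by the
    -- whole sum; a loop pays such a sum once for each round.
    timed : ∀ v {B : Set} (P : Prog B) {m b m'} → Exec v P m b m' → Timed P m b m' (cost P v)
    timed-iter : ∀ v {A B : Set} ⦃ _ : Finite A ⦄ (body : A → Prog (A ⊎ B)) a₀ k {a m b m'} →
                 Iter (λ a → Exec v (body a)) k a m b m' →
                 Σ ℕ λ n → n ≤ k * sum (map (λ a → cost (body a) v) elems) ×
                           Reach (iter body a₀) (a , entry (body a)) m n b m'
    timed v (ret b)    (refl , refl) = 1 , ≤-refl , exit refl
    timed v (stp f)    (refl , refl) = 1 , ≤-refl , exit refl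
    timed v (bind P g) (a , m₁ , e₁ , e₂) with timed v P e₁ | timed v (g a) e₂
    ... | n₁ , le₁ , r₁ | n₂ , le₂ , r₂ =
      n₁ + n₂ , +-mono-≤ le₁ (≤-trans le₂ (sum-∈ (λ a → cost (g a) v) (complete a))) , reachL r₁ r₂
    timed v (iter body a) e = timed-iter v body a v e
    timed-iter v body a₀ (suc k) {a} (inj₁ e) with timed v (body a) e
    ... | n , le , r = n , ≤-trans (≤-trans le (sum-∈ (λ a → cost (body a) v) (complete a))) (m≤m+n _ _) , reach-last r
    timed-iter v body a₀ (suc k) {a} (inj₂ (a' , m₁ , e , i)) with timed v (body a) e | timed-iter v body a₀ k i
    ... | n₁ , le₁ , r₁ | n₂ , le₂ , r₂ =
      n₁ + n₂ , +-mono-≤ (≤-trans le₁ (sum-∈ (λ a → cost (body a) v) (complete a))) le₂ , reach-more r₁ r₂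

-- Executions of Turing machines

module _ (M : TM) (w : List Sym) where
  open TM M

  step-halted : ∀ c → Halted M c → step M w c ≡ c
  step-halted (mkConfig q ip ts o) h with halt q
  ... | true = refl
  step-halted (mkConfig q ip ts o) () | false

  stepTo : Fin nQ × Move × Vec (Fin (suc nΓ) × Move) tapes × Maybe Sym → Config M → Config M
  stepTo (q' , mi , acts , os) (mkConfig q ip ts o) =
    mkConfig q' (moveIn (length w) mi ip) (V.zipWith updTape ts acts) (outApp M o os)

  step-running : ∀ c → halt (Config.state c) ≡ false →
    step M w c ≡ stepTo (δ (Config.state c) (readIn w (Config.inPos c)) (V.map (headSym M) (Config.work c))) c
  step-running (mkConfig q ip ts o) h with halt q
  step-running (mkConfig q ip ts o) () | true
  ... | false with δ q (readIn w ip) (V.map (headSym M) ts)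
  ...   | _ = refl

  run-halted : ∀ t n → Halted M (run M w t) → run M w (n + t) ≡ run M w t
  run-halted t zero    h = refl
  run-halted t (suc n) h rewrite run-halted t n h = step-halted _ h

  run-halted-≤ : ∀ {t n} → t ≤ n → Halted M (run M w t) → run M w n ≡ run M w t
  run-halted-≤ {t} {n} le h = subst (λ k → run M w k ≡ run M w t) (m∸n+n≡m le) (run-halted t (n ∸ t) h)

  space-step : ∀ c → space M c ≤ space M (step M w c)
  space-step c = go (halt (Config.state c)) refl
    where
    grow : ∀ {n} (ts : Vec (Tape (Fin (suc nΓ))) n) acts →
           V.foldr (λ _ → ℕ) (λ t s → suc (Tape.maxpos t) + s) 0 ts ≤
           V.foldr (λ _ → ℕ) (λ t s → suc (Tape.maxpos t) + s) 0 (V.zipWith updTape ts acts)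
    grow []       []           = z≤n
    grow (t ∷ ts) (a ∷ acts) = +-mono-≤ (s≤s (m≤m⊔n (Tape.maxpos t) _)) (grow ts acts)

    go : ∀ h → halt (Config.state c) ≡ h → space M c ≤ space M (step M w c)
    go true  eq = ≤-reflexive (cong (space M) (sym (step-halted c eq)))
    go false eq = ≤-trans (grow (Config.work c) _) (≤-reflexive (cong (space M) (sym (step-running c eq))))

  space-mono : ∀ t n → space M (run M w t) ≤ space M (run M w (n + t))
  space-mono t zero    = ≤-refl
  space-mono t (suc n) = ≤-trans (space-mono t n) (space-step _)

  -- `maxpos` never decreases and a halted configuration is frozen, so the final configuration
  -- accounts for the space of the whole run.
  space-≤-halted : ∀ {T} → Halted M (run M w T) → ∀ t → space M (run M w t) ≤ space M (run M w T)
  space-≤-halted {T} h t = ≤-trans (space-mono t T)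
    (≤-reflexive (cong (space M) (trans (cong (run M w) (+-comm T t)) (run-halted T t h))))

-- Turing machines from programs

module Compile (T nΓ : ℕ) where
  open Machine T nΓ

  module _ (P : Prog Bool) where

    private
      fin = ⊎-finite ⦃ State-finite P ⦄ ⦃ Bool-finite ⦄

    stateCode : State P ⊎ Bool → Fin (length (Finite.elems fin))
    stateCode = encode (Finite.complete fin)

    stateOf : Fin (length (Finite.elems fin)) → State P ⊎ Bool
    stateOf = lookup (Finite.elems fin)

    halting accepting : State P ⊎ Bool → Bool
    halting (inj₁ _) = false
    halting (inj₂ _) = true
    accepting (inj₁ _) = false
    accepting (inj₂ b) = b

    δ-of : State P ⊎ Bool → Obs → Act × (State P ⊎ Bool)
    δ-of (inj₁ s) o = trans-of P s o
    δ-of (inj₂ b) o = noAct (proj₂ o) , inj₂ b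

    toTM : TM
    toTM = record
      { nQ = _ ; nΓ = nΓ ; tapes = T
      ; start = stateCode (inj₁ (entry P))
      ; halt = λ q → halting (stateOf q)
      ; accept = λ q → accepting (stateOf q)
      ; δ = λ q s γs → let (mi , acts) , r = δ-of (stateOf q) (s , γs) in stateCode r , mi , acts , nothing
      }

    module _ (w : List Sym) where
      open Run w

      cfg : State P ⊎ Bool → Mem → Config toTM
      cfg s (ip , ts) = mkConfig (stateCode s) ip ts []

      step-cfg : ∀ s m {α r} → trans-of P s (obs m) ≡ (α , r) →
                 step toTM w (cfg (inj₁ s) m) ≡ cfg r (apply α m)
      step-cfg s m@(ip , ts) {α} {r} e =
        trans (step-running toTM w (cfg (inj₁ s) m) (cong halting dec))
              (cong (λ { ((mi , acts) , r) → stepTo toTM w (stateCode r , mi , acts , nothing) (cfg (inj₁ s) m) })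
                    (trans (cong (λ σ → δ-of σ (obs m)) dec) e))
        where
        dec : stateOf (stateCode (inj₁ s)) ≡ inj₁ s
        dec = decode-encode (Finite.complete fin) (inj₁ s)

      run-reach : ∀ {s m n b m' t} → Reach P s m n b m' → run toTM w t ≡ cfg (inj₁ s) m →
                  run toTM w (n + t) ≡ cfg (inj₂ b) m'
      run-reach {s} {m} (exit e) h = trans (cong (step toTM w) h) (step-cfg s m e)
      run-reach {s} {m} {suc n} {b} {m'} {t} (next {s' = s'} e r) h =
        subst (λ k → run toTM w k ≡ cfg (inj₂ b) m') (+-suc n t)
          (run-reach r (trans (cong (step toTM w) h) (step-cfg s m e)))

      initMem : Mem
      initMem = 0 , V.replicate T (mkTape (λ _ → F.zero) 0 0)

      run-exec : ∀ {v b m'} → Exec v P initMem b m' →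
                 Σ ℕ λ n → n ≤ cost P v × run toTM w n ≡ cfg (inj₂ b) m'
      run-exec {v} {b} {m'} e with timed v P e
      ... | n , le , r = n , le , subst (λ k → run toTM w k ≡ cfg (inj₂ b) m') (+-identityʳ n) (run-reach r refl)

      cfg-halted : ∀ b m → Halted toTM (cfg (inj₂ b) m)
      cfg-halted b m = cong halting (decode-encode (Finite.complete fin) (inj₂ b))

      cfg-accept : ∀ b m → TM.accept toTM (Config.state (cfg (inj₂ b) m)) ≡ b
      cfg-accept b m = cong accepting (decode-encode (Finite.complete fin) (inj₂ b))

-- Binary registers on a work tape

-- One work tape holds all registers: cell 0 carries a left end mark, and the
-- r-th bits of the following cells are the binary digits of register r, least
-- significant first.

data RSym (K : ℕ) : Set where
  blank mark : RSym K
  dat        : Vec Bool K → RSym K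

instance
  RSym-finite : ∀ {K} → Finite (RSym K)
  RSym-finite .elems = blank ∷ mark ∷ map dat elems
  RSym-finite .complete blank   = here refl
  RSym-finite .complete mark    = there (here refl)
  RSym-finite .complete (dat c) = there (there (∈-map⁺ dat (complete c)))

module _ {K : ℕ} where
  at : List (Vec Bool K) → ℕ → RSym K
  at []       q       = blank
  at (c ∷ cs) zero    = dat c
  at (c ∷ cs) (suc q) = at cs q

  tapeSym : List (Vec Bool K) → ℕ → RSym K
  tapeSym cs zero    = mark
  tapeSym cs (suc q) = at cs q

  at-ʳ++ : ∀ ds {ys} q → at (ds ʳ++ ys) (length ds + q) ≡ at ys q
  at-ʳ++ []       q = refl
  at-ʳ++ (d ∷ ds) {ys} q =
    trans (cong (at (ds ʳ++ (d ∷ ys))) (sym (+-suc (length ds) q))) (at-ʳ++ ds (suc q))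

  upd-++ : ∀ ds rest c q →
           (if q ≡ᵇ length ds then dat c else at (ds ++ rest) q) ≡ at (ds ++ c ∷ drop 1 rest) q
  upd-++ []       []         c zero    = refl
  upd-++ []       []         c (suc q) = refl
  upd-++ []       (x ∷ rest) c zero    = refl
  upd-++ []       (x ∷ rest) c (suc q) = refl
  upd-++ (d ∷ ds) rest c zero    = refl
  upd-++ (d ∷ ds) rest c (suc q) = upd-++ ds rest c q

  -- The tape is seen as a zipper: `ds` lists the cells left of the head in reversed order, and
  -- positions are shifted by one because of the end mark. With `drop 1`, writing on the first blank
  -- appends a cell.
  upd-ʳ++ : ∀ ds rest c q →
            (if q ≡ᵇ suc (length ds) then dat c else tapeSym (ds ʳ++ rest) q) ≡ tapeSym (ds ʳ++ (c ∷ drop 1 rest)) q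
  upd-ʳ++ ds rest c zero = refl
  upd-ʳ++ ds rest c (suc q)
    rewrite ʳ++-defn ds {rest} | ʳ++-defn ds {c ∷ drop 1 rest} | sym (length-reverse ds) = upd-++ (reverse ds) rest c q

  at-end : ∀ cs → at cs (length cs) ≡ blank
  at-end []       = refl
  at-end (c ∷ cs) = at-end cs

  at-in : ∀ cs {q} → q < length cs → Σ (Vec Bool K) λ c → at cs q ≡ dat c
  at-in (c ∷ cs) {zero}  _       = c , refl
  at-in (c ∷ cs) {suc q} (s≤s l) = at-in cs l

-- The machine model writes on every tape in every step, so leaving a tape alone means rewriting the
-- scanned symbol. Tape contents are compared pointwise throughout.
noop-upd : {A : Set} (f : ℕ → A) (p : ℕ) (x : A) → f p ≡ x → ∀ q → (if q ≡ᵇ p then x else f q) ≡ f q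
noop-upd f zero    x e zero    = sym e
noop-upd f zero    x e (suc q) = refl
noop-upd f (suc p) x e zero    = refl
noop-upd f (suc p) x e (suc q) = noop-upd (f ∘ suc) p x e q

module Simulator (M : TM) (K : ℕ) where

  Cell = Vec Bool K

  Symbol : Set
  Symbol = RSym K × Fin (suc (TM.nΓ M))

  abstract
    nSym : ℕ
    nSym = length {A = Symbol} elems

    -- Symbol zero, the blank of the model, must decode to a blank in both components; this pair is
    -- therefore put in front of the enumeration, and every proper code comes after it.
    enc : Symbol → Fin (suc nSym)
    enc = encode {xs = (blank , F.zero) ∷ elems} (there ∘ complete)

    dec : Fin (suc nSym) → Symbol
    dec = lookup ((blank , F.zero) ∷ elems)

    dec-enc : ∀ x → dec (enc x) ≡ x
    dec-enc = decode-encode {xs = (blank , F.zero) ∷ elems} (there ∘ complete)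

    dec-zero : dec F.zero ≡ (blank , F.zero)
    dec-zero = refl

  open Machine (suc (TM.tapes M)) nSym public

  MTape = Tape (Fin (suc (TM.nΓ M)))

  onReg : {B : Set} → (RSym K → (RSym K × Move) × B) → Prog B
  onReg h = stp λ o →
    let (x , mv) , b = h (proj₁ (dec (V.head (proj₂ o))))
    in (S , (enc (x , F.zero) , mv) ∷ V.map (_, S) (V.tail (proj₂ o))) , b

  left : RSym K → (RSym K × Move) × (⊤ ⊎ ⊤)
  left mark = (mark , R) , inj₂ tt
  left x    = (x , L) , inj₁ tt

  module _ {A : Set} ⦃ _ : Finite A ⦄ (f : A → Cell → A × Cell) (fin : A → Maybe Cell) where
    right : A → RSym K → (RSym K × Move) × (A ⊎ A)
    right s (dat c) = (dat (proj₂ (f s c)) , R) , inj₁ (proj₁ (f s c))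
    right s x with fin s
    ... | just c  = (dat c , L) , inj₂ s
    ... | nothing = (x , L) , inj₂ s

    -- A finite automaton passes over all digits, least significant first, and may rewrite them;
    -- `fin` can append one cell, as a final carry requires. The way back ends on the cell to the
    -- right of the mark.
    sweep : A → Prog A
    sweep s = bind (iter (λ s → onReg (right s)) s) λ s' →
              bind (iter (λ _ → onReg left) tt) λ _ → ret s'

    swept : A → List Cell → A × List Cell
    swept s []       = s , fromMaybe (fin s)
    swept s (c ∷ cs) =
      proj₁ (swept (proj₁ (f s c)) cs) , proj₂ (f s c) ∷ proj₂ (swept (proj₁ (f s c)) cs)

  init-regs : Prog ⊤
  init-regs = onReg (λ _ → (mark , R) , tt)

  readSym : Prog (Maybe Sym)
  readSym = stp λ o → noAct (proj₂ o) , proj₁ o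

  moveHead : Move → Prog ⊤
  moveHead mv = stp λ o → (mv , V.map (_, S) (proj₂ o)) , tt

  -- The input move and the output symbol of `M` are returned instead of performed: the input of `M`
  -- exists only virtually, and its output is not stored.
  mstep : Fin (TM.nQ M) → Maybe Sym → Prog (Fin (TM.nQ M) × Move × Maybe Sym)
  mstep q s = stp λ o →
    let q' , mi , acts , os = TM.δ M q s (V.map (proj₂ ∘ dec) (V.tail (proj₂ o)))
    in (S , (V.head (proj₂ o) , S) ∷ V.map (λ am → enc (blank , proj₁ am) , proj₂ am) acts) , (q' , mi , os)

  record RegTape (cs : List Cell) (p : ℕ) (t : Tape Γ) : Set where
    constructor regTape
    field
      cells≡  : ∀ q → proj₁ (dec (Tape.cells t q)) ≡ tapeSym cs q
      pos≡    : Tape.pos t ≡ p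
      -- The head goes no further than the first blank, which lies one position after the mark and
      -- all cells.
      maxpos≤ : Tape.maxpos t ≤ suc (length cs)

  record SimTape (t : Tape Γ) (u : MTape) : Set where
    constructor simTape
    field
      cells≡  : ∀ q → proj₂ (dec (Tape.cells t q)) ≡ Tape.cells u q
      pos≡    : Tape.pos t ≡ Tape.pos u
      maxpos≤ : Tape.maxpos t ≤ Tape.maxpos u
      -- A step that leaves the copied tape alone still replaces its `maxpos` by the maximum with
      -- the current position; this field keeps that maximum below the space used by `M`.
      pos≤    : Tape.pos u ≤ Tape.maxpos u

  data Holds (cs : List Cell) (p : ℕ) (us : Vec MTape (TM.tapes M)) (ip : ℕ) : Mem → Set where
    holds : ∀ {t ts} → RegTape cs p t → Pointwise SimTape ts us → Holds cs p us ip (ip , t ∷ ts)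

  noop-sim : ∀ {t u} → SimTape t u → SimTape (updTape t (hd t , S)) u
  noop-sim {mkTape c p mx} (simTape c≡ p≡ m≤ p≤) = simTape
    (λ q → trans (cong (proj₂ ∘ dec) (noop-upd c p (c p) refl q)) (c≡ q)) p≡
    (⊔-lub m≤ (≤-trans (≤-reflexive p≡) p≤)) p≤

  noop-sims : ∀ {n} {ts : Vec (Tape Γ) n} {us : Vec MTape n} → Pointwise SimTape ts us →
              Pointwise SimTape (V.zipWith updTape ts (V.map (_, S) (V.map hd ts))) us
  noop-sims []       = []
  noop-sims (x ∷ xs) = noop-sim x ∷ noop-sims xs

  noop-reg : ∀ {cs p t} → RegTape cs p t → p ≤ suc (length cs) → RegTape cs p (updTape t (hd t , S))
  noop-reg {t = mkTape c p mx} (regTape c≡ refl m≤) p≤ = regTape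
    (λ q → trans (cong (proj₁ ∘ dec) (noop-upd c p (c p) refl q)) (c≡ q)) refl (⊔-lub m≤ p≤)

  act-sims : ∀ {n} {ts : Vec (Tape Γ) n} {us : Vec MTape n} → Pointwise SimTape ts us → ∀ acts →
             Pointwise SimTape (V.zipWith updTape ts (V.map (λ am → enc (blank , proj₁ am) , proj₂ am) acts))
                               (V.zipWith updTape us acts)
  act-sims [] [] = []
  act-sims {ts = mkTape c p mx ∷ _} {us = mkTape d _ mx' ∷ _} (simTape c≡ refl m≤ p≤ ∷ xs) ((a , mv) ∷ acts) =
    simTape cells refl (⊔-mono-≤ m≤ ≤-refl) (m≤n⊔m mx' (move mv p)) ∷ act-sims xs acts
    where
    cells : ∀ q → proj₂ (dec (if q ≡ᵇ p then enc (blank , a) else c q)) ≡ (if q ≡ᵇ p then a else d q)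
    cells q with q ≡ᵇ p
    ... | true  = cong proj₂ (dec-enc (blank , a))
    ... | false = c≡ q

  hd-sims : ∀ {n} {ts : Vec (Tape Γ) n} {us : Vec MTape n} → Pointwise SimTape ts us →
            V.map (proj₂ ∘ dec) (V.map hd ts) ≡ V.map (headSym M) us
  hd-sims [] = refl
  hd-sims (simTape c≡ refl _ _ ∷ xs) = cong₂ _∷_ (c≡ _) (hd-sims xs)

  module Spec (w : List Sym) (v : ℕ) where
    open Run w

    onReg-exec : ∀ {B} (h : RSym K → (RSym K × Move) × B) {cs p us ip m x y mv b cs'} →
      Holds cs p us ip m → tapeSym cs p ≡ x → h x ≡ ((y , mv) , b) →
      (∀ q → (if q ≡ᵇ p then y else tapeSym cs q) ≡ tapeSym cs' q) →
      length cs ≤ length cs' → move mv p ≤ suc (length cs') →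
      Σ Mem λ m' → Exec v (onReg h) m b m' × Holds cs' (move mv p) us ip m'
    onReg-exec h {cs} {p} {us} {ip} {y = y} {mv} {b} {cs'} (holds {t = mkTape c _ mx} {ts} (regTape c≡ refl m≤) sim) refl hx upd le pl
      = _ , (cong proj₂ hx' , refl) , subst (λ z → Holds cs' (move mv p) us ip (ip , updTape (mkTape c p mx) z ∷ ts'))
              (cong (λ (z : (RSym K × Move) × _) → enc (proj₁ (proj₁ z) , F.zero) , proj₂ (proj₁ z)) (sym hx')) h'
      where
      ts' = V.zipWith updTape ts (V.map (_, S) (V.map hd ts))
      hx' : h (proj₁ (dec (c p))) ≡ ((y , mv) , b)
      hx' = trans (cong h (c≡ p)) hx
      cells : ∀ q → proj₁ (dec (if q ≡ᵇ p then enc (y , F.zero) else c q)) ≡ (if q ≡ᵇ p then y else tapeSym cs q)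
      cells q with q ≡ᵇ p
      ... | true  = cong proj₁ (dec-enc (y , F.zero))
      ... | false = c≡ q
      h' : Holds cs' (move mv p) us ip (ip , updTape (mkTape c p mx) (enc (y , F.zero) , mv) ∷ ts')
      h' = holds (regTape (λ q → trans (cells q) (upd q)) refl (⊔-lub (≤-trans m≤ (s≤s le)) pl)) (noop-sims sim)

    module _ {A : Set} ⦃ _ : Finite A ⦄ (f : A → Cell → A × Cell) (fin : A → Maybe Cell) where

      right-exec : ∀ rest ds s {k us ip m} → length rest < k →
        Holds (ds ʳ++ rest) (suc (length ds)) us ip m →
        Σ Mem λ m' → Iter (λ s → Exec v (onReg (right f fin s))) k s m (proj₁ (swept f fin s rest)) m' ×
                     Holds (ds ʳ++ proj₂ (swept f fin s rest)) (length ds + length rest) us ip m'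
      right-exec [] ds s {suc k} {us} {ip} {m} _ H =
        subst (λ n → Σ Mem λ m' → Iter (λ s → Exec v (onReg (right f fin s))) (suc k) s m s m' × Holds (ds ʳ++ proj₂ (swept f fin s [])) n us ip m')
              (sym (+-identityʳ (length ds))) stop
        where
        end : tapeSym (ds ʳ++ []) (suc (length ds)) ≡ blank
        end = trans (cong (at (ds ʳ++ [])) (sym (+-identityʳ (length ds)))) (at-ʳ++ ds 0)
        stop : Σ Mem λ m' → Iter (λ s → Exec v (onReg (right f fin s))) (suc k) s m s m' × Holds (ds ʳ++ proj₂ (swept f fin s [])) (length ds) us ip m'
        stop with fin s in eq
        ... | just c with onReg-exec (right f fin s) {y = dat c} {mv = L} {b = inj₂ s} {cs' = ds ʳ++ (c ∷ [])} H end (lem eq) (upd-ʳ++ ds [] c)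
                       (≤-trans (≤-reflexive (length-ʳ++ ds)) (≤-trans (+-monoʳ-≤ (length ds) z≤n) (≤-reflexive (sym (length-ʳ++ ds)))))
                       (≤-trans (m≤m+n (length ds) 1) (≤-trans (≤-reflexive (sym (length-ʳ++ ds))) (n≤1+n _)))
          where
          lem : fin s ≡ just c → right f fin s blank ≡ ((dat c , L) , inj₂ s)
          lem e rewrite e = refl
        ...   | m' , e , H' = m' , inj₁ e , H'
        stop | nothing with onReg-exec (right f fin s) {y = blank} {mv = L} {b = inj₂ s} {cs' = ds ʳ++ []} H end (lem eq)
                       (noop-upd (tapeSym (ds ʳ++ [])) (suc (length ds)) blank end) ≤-refl
                       (≤-trans (m≤m+n (length ds) 0) (≤-trans (≤-reflexive (sym (length-ʳ++ ds))) (n≤1+n _)))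
          where
          lem : fin s ≡ nothing → right f fin s blank ≡ ((blank , L) , inj₂ s)
          lem e rewrite e = refl
        ...   | m' , e , H' = m' , inj₁ e , H'
      right-exec (c ∷ rest) ds s {suc k} {us} {ip} (s≤s lt) H
        with onReg-exec (right f fin s) H
               (trans (cong (at (ds ʳ++ (c ∷ rest))) (sym (+-identityʳ (length ds)))) (at-ʳ++ ds 0)) refl
               (upd-ʳ++ ds (c ∷ rest) (proj₂ (f s c)))
               (≤-reflexive (trans (length-ʳ++ ds) (sym (length-ʳ++ ds))))
               (s≤s (≤-trans (≤-trans (≤-reflexive (sym (+-comm (length ds) 1))) (+-monoʳ-≤ (length ds) (s≤s z≤n)))
                             (≤-reflexive (sym (length-ʳ++ ds)))))
      ... | m₁ , e₁ , H₁ with right-exec rest (proj₂ (f s c) ∷ ds) (proj₁ (f s c)) lt H₁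
      ...   | m' , i , H' = m' , inj₂ (_ , _ , e₁ , i) , subst (λ n → Holds (ds ʳ++ (proj₂ (f s c) ∷ proj₂ (swept f fin (proj₁ (f s c)) rest))) n us ip m') (sym (+-suc (length ds) (length rest))) H'

      left-exec : ∀ p {cs k us ip m} → p < k → p ≤ length cs → Holds cs p us ip m →
        Σ Mem λ m' → Iter (λ _ → Exec v (onReg (left))) k tt m tt m' × Holds cs 1 us ip m'
      left-exec zero {cs} {suc k} _ _ H
        with onReg-exec (left) {cs' = cs} H refl refl (noop-upd (tapeSym cs) 0 mark refl) ≤-refl (s≤s z≤n)
      ... | m' , e , H' = m' , inj₁ e , H'
      left-exec (suc p) {cs} {suc k} (s≤s lt) le H with at-in cs le
      ... | c , eq
        with onReg-exec (left) {cs' = cs} H eq refl (noop-upd (tapeSym cs) (suc p) (dat c) eq) ≤-refl (≤-trans (<⇒≤ le) (n≤1+n _))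
      ... | m₁ , e₁ , H₁ with left-exec p lt (<⇒≤ le) H₁
      ...   | m' , i , H' = m' , inj₂ (tt , m₁ , e₁ , i) , H'

      swept-length : ∀ s cs → length cs ≤ length (proj₂ (swept f fin s cs))
      swept-length s []       = z≤n
      swept-length s (c ∷ cs) = s≤s (swept-length _ cs)

      sweep-exec : ∀ s cs {us ip m} → length cs < v → Holds cs 1 us ip m →
        Σ Mem λ m' → Exec v (sweep f fin s) m (proj₁ (swept f fin s cs)) m' ×
                     Holds (proj₂ (swept f fin s cs)) 1 us ip m'
      sweep-exec s cs lt H with right-exec cs [] s lt H
      ... | m₁ , i₁ , H₁ with left-exec (length cs) lt (swept-length s cs) H₁
      ...   | m₂ , i₂ , holds r sim = _ , (_ , m₁ , i₁ , tt , m₂ , i₂ , refl , refl) ,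
                                      holds (noop-reg r (s≤s z≤n)) (noop-sims sim)

    init-exec : ∀ {us ip t ts} → (∀ q → Tape.cells t q ≡ F.zero) → Tape.pos t ≡ 0 → Tape.maxpos t ≡ 0 →
      Pointwise SimTape ts us →
      Σ Mem λ m' → Exec v init-regs (ip , t ∷ ts) tt m' × Holds [] 1 us ip m'
    init-exec {t = mkTape c p mx} c≡ refl refl sim = _ , (refl , refl) , holds (regTape cells refl ≤-refl) (noop-sims sim)
      where
      cells : ∀ q → proj₁ (dec (if q ≡ᵇ 0 then enc (mark , F.zero) else c q)) ≡ tapeSym [] q
      cells zero    = cong proj₁ (dec-enc (mark , F.zero))
      cells (suc q) = trans (cong (proj₁ ∘ dec) (c≡ (suc q))) (cong proj₁ dec-zero)

    readSym-exec : ∀ {cs us ip m} → Holds cs 1 us ip m →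
      Σ Mem λ m' → Exec v readSym m (readIn w ip) m' × Holds cs 1 us ip m'
    readSym-exec (holds r sim) = _ , (refl , refl) , holds (noop-reg r (s≤s z≤n)) (noop-sims sim)

    moveHead-exec : ∀ mv {cs us ip m} → Holds cs 1 us ip m →
      Σ Mem λ m' → Exec v (moveHead mv) m tt m' × Holds cs 1 us (moveIn (length w) mv ip) m'
    moveHead-exec mv (holds r sim) = _ , (refl , refl) , holds (noop-reg r (s≤s z≤n)) (noop-sims sim)

    mstep-exec : ∀ q s {cs us ip m} → Holds cs 1 us ip m →
      let q' , mi , acts , os = TM.δ M q s (V.map (headSym M) us) in
      Σ Mem λ m' → Exec v (mstep q s) m (q' , mi , os) m' × Holds cs 1 (V.zipWith updTape us acts) ip m'
    mstep-exec q s (holds r sim) rewrite sym (hd-sims sim) =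
      _ , (refl , refl) , holds (noop-reg r (s≤s z≤n)) (act-sims sim _)

-- Register arithmetic and a calculus of weakest preconditions

n<2^n : ∀ n → n < 2 ^ n
n<2^n zero    = s≤s z≤n
n<2^n (suc n) = begin
  suc (suc n)    ≤⟨ +-mono-≤ (m^n>0 2 n) (n<2^n n) ⟩
  2 ^ n + 2 ^ n  ≡⟨ cong (2 ^ n +_) (sym (+-identityʳ _)) ⟩
  2 ^ suc n      ∎
  where open ≤-Reasoning

b2n : Bool → ℕ
b2n true  = 1
b2n false = 0

data BinEq : Bool → ℕ → ℕ → Set where
  equal   : ∀ {x} → BinEq true x x
  unequal : ∀ {x y} → x ≢ y → BinEq false x y

binEq-map : ∀ (f : ℕ → ℕ) → (∀ {x y} → f x ≡ f y → x ≡ y) → ∀ {b x y} → BinEq b x y → BinEq b (f x) (f y)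
binEq-map f inj equal       = equal
binEq-map f inj (unequal n) = unequal (n ∘ inj)

binEq-elim : ∀ {b x y} (P : Bool → Set) → BinEq b x y → (x ≡ y → P true) → (x ≢ y → P false) → P b
binEq-elim P equal        t f = t refl
binEq-elim P (unequal ne) t f = f ne

module Arith {K : ℕ} where

  val : Fin K → List (Vec Bool K) → ℕ
  val r []       = 0
  val r (c ∷ cs) = b2n (V.lookup c r) + 2 * val r cs

module Registers (M : TM) (K : ℕ) where
  open Simulator M K public
  open Arith {K}

  never : {A : Set} → A → Maybe Cell
  never _ = nothing

  -- A half adder whose state is the carry; `decF` is the corresponding half subtractor, with the
  -- borrow as state.
  incF : Fin K → Bool → Cell → Bool × Cell
  incF r c x = c ∧ V.lookup x r , x [ r ]≔ (c xor V.lookup x r)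

  incE : Fin K → Bool → Maybe Cell
  incE r true  = just (V.replicate K false [ r ]≔ true)
  incE r false = nothing

  decF : Fin K → Bool → Cell → Bool × Cell
  decF r c x = c ∧ not (V.lookup x r) , x [ r ]≔ (c xor V.lookup x r)

  posF : Fin K → Bool → Cell → Bool × Cell
  posF r s x = s ∨ V.lookup x r , x

  eqF : Fin K → Fin K → Bool → Cell → Bool × Cell
  eqF r r' s x = s ∧ not (V.lookup x r xor V.lookup x r') , x

  cpyF : Fin K → Fin K → ⊤ → Cell → ⊤ × Cell
  cpyF r r' _ x = tt , x [ r ]≔ V.lookup x r'

  opaque
    inc : Fin K → Prog ⊤
    inc r = bind (sweep (incF r) (incE r) true) λ _ → ret tt

    -- A first sweep looks for a nonzero digit, so that a register holding 0 is left unchanged. The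
    -- Boolean tells whether something was subtracted and serves as the test of all counting loops.
    decr : Fin K → Prog Bool
    decr r = bind (sweep (posF r) never false) λ
      { false → ret false
      ; true  → bind (sweep (decF r) never true) λ _ → ret true }

    eq : Fin K → Fin K → Prog Bool
    eq r r' = sweep (eqF r r') never true

    cpy : Fin K → Fin K → Prog ⊤
    cpy r r' = sweep (cpyF r r') never tt

  module _ (r : Fin K) where
    inc-val : ∀ c cs → val r (proj₂ (swept (incF r) (incE r) c cs)) ≡ b2n c + val r cs
    inc-val true  [] = cong (λ b → b2n b + 0) (VP.lookup∘updateAt r (V.replicate K false))
    inc-val false [] = refl
    inc-val c (x ∷ cs)
      rewrite inc-val (c ∧ V.lookup x r) cs | VP.lookup∘updateAt r {λ _ → c xor V.lookup x r} x
      with c | V.lookup x r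
    ... | false | b     = refl
    ... | true  | false = refl
    ... | true  | true  = lem (val r cs)
      where
      lem : ∀ a → 2 * (1 + a) ≡ 1 + (1 + 2 * a)
      lem = solve-∀

    -- The tape grows only if a carry leaves the top digit. The new top digit of `r` is then 1, so
    -- the value of `r` is at least half of two to the length: growth can be charged to a register
    -- value.
    inc-length : ∀ c cs → let cs' = proj₂ (swept (incF r) (incE r) c cs) in
                 2 ^ length cs' ≤ 2 ^ length cs ⊎ 2 ^ length cs' ≤ 2 * val r cs'
    inc-length true  [] rewrite VP.lookup∘updateAt r {λ _ → true} (V.replicate K false) = inj₂ ≤-refl
    inc-length false [] = inj₁ ≤-refl
    inc-length c (x ∷ cs) with inc-length (c ∧ V.lookup x r) cs
    ... | inj₁ le = inj₁ (*-monoʳ-≤ 2 le)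
    ... | inj₂ le = inj₂ (*-monoʳ-≤ 2 (≤-trans le (m≤n+m _ (b2n (V.lookup (x [ r ]≔ (c xor V.lookup x r)) r)))))

    dec-id : ∀ cs → val r (proj₂ (swept (decF r) never false cs)) ≡ val r cs
    dec-id [] = refl
    dec-id (x ∷ cs) rewrite dec-id cs | VP.lookup∘updateAt r {λ _ → V.lookup x r} x = refl

    dec-val : ∀ cs n → val r cs ≡ suc n → val r (proj₂ (swept (decF r) never true cs)) ≡ n
    dec-val (x ∷ cs) n e rewrite VP.lookup∘updateAt r {λ _ → not (V.lookup x r)} x with V.lookup x r
    dec-val (x ∷ cs) n e | true = trans (cong (2 *_) (dec-id cs)) (suc-injective e)
    ... | false with val r cs in eq
    dec-val (x ∷ cs) n () | false | zero
    ... | suc k rewrite dec-val cs k eq = suc-injective (trans (lem k) e)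
      where
      lem : ∀ k → 1 + (1 + 2 * k) ≡ 2 * (1 + k)
      lem = solve-∀

    pos-true : ∀ cs → proj₁ (swept (posF r) never true cs) ≡ true
    pos-true []       = refl
    pos-true (x ∷ cs) = pos-true cs

    pos-zero : ∀ cs → val r cs ≡ 0 → proj₁ (swept (posF r) never false cs) ≡ false
    pos-zero [] e = refl
    pos-zero (x ∷ cs) e with V.lookup x r
    pos-zero (x ∷ cs) () | true
    ... | false = pos-zero cs (m+n≡0⇒m≡0 (val r cs) e)

    pos-suc : ∀ cs n → val r cs ≡ suc n → proj₁ (swept (posF r) never false cs) ≡ true
    pos-suc (x ∷ cs) n e with V.lookup x r
    ... | true = pos-true cs
    ... | false with val r cs in eq
    pos-suc (x ∷ cs) n () | false | zero
    ... | suc k = pos-suc cs k eq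

    pos-id : ∀ s cs → proj₂ (swept (posF r) never s cs) ≡ cs
    pos-id s []       = refl
    pos-id s (x ∷ cs) = cong (x ∷_) (pos-id _ cs)

    module _ (r' : Fin K) where
      eq-id : ∀ s cs → proj₂ (swept (eqF r r') never s cs) ≡ cs
      eq-id s []       = refl
      eq-id s (x ∷ cs) = cong (x ∷_) (eq-id _ cs)

      eq-false : ∀ cs → proj₁ (swept (eqF r r') never false cs) ≡ false
      eq-false []       = refl
      eq-false (x ∷ cs) = eq-false cs

      eq-val : ∀ cs → BinEq (proj₁ (swept (eqF r r') never true cs)) (val r cs) (val r' cs)
      eq-val [] = equal
      eq-val (x ∷ cs) with V.lookup x r | V.lookup x r'
      ... | true  | false rewrite eq-false cs = unequal (λ e → even≢odd (val r' cs) (val r cs) (sym e))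
      ... | false | true  rewrite eq-false cs = unequal (even≢odd (val r cs) (val r' cs))
      ... | true  | true  = binEq-map (λ x → suc (2 * x)) (λ e → *-cancelˡ-≡ _ _ 2 (suc-injective e)) (eq-val cs)
      ... | false | false = binEq-map (2 *_) (*-cancelˡ-≡ _ _ 2) (eq-val cs)

      cpy-val : ∀ cs → val r (proj₂ (swept (cpyF r r') never tt cs)) ≡ val r' cs
      cpy-val [] = refl
      cpy-val (x ∷ cs) rewrite cpy-val cs | VP.lookup∘updateAt r {λ _ → V.lookup x r'} x = refl

    module _ {A : Set} ⦃ _ : Finite A ⦄ (f : A → Cell → A × Cell) (fin : A → Maybe Cell) where
      frame : ∀ {r'} → (∀ s x → V.lookup (proj₂ (f s x)) r' ≡ V.lookup x r') →
              (∀ s c → fin s ≡ just c → V.lookup c r' ≡ false) →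
              ∀ s cs → val r' (proj₂ (swept f fin s cs)) ≡ val r' cs
      frame hf hfin s [] with fin s in e
      ... | nothing = refl
      ... | just c rewrite hfin s c e = refl
      frame hf hfin s (x ∷ cs) rewrite hf s x | frame hf hfin (proj₁ (f s x)) cs = refl

  never-length : ∀ {A : Set} ⦃ _ : Finite A ⦄ (f : A → Cell → A × Cell) s cs →
                 length (proj₂ (swept f never s cs)) ≡ length cs
  never-length f s []       = refl
  never-length f s (x ∷ cs) = cong suc (never-length f _ cs)

  record St : Set where
    constructor mkSt
    field
      regs : Vec ℕ K
      ip   : ℕ
      sims : Vec MTape (TM.tapes M)

  open St public

  _[_↦_] : St → Fin K → ℕ → St
  mkSt ρ i us [ r ↦ x ] = mkSt (ρ [ r ]≔ x) i us

  -- U bounds every register value, so that the register tape has length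
  -- O(log U); 2 * U bounds the number of iterations of every loop.
  module Logic (w : List Sym) (U : ℕ) where
    open Run w public
    open Spec w (2 * U) public

    record Rep (s : St) (m : Mem) : Set where
      constructor rep
      field
        {cs}    : List Cell
        holding : Holds cs 1 (sims s) (ip s) m
        values  : ∀ r → val r cs ≡ V.lookup (regs s) r
        -- The factor 2 is the gap between a number and the next power of two, as supplied by
        -- `inc-length`.
        short   : 2 ^ length cs ≤ 2 * U

    -- `Exec` limits every loop to `2 * U` rounds, so such a triple implies termination within
    -- `cost` steps; and since `Rep` limits the tape, it yields the space bound as well.
    record wp {B : Set} (P : Prog B) (Q : B → St → Set) (s : St) : Set where
      constructor mkwp
      field
        exec : ∀ {m} → Rep s m → Σ B λ b → Σ St λ s' → Σ Mem λ m' →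
               Exec (2 * U) P m b m' × Rep s' m' × Q b s'

    record wpI {A B : Set} (body : A → Prog (A ⊎ B)) (k : ℕ) (a : A) (Q : B → St → Set) (s : St) : Set where
      constructor mkwpI
      field
        exec : ∀ {m} → Rep s m → Σ B λ b → Σ St λ s' → Σ Mem λ m' →
               Iter (λ a → Exec (2 * U) (body a)) k a m b m' × Rep s' m' × Q b s'

    [_∣_] : {A B : Set} → (A → St → Set) → (B → St → Set) → A ⊎ B → St → Set
    [ Q ∣ Q' ] (inj₁ a) = Q a
    [ Q ∣ Q' ] (inj₂ b) = Q' b

    wp-conseq : ∀ {B} {P : Prog B} {Q Q' s} → (∀ b s' → Q b s' → Q' b s') → wp P Q s → wp P Q' s
    wp-conseq h (mkwp e) = mkwp λ r → let b , s' , m' , x , r' , q = e r in b , s' , m' , x , r' , h b s' q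

    wp-bind : ∀ {A B} ⦃ _ : Finite A ⦄ {P : Prog A} {g : A → Prog B} {Q s} →
              wp P (λ a s' → wp (g a) Q s') s → wp (bind P g) Q s
    wp-bind (mkwp e) = mkwp λ r →
      let a , s₁ , m₁ , x , r₁ , mkwp e' = e r
          b , s₂ , m₂ , y , r₂ , q = e' r₁
      in b , s₂ , m₂ , (a , m₁ , x , y) , r₂ , q

    wp-ret : ∀ {B b Q s} → Q b s → wp {B} (ret b) Q s
    wp-ret q = mkwp λ where
      (rep (holds t sim) vs sh) → _ , _ , _ , (refl , refl) , rep (holds (noop-reg t (s≤s z≤n)) (noop-sims sim)) vs sh , q

    wpI-step : ∀ {A B} {body : A → Prog (A ⊎ B)} {k a Q s} →
               wp (body a) [ (λ a' s' → wpI body k a' Q s') ∣ Q ] s → wpI body (suc k) a Q s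
    wpI-step (mkwp e) = mkwpI λ r → case e r of λ where
      (inj₁ a' , s₁ , m₁ , x , r₁ , mkwpI e') →
        let b , s₂ , m₂ , y , r₂ , q = e' r₁ in b , s₂ , m₂ , inj₂ (a' , m₁ , x , y) , r₂ , q
      (inj₂ b , s₁ , m₁ , x , r₁ , q) → b , s₁ , m₁ , inj₁ x , r₁ , q

    iter-mono : ∀ {A B : Set} {body : A → Mem → A ⊎ B → Mem → Set} {k k' a m b m'} → k ≤ k' →
                Iter body k a m b m' → Iter body k' a m b m'
    iter-mono (s≤s le) (inj₁ x)                  = inj₁ x
    iter-mono (s≤s le) (inj₂ (a' , m₁ , x , i)) = inj₂ (a' , m₁ , x , iter-mono le i)

    wp-iter : ∀ {A B} ⦃ _ : Finite A ⦄ {body : A → Prog (A ⊎ B)} {k a Q s} → k ≤ 2 * U →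
              wpI body k a Q s → wp (iter body a) Q s
    wp-iter le (mkwpI e) = mkwp λ r → let b , s' , m' , x , r' , q = e r in b , s' , m' , iter-mono le x , r' , q

    wpI-mono : ∀ {A B} {body : A → Prog (A ⊎ B)} {k k' a Q s} → k ≤ k' → wpI body k a Q s → wpI body k' a Q s
    wpI-mono le (mkwpI e) = mkwpI λ r → let b , s' , m' , x , r' , q = e r in b , s' , m' , iter-mono le x , r' , q

    wpI-conseq : ∀ {A B} {body : A → Prog (A ⊎ B)} {k a Q Q' s} → (∀ b s' → Q b s' → Q' b s') →
                 wpI body k a Q s → wpI body k a Q' s
    wpI-conseq h (mkwpI e) = mkwpI λ r → let b , s' , m' , x , r' , q = e r in b , s' , m' , x , r' , h b s' q

    private
      short→ : ∀ {cs : List Cell} → 2 ^ length cs ≤ 2 * U → length cs < 2 * U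
      short→ {cs} h = ≤-trans (n<2^n (length cs)) h

    opaque
      unfolding inc

      wp-inc : ∀ r {Q s} → V.lookup (regs s) r < U → Q tt (s [ r ↦ suc (V.lookup (regs s) r) ]) → wp (inc r) Q s
      wp-inc r {Q} {s} lt q = mkwp λ { (rep {cs} H vs sh) →
        let m₁ , x , H₁ = sweep-exec (incF r) (incE r) true cs (short→ {cs} sh) H
            b , _ , m₂ , y , rep' , q' = wp.exec (wp-ret {b = tt} {Q} q) (rep H₁ (vals cs vs) (shrt cs vs sh))
        in b , _ , m₂ , (_ , m₁ , x , y) , rep' , q' }
        where
        out : List Cell → List Cell
        out cs = proj₂ (swept (incF r) (incE r) true cs)
        vals : ∀ cs → (∀ r' → val r' cs ≡ V.lookup (regs s) r') → ∀ r' → val r' (out cs) ≡ V.lookup (regs s [ r ]≔ suc (V.lookup (regs s) r)) r'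
        vals cs vs r' with r' F.≟ r
        ... | yes refl = trans (inc-val r true cs) (trans (cong suc (vs r)) (sym (VP.lookup∘updateAt r (regs s))))
        ... | no  ne = trans (frame r (incF r) (incE r) (λ _ x → VP.lookup∘updateAt′ r' r ne x)
                                (λ { true .(_) refl → trans (VP.lookup∘updateAt′ r' r ne (V.replicate K false)) (VP.lookup-replicate r' false) }) true cs)
                             (trans (vs r') (sym (VP.lookup∘updateAt′ r' r ne (regs s))))
        shrt : ∀ cs → (∀ r' → val r' cs ≡ V.lookup (regs s) r') → 2 ^ length cs ≤ 2 * U → 2 ^ length (out cs) ≤ 2 * U
        shrt cs vs sh with inc-length r true cs
        ... | inj₁ le = ≤-trans le sh
        -- The tape has grown, so its length is charged to the new value of `r`, which is at most
        -- `U`.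
        ... | inj₂ le = ≤-trans le (*-monoʳ-≤ 2 (≤-trans (≤-reflexive (trans (inc-val r true cs) (cong suc (vs r)))) lt))

    sweep-wp : ∀ {A} ⦃ _ : Finite A ⦄ (f : A → Cell → A × Cell) {a s s' cs m} →
               Holds cs 1 (sims s) (ip s) m → 2 ^ length cs ≤ 2 * U →
               sims s ≡ sims s' → ip s ≡ ip s' →
               (∀ r → val r (proj₂ (swept f never a cs)) ≡ V.lookup (regs s') r) →
               Σ Mem λ m' → Exec (2 * U) (sweep f never a) m (proj₁ (swept f never a cs)) m' × Rep s' m'
    sweep-wp f {a} {cs = cs} H sh refl refl vs with sweep-exec f never a cs (short→ {cs} sh) H
    ... | m' , x , H' = m' , x , rep H' vs (≤-trans (≤-reflexive (cong (2 ^_) (never-length f a cs))) sh)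

    opaque
      unfolding cpy

      wp-cpy : ∀ r r' {Q s} → Q tt (s [ r ↦ V.lookup (regs s) r' ]) → wp (cpy r r') Q s
      wp-cpy r r' {Q} {s} q = mkwp λ { (rep {cs} H vs sh) →
        let m' , x , hold = sweep-wp (cpyF r r') {s = s} {s' = s [ r ↦ V.lookup (regs s) r' ]} H sh refl refl (vals cs vs)
        in tt , _ , m' , x , hold , q }
        where
        vals : ∀ cs → (∀ r' → val r' cs ≡ V.lookup (regs s) r') →
               ∀ r″ → val r″ (proj₂ (swept (cpyF r r') never tt cs)) ≡ V.lookup (regs s [ r ]≔ V.lookup (regs s) r') r″
        vals cs vs r″ with r″ F.≟ r
        ... | yes refl = trans (cpy-val r r' cs) (trans (vs r') (sym (VP.lookup∘updateAt r (regs s))))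
        ... | no  ne = trans (frame r (cpyF r r') never (λ _ x → VP.lookup∘updateAt′ r″ r ne x) (λ _ _ ()) tt cs)
                             (trans (vs r″) (sym (VP.lookup∘updateAt′ r″ r ne (regs s))))

    opaque
      unfolding eq

      wp-eq : ∀ r r' {Q s} → (∀ {b} → BinEq b (V.lookup (regs s) r) (V.lookup (regs s) r') → Q b s) → wp (eq r r') Q s
      wp-eq r r' {Q} {s} q = mkwp λ { (rep {cs} H vs sh) →
        let m' , x , hold = sweep-wp (eqF r r') {s = s} {s' = s} H sh refl refl
                           (λ r″ → trans (cong (val r″) (eq-id r r' true cs)) (vs r″))
        in _ , _ , m' , x , hold , q (subst₂ (BinEq _) (vs r) (vs r') (eq-val r r' cs)) }

    opaque
      unfolding decr

      wp-decr : ∀ r {Q s} → (V.lookup (regs s) r ≡ 0 → Q false s) →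
                (∀ n → V.lookup (regs s) r ≡ suc n → Q true (s [ r ↦ n ])) → wp (decr r) Q s
      wp-decr r {Q} {s} qz qs = go (V.lookup (regs s) r) refl
        where
        go : ∀ n → V.lookup (regs s) r ≡ n → wp (decr r) Q s
        go zero e = mkwp λ { (rep {cs} H vs sh) →
          let m₁ , x , hold = sweep-wp (posF r) {s = s} {s' = s} H sh refl refl
                            (λ r″ → trans (cong (val r″) (pos-id r false cs)) (vs r″))
              b , _ , m₂ , y , rep' , q' = wp.exec (wp-ret {b = false} {Q} (qz e)) hold
          in b , _ , m₂ , (false , m₁ , subst (λ z → Exec (2 * U) (sweep (posF r) never false) _ z m₁) (pos-zero r cs (trans (vs r) e)) x , y) , rep' , q' }
        go (suc n) e = mkwp λ { (rep {cs} H vs sh) →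
          let m₁ , x , rep {cs₁} H₁ vs₁ sh₁ = sweep-wp (posF r) {s = s} {s' = s} H sh refl refl
                            (λ r″ → trans (cong (val r″) (pos-id r false cs)) (vs r″))
              m₂ , x₂ , hold₂ = sweep-wp (decF r) {s = s} {s' = s [ r ↦ n ]} H₁ sh₁ refl refl (vals cs₁ vs₁)
              b , _ , m₃ , y , rep' , q' = wp.exec (wp-ret {b = true} {Q} (qs n e)) hold₂
          in b , _ , m₃ , (true , m₁ , subst (λ z → Exec (2 * U) (sweep (posF r) never false) _ z m₁) (pos-suc r cs n (trans (vs r) e)) x
                          , _ , m₂ , x₂ , y) , rep' , q' }
          where
          vals : ∀ cs → (∀ r' → val r' cs ≡ V.lookup (regs s) r') →
                 ∀ r″ → val r″ (proj₂ (swept (decF r) never true cs)) ≡ V.lookup (regs s [ r ]≔ n) r″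
          vals cs vs r″ with r″ F.≟ r
          ... | yes refl = trans (dec-val r cs n (trans (vs r) e)) (sym (VP.lookup∘updateAt r (regs s)))
          ... | no  ne = trans (frame r (decF r) never (λ _ x → VP.lookup∘updateAt′ r″ r ne x) (λ _ _ ()) true cs)
                               (trans (vs r″) (sym (VP.lookup∘updateAt′ r″ r ne (regs s))))

    wp-read : ∀ {Q s} → Q (readIn w (ip s)) s → wp readSym Q s
    wp-read q = mkwp λ { (rep H vs sh) → let m' , x , H' = readSym-exec H in _ , _ , m' , x , rep H' vs sh , q }

    wp-move : ∀ mv {Q s} → Q tt (mkSt (regs s) (moveIn (length w) mv (ip s)) (sims s)) → wp (moveHead mv) Q s
    wp-move mv q = mkwp λ { (rep H vs sh) → let m' , x , H' = moveHead-exec mv H in _ , _ , m' , x , rep H' vs sh , q }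

    wp-mstep : ∀ q s {Q σ} →
      (let q' , mi , acts , os = TM.δ M q s (V.map (headSym M) (sims σ)) in
       Q (q' , mi , os) (mkSt (regs σ) (ip σ) (V.zipWith updTape (sims σ) acts))) → wp (mstep q s) Q σ
    wp-mstep q s k = mkwp λ { (rep H vs sh) → let m' , x , H' = mstep-exec q s H in _ , _ , m' , x , rep H' vs sh , k }

-- Binary codes of numbers

encℕ-odd : ∀ n → encℕ (1 + 2 * n) ≡ s0 ∷ encℕ n
encℕ-odd n = cong encℕᵇ (begin
  toBin (1 + 2 * n)                     ≡⟨ cong (λ m → toBin (1 + 2 * m)) (sym (ofBin-toBin n)) ⟩
  toBin (ofBin (1+[2 toBin n ]))        ≡⟨ toBin-ofBin _ ⟩
  1+[2 toBin n ]                        ∎)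
  where open ≡-Reasoning

encℕ-even : ∀ n → encℕ (2 + 2 * n) ≡ s1 ∷ encℕ n
encℕ-even n = cong encℕᵇ (begin
  toBin (2 + 2 * n)                     ≡⟨ cong toBin (lem n) ⟩
  toBin (2 * (1 + n))                   ≡⟨ cong (λ m → toBin (2 * (1 + m))) (sym (ofBin-toBin n)) ⟩
  toBin (ofBin (2[1+ toBin n ]))        ≡⟨ toBin-ofBin _ ⟩
  2[1+ toBin n ]                        ∎)
  where
  open ≡-Reasoning
  lem : ∀ n → 2 + 2 * n ≡ 2 * (1 + n)
  lem = solve-∀

NonSep : Sym → Set
NonSep s = s ≢ sep

encℕᵇ-nonSep : ∀ b → All NonSep (encℕᵇ b)
encℕᵇ-nonSep 0ᵇ       = []
encℕᵇ-nonSep 2[1+ b ] = (λ ()) ∷ encℕᵇ-nonSep b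
encℕᵇ-nonSep 1+[2 b ] = (λ ()) ∷ encℕᵇ-nonSep b

encℕᵇ-injective : ∀ a b → encℕᵇ a ≡ encℕᵇ b → a ≡ b
encℕᵇ-injective 0ᵇ       0ᵇ       e = refl
encℕᵇ-injective 2[1+ a ] 2[1+ b ] e = cong 2[1+_] (encℕᵇ-injective a b (∷-injectiveʳ e))
encℕᵇ-injective 1+[2 a ] 1+[2 b ] e = cong 1+[2_] (encℕᵇ-injective a b (∷-injectiveʳ e))

encℕ-injective : ∀ a b → encℕ a ≡ encℕ b → a ≡ b
encℕ-injective a b e = begin
  a                    ≡⟨ sym (ofBin-toBin a) ⟩
  ofBin (toBin a)      ≡⟨ cong ofBin (encℕᵇ-injective _ _ e) ⟩
  ofBin (toBin b)      ≡⟨ ofBin-toBin b ⟩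
  b                    ∎
  where open ≡-Reasoning

-- The graph of the reduction

-- In a unit clause both occurrences denote its only literal.
litOf : Clause → Bool → Literal
litOf []          _     = 0 , true
litOf (l ∷ [])    _     = l
litOf (l ∷ _ ∷ _) false = l
litOf (_ ∷ l ∷ _) true  = l

polTest : Bool → Bool → Bool → Bool
polTest true  b b' = b xor b'
polTest false b b' = not (b xor b')

-- For `x` true this recognises complementary literals, for `x` false equal ones.
litTest : Bool → Literal → Literal → Bool
litTest x (v , b) (v' , b') = polTest x b b' ∧ ⌊ v ≟ v' ⌋

-- The phase can only be raised, and at full weight only on an edge leaving the complement of the
-- starting literal, which is what `b` reports.
phaseWt : Bool → Bool → Bool → ℕ
phaseWt false false _ = 4
phaseWt true  true  _ = 4
phaseWt false true  b = if b then 4 else 1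
phaseWt true  false _ = 1

module Reduction (φ : CNF) where

  N : ℕ
  N = length φ

  Occ : Set
  Occ = Fin N × Bool

  lit : Occ → Literal
  lit (i , s) = litOf (lookup φ i) s

  partner : Occ → Occ
  partner (i , s) = i , not s

  sameOcc : Occ → Occ → Bool
  sameOcc (i , s) (i' , s') = not (s xor s') ∧ ⌊ i F.≟ i' ⌋

  -- blk x y p: a walk in the implication graph that started at the literal
  -- of x is now at the literal of y; p tells whether it has already passed
  -- through the complement of the literal of x.
  data Vtx : Set where
    source idle sink : Vtx
    blk : Occ → Occ → Bool → Vtx

  -- If `lit y` is the complement of `lit (partner y')`, the clause of `y'` is an implication from
  -- `lit y` to `lit y'`. The entrance from `source` is at the same time the first implication, from
  -- `x` to `y`.
  wt : Vtx → Vtx → ℕ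
  wt source idle = 4
  wt source (blk x y false) = if litTest true (lit x) (lit (partner y)) then 3 else 1
  wt idle idle = 4
  wt sink sink = 4
  wt (blk x y true) sink = if litTest false (lit y) (lit x) then 6 else 1
  wt (blk x y p) (blk x' y' p') =
    if sameOcc x x'
    then (if litTest true (lit y) (lit (partner y')) then phaseWt p p' (litTest true (lit y) (lit x)) else 1)
    else 1
  wt _ _ = 1

  bits : List Bool
  bits = false ∷ true ∷ []

  -- The nesting of these lists is that of the loops by which the machine will enumerate the blocks.
  vₚ : Fin N → Bool → Fin N → Bool → Bool → List Vtx
  vₚ i s k t p = blk (i , s) (k , t) p ∷ []

  vₜ : Fin N → Bool → Fin N → Bool → List Vtx
  vₜ i s k t = concatMap (vₚ i s k t) bits

  vₖ : Fin N → Bool → Fin N → List Vtx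
  vₖ i s k = concatMap (vₜ i s k) bits

  vₛ : Fin N → Bool → List Vtx
  vₛ i s = concatMap (vₖ i s) (allFin N)

  vᵢ : Fin N → List Vtx
  vᵢ i = concatMap (vₛ i) bits

  blocks : List Vtx
  blocks = concatMap vᵢ (allFin N)

  -- The additional copies of `sink` bring the number of vertices to at least 6, so that the weight
  -- 6 is an admissible entry even for the empty formula. `idle` comes directly after `source` and
  -- hence has index 2 in the output.
  rest : List Vtx
  rest = idle ∷ sink ∷ sink ∷ sink ∷ sink ∷ blocks

  vertices : List Vtx
  vertices = source ∷ rest

-- Access to the literals of φ on the input tape

symEq : Maybe Sym → Maybe Sym → Bool
symEq (just s0)  (just s0)  = true
symEq (just s1)  (just s1)  = true
symEq (just sep) (just sep) = true
symEq _          _          = false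

isSep : Maybe Sym → Bool
isSep (just sep) = true
isSep _          = false

symBit : Maybe Sym → Bool
symBit (just s1) = true
symBit _         = false

module Programs (M : TM) where
  open Registers M 15 public

  hi : Fin 9 → Fin 15
  hi j = suc (suc (suc (suc (suc (suc j)))))

  -- Scratch registers `t₁` and `t₂`, an offset `t₃` inside a literal, the constant 0 in `rZ`, the
  -- number of clauses in `rL` and the input length in `rW`.
  t₁ t₂ t₃ rZ rL rW : Fin 15
  t₁ = zero
  t₂ = suc zero
  t₃ = suc (suc zero)
  rZ = suc (suc (suc zero))
  rL = suc (suc (suc (suc zero)))
  rW = suc (suc (suc (suc (suc zero))))

  loopBody : Fin 15 → Prog ⊤ → ⊤ → Prog (⊤ ⊎ ⊤)
  loopBody r body _ = bind (decr r) λ b →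
    if b then (bind body λ _ → ret (inj₁ tt)) else ret (inj₂ tt)

  loopDec : Fin 15 → Prog ⊤ → Prog ⊤
  loopDec r body = iter (loopBody r body) tt

  -- The left end of the input cannot be sensed, but a left move at cell 0 has no effect, so as many
  -- moves as the input has symbols lead there from anywhere.
  rewind : Prog ⊤
  rewind = bind (cpy t₁ rW) λ _ → loopDec t₁ (moveHead L)

  skipSym : ⊤ → Prog (⊤ ⊎ ⊤)
  skipSym _ = bind readSym λ s → bind (moveHead R) λ _ → ret (if isSep s then inj₂ tt else inj₁ tt)

  skipLit : Prog ⊤
  skipLit = iter skipSym tt

  -- A literal begins with its polarity, never with `sep`; a `sep` in this place therefore ends the
  -- clause.
  skipOne : ⊤ → Prog (⊤ ⊎ ⊤)
  skipOne _ = bind readSym λ s →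
    if isSep s then (bind (moveHead R) λ _ → ret (inj₂ tt)) else (bind skipLit λ _ → ret (inj₁ tt))

  skipClause : Prog ⊤
  skipClause = iter skipOne tt

  locate₀ : Fin 15 → Prog ⊤
  locate₀ r = bind rewind λ _ → bind (cpy t₁ r) λ _ → loopDec t₁ skipClause

  locate : Fin 15 → Bool → Prog ⊤
  locate r false = locate₀ r
  locate r true  = bind (locate₀ r) λ _ → bind skipLit λ _ → bind readSym λ s →
    -- A `sep` after the first literal reveals a unit clause; in accordance with `litOf`, the head
    -- returns to that literal.
    if isSep s then locate₀ r else ret tt

  symAt : Fin 15 → Bool → Prog (Maybe Sym)
  symAt r s = bind (locate r s) λ _ → bind (cpy t₁ t₃) λ _ → bind (loopDec t₁ (moveHead R)) λ _ → readSym

  -- The number of a variable may have a code far longer than logarithmic, so it cannot be loaded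
  -- into a register. The two codes are compared symbol by symbol at the common offset `t₃`, each
  -- symbol being located anew.
  compareNext : Fin 15 → Bool → Fin 15 → Bool → ⊤ → Prog (⊤ ⊎ Bool)
  compareNext r s r' s' _ = bind (symAt r s) λ a → bind (symAt r' s') λ b →
    if symEq a b
    then (if isSep a then ret (inj₂ true) else (bind (inc t₃) λ _ → ret (inj₁ tt)))
    else ret (inj₂ false)

  compareVars : Fin 15 → Bool → Fin 15 → Bool → Prog Bool
  compareVars r s r' s' = iter (compareNext r s r' s') tt

  opaque
    testLits : Bool → Fin 15 → Bool → Fin 15 → Bool → Prog Bool
    -- Offset 0 of a literal is its polarity; the code of its variable starts at offset 1.
    testLits x r s r' s' = bind (cpy t₃ rZ) λ _ → bind (symAt r s) λ a → bind (symAt r' s') λ b →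
      if polTest x (symBit a) (symBit b) then (bind (inc t₃) λ _ → compareVars r s r' s') else ret false

  module Generic (w : List Sym) (U : ℕ) where
    open Logic w U public

    U≤2U : ∀ {k} → k ≤ U → k ≤ 2 * U
    U≤2U le = ≤-trans le (m≤m+n U _)

    -- The invariant is indexed by the number of rounds left, and the body starts with the counter
    -- already lowered.
    loopDec-wp : ∀ {r body} (I : ℕ → St → Set) →
      (∀ {y s} → I y s → V.lookup (regs s) r ≡ y) →
      (∀ {y s} → I (suc y) s → wp body (λ _ → I y) (s [ r ↦ y ])) →
      ∀ {y s Q} → y < U → I y s → (∀ {s} → I 0 s → Q tt s) → wp (loopDec r body) Q s
    loopDec-wp {r} {body} I val step {y} {s} {Q} lt i end = wp-iter (U≤2U lt) (go y s i)
      where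
      go : ∀ y s → I y s → wpI (loopBody r body) (suc y) tt Q s
      more : ∀ {y s} n → y ≡ suc n → I y s →
             wp (bind body λ _ → ret (inj₁ tt)) [ (λ a' → wpI (loopBody r body) y a' Q) ∣ Q ] (s [ r ↦ n ])
      go y s i = wpI-step (wp-bind (wp-decr r (λ e → wp-ret (end (subst (λ z → I z s) (trans (sym (val i)) e) i)))
                                             (λ n e → more n (trans (sym (val i)) e) i)))
      more n refl i = wp-bind (wp-conseq (λ _ s' i' → wp-ret (go n s' i')) (step i))

    record Pos (p : ℕ) (s : List Sym) : Set where
      constructor at-pos
      field
        pre   : List Sym
        split : w ≡ pre ++ s
        len   : length pre ≡ p

    W : ℕ
    W = length w

    pos-len : ∀ {p s} → Pos p s → p + length s ≡ W
    pos-len {s = s} (at-pos pre refl refl) = sym (length-++ pre)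

    pos-≤ : ∀ {p s} → Pos p s → p ≤ W
    pos-≤ P = ≤-trans (m≤m+n _ _) (≤-reflexive (pos-len P))

    pos-suffix : ∀ {p s} → Pos p s → length s ≤ W
    pos-suffix {p} P = ≤-trans (m≤n+m _ p) (≤-reflexive (pos-len P))

    readIn-++ : ∀ pre {s} → readIn (pre ++ s) (length pre) ≡ readIn s 0
    readIn-++ []        = refl
    readIn-++ (x ∷ pre) = readIn-++ pre

    pos-read : ∀ {p s} → Pos p s → readIn w p ≡ readIn s 0
    pos-read (at-pos pre refl refl) = readIn-++ pre

    <⇒≢ᵇ : ∀ {m n} → m < n → (m ≡ᵇ n) ≡ false
    <⇒≢ᵇ {zero}  (s≤s lt) = refl
    <⇒≢ᵇ {suc m} (s≤s lt) = <⇒≢ᵇ lt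

    pos-next : ∀ {p x s} → Pos p (x ∷ s) → Pos (moveIn W R p) s
    pos-next {p} {x} {s} P@(at-pos pre e l) = subst (λ q → Pos q s) (sym advance)
      (at-pos (pre ++ x ∷ []) (trans e (sym (++-assoc pre (x ∷ []) s))) (trans (length-++ pre) (trans (+-comm _ 1) (cong suc l))))
      where
      advance : moveIn W R p ≡ suc p
      advance rewrite <⇒≢ᵇ (≤-trans (≤-trans (≤-reflexive (+-comm 1 p)) (+-monoʳ-≤ p (s≤s (z≤n {length s})))) (≤-reflexive (pos-len P))) = refl

    pos-start : Pos 0 w
    pos-start = at-pos [] refl refl

    skipLit-wp : ∀ {ρ p us} xs {rest Q} → All NonSep xs → Pos p (xs ++ sep ∷ rest) → W < U →
      (∀ {p'} → Pos p' rest → Q tt (mkSt ρ p' us)) → wp skipLit Q (mkSt ρ p us)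
    skipLit-wp {ρ} {p} {us} xs {rest} {Q} ns P lt q =
      wp-iter (U≤2U (≤-trans (s≤s (≤-trans (m≤m+n (length xs) _) (≤-trans (≤-reflexive (sym (length-++ xs))) (pos-suffix P)))) lt)) (go xs ns P)
      where
      go : ∀ xs {p} → All NonSep xs → Pos p (xs ++ sep ∷ rest) → wpI skipSym (suc (length xs)) tt Q (mkSt ρ p us)
      onward : ∀ x xs {p} → NonSep x → All NonSep xs → Pos p (x ∷ xs ++ sep ∷ rest) →
             [ (λ a' s' → wpI skipSym (suc (length xs)) a' Q s') ∣ Q ] (if isSep (just x) then inj₂ tt else inj₁ tt) (mkSt ρ (moveIn W R p) us)
      go [] {p} _ P = wpI-step (wp-bind (wp-read (wp-bind (wp-move R (wp-ret
        (subst (λ z → [ (λ a' s' → wpI skipSym 0 a' Q s') ∣ Q ] (if isSep z then inj₂ tt else inj₁ tt) (mkSt ρ (moveIn W R p) us))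
               (sym (pos-read P)) (q (pos-next P))))))))
      go (x ∷ xs) {p} (n ∷ ns) P = wpI-step (wp-bind (wp-read (wp-bind (wp-move R (wp-ret
        (subst (λ z → [ (λ a' s' → wpI skipSym (suc (length xs)) a' Q s') ∣ Q ] (if isSep z then inj₂ tt else inj₁ tt) (mkSt ρ (moveIn W R p) us))
               (sym (pos-read P)) (onward x xs n ns P)))))))
      onward s0  xs n ns P = go xs ns (pos-next P)
      onward s1  xs n ns P = go xs ns (pos-next P)
      onward sep xs n ns P = ⊥-elim (n refl)

    encLit-++ : ∀ v b r → encLit (v , b) ++ r ≡ (encBool b ∷ encℕ v) ++ sep ∷ r
    encLit-++ v b r = cong (encBool b ∷_) (++-assoc (encℕ v) (sep ∷ []) r)

    encLit-nonSep : ∀ v b → All NonSep (encBool b ∷ encℕ v)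
    encLit-nonSep v true  = (λ ()) ∷ encℕᵇ-nonSep _
    encLit-nonSep v false = (λ ()) ∷ encℕᵇ-nonSep _

    skipLit-wp' : ∀ {ρ p us} l {rest Q} → Pos p (encLit l ++ rest) → W < U →
      (∀ {p'} → Pos p' rest → Q tt (mkSt ρ p' us)) → wp skipLit Q (mkSt ρ p us)
    skipLit-wp' (v , b) P lt q =
      skipLit-wp _ (encLit-nonSep v b) (subst (Pos _) (encLit-++ v b _) P) lt q

    length-concatMap-≥ : ∀ (C : Clause) → length C ≤ length (concatMap encLit C)
    length-concatMap-≥ []      = z≤n
    length-concatMap-≥ (l ∷ C) = s≤s (≤-trans (length-concatMap-≥ C)
      (≤-trans (m≤n+m _ (length (encNum (proj₁ l)))) (≤-reflexive (sym (length-++ (encNum (proj₁ l)))))))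

    skipClause-wp : ∀ {ρ p us} C {rest Q} → Pos p (encClause C ++ rest) → W < U →
      (∀ {p'} → Pos p' rest → Q tt (mkSt ρ p' us)) → wp skipClause Q (mkSt ρ p us)
    skipClause-wp {ρ} {p} {us} C {rest} {Q} P lt q =
      wp-iter (U≤2U (≤-trans (s≤s (≤-trans (length-concatMap-≥ C) (≤-trans (m≤m+n _ _) (≤-trans (≤-reflexive (sym (length-++ (concatMap encLit C)))) (pos-suffix P'))))) lt)) (go C P')
      where
      P' : Pos p (concatMap encLit C ++ sep ∷ rest)
      P' = subst (Pos p) (++-assoc (concatMap encLit C) (sep ∷ []) rest) P
      after : ℕ → Maybe Sym → ℕ → Set
      after k z p = wp (if isSep z then (bind (moveHead R) λ _ → ret (inj₂ tt)) else (bind skipLit λ _ → ret (inj₁ tt)))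
                       [ (λ a' s' → wpI skipOne k a' Q s') ∣ Q ] (mkSt ρ p us)
      go : ∀ C {p} → Pos p (concatMap encLit C ++ sep ∷ rest) → wpI skipOne (suc (length C)) tt Q (mkSt ρ p us)
      onward : ∀ v b C {p} → Pos p (encLit (v , b) ++ (concatMap encLit C ++ sep ∷ rest)) → after (suc (length C)) (just (encBool b)) p
      go [] {p} P = wpI-step (wp-bind (wp-read
        (subst (λ z → after 0 z p) (sym (pos-read P)) (wp-bind (wp-move R (wp-ret (q (pos-next P))))))))
      go ((v , b) ∷ C) {p} P = wpI-step (wp-bind (wp-read
        (subst (λ z → after (suc (length C)) z p) (sym (pos-read P))
          (onward v b C (subst (Pos p) (++-assoc (encLit (v , b)) (concatMap encLit C) _) P)))))
      onward v true  C P = wp-bind (skipLit-wp' (v , true)  P lt (λ P' → wp-ret (go C P')))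
      onward v false C P = wp-bind (skipLit-wp' (v , false) P lt (λ P' → wp-ret (go C P')))

ShortClauses : CNF → Set
ShortClauses φ = All (λ C → (1 ≤ length C) × (length C ≤ 2)) φ

encClause-∷ : ∀ l C r → encClause (l ∷ C) ++ r ≡ encLit l ++ (encClause C ++ r)
encClause-∷ l C r = trans (cong (_++ r) (++-assoc (encLit l) (concatMap encLit C) (sep ∷ [])))
                          (++-assoc (encLit l) (encClause C) r)

length-encCNF : ∀ φ → length φ ≤ length (encCNF φ)
length-encCNF []      = z≤n
length-encCNF (C ∷ φ) = begin
  1 + length φ                               ≤⟨ +-mono-≤ clause (length-encCNF φ) ⟩
  length (encClause C) + length (encCNF φ)   ≡⟨ sym (length-++ (encClause C)) ⟩
  length (encCNF (C ∷ φ))                    ∎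
  where
  open ≤-Reasoning
  clause : 1 ≤ length (encClause C)
  clause = ≤-trans (m≤n+m 1 (length (concatMap encLit C))) (≤-reflexive (sym (length-++ (concatMap encLit C))))

symBit-encBool : ∀ b → symBit (just (encBool b)) ≡ b
symBit-encBool true  = refl
symBit-encBool false = refl

data SymCmp : Sym → Sym → Bool → Set where
  same : ∀ {x} → SymCmp x x true
  diff : ∀ {x y} → x ≢ y → SymCmp x y false

symCmp : ∀ x y → SymCmp x y (symEq (just x) (just y))
symCmp s0  s0  = same
symCmp s0  s1  = diff λ ()
symCmp s0  sep = diff λ ()
symCmp s1  s0  = diff λ ()
symCmp s1  s1  = same
symCmp s1  sep = diff λ ()
symCmp sep s0  = diff λ ()
symCmp sep s1  = diff λ ()
symCmp sep sep = same

sym-dec : ∀ x y → x ≡ y ⊎ x ≢ y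
sym-dec x y with symEq (just x) (just y) | symCmp x y
... | _ | same    = inj₁ refl
... | _ | diff ne = inj₂ ne

≟-true : ∀ {m n} → m ≡ n → ⌊ m ≟ n ⌋ ≡ true
≟-true {m} {n} e with m ≟ n
... | yes _ = refl
... | no ne = contradiction e ne

≟-false : ∀ {m n} → m ≢ n → ⌊ m ≟ n ⌋ ≡ false
≟-false {m} {n} ne with m ≟ n
... | yes e = contradiction e ne
... | no _  = refl

module Literals (M : TM) (φ : CNF) (short : ShortClauses φ) (U : ℕ) (W<U : length (encCNF φ) < U) where
  open Reduction φ public
  open Programs M public
  open Generic (encCNF φ) U public

  Sims = Vec MTape (TM.tapes M)

  tm : ℕ → ℕ → ℕ → Vec ℕ 9 → ℕ → Sims → St
  tm x₁ x₂ x₃ ρ p us = mkSt (x₁ ∷ x₂ ∷ x₃ ∷ 0 ∷ N ∷ W ∷ ρ) p us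

  module _ {x₂ : ℕ} {ρ : Vec ℕ 9} {us : Sims} where

    rewind-wp : ∀ {ℓ x₁ x₃ p} {Q : ⊤ → St → Set} → p ≤ W →
      Q tt (mkSt (0 ∷ x₂ ∷ x₃ ∷ 0 ∷ ℓ ∷ W ∷ ρ) 0 us) → wp rewind Q (mkSt (x₁ ∷ x₂ ∷ x₃ ∷ 0 ∷ ℓ ∷ W ∷ ρ) p us)
    rewind-wp {ℓ} {x₁} {x₃} {p} {Q} le q = wp-bind (wp-cpy t₁ rW (loopDec-wp I (λ { (_ , _ , refl) → refl }) one W<U (p , le , refl)
        (λ { (zero , _ , refl) → q })))
      where
      I : ℕ → St → Set
      I y s = Σ ℕ λ p → p ≤ y × s ≡ mkSt (y ∷ x₂ ∷ x₃ ∷ 0 ∷ ℓ ∷ W ∷ ρ) p us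
      one : ∀ {y s} → I (suc y) s → wp (moveHead L) (λ _ → I y) (s [ t₁ ↦ y ])
      one (zero  , le     , refl) = wp-move L (0 , z≤n , refl)
      one (suc p , s≤s le , refl) = wp-move L (p , le , refl)

    module _ (j : Fin 9) (i : Fin N) (ji : V.lookup ρ j ≡ toℕ i) where

      locate₀-wp : ∀ {x₁ x₃ p Q} → p ≤ W →
        (∀ {p' r} → Pos p' (encClause (lookup φ i) ++ r) → Q tt (tm 0 x₂ x₃ ρ p' us)) →
        wp (locate₀ (hi j)) Q (tm x₁ x₂ x₃ ρ p us)
      locate₀-wp {x₃ = x₃} le q = wp-bind (rewind-wp le (wp-bind (wp-cpy t₁ (hi j)
        (loopDec-wp I (λ { (_ , _ , _ , _ , _ , _ , refl) → refl }) one
          (≤-trans (s≤s (≤-trans (≤-reflexive ji) (≤-trans (<⇒≤ (FP.toℕ<n i)) (length-encCNF φ)))) W<U)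
          (φ , i , 0 , sym ji , refl , pos-start , refl)
          (λ { (C ∷ ψ , zero , _ , _ , refl , P , refl) → q P })))))
        where
        -- The invariant keeps the unread part `ψ` of the formula and the place of the wanted clause
        -- within it; the clauses already passed are forgotten.
        I : ℕ → St → Set
        I y s = Σ CNF λ ψ → Σ (Fin (length ψ)) λ k → Σ ℕ λ p →
                toℕ k ≡ y × lookup ψ k ≡ lookup φ i × Pos p (encCNF ψ) × s ≡ tm y x₂ x₃ ρ p us
        one : ∀ {y s} → I (suc y) s → wp skipClause (λ _ → I y) (s [ t₁ ↦ y ])
        one (C ∷ ψ , suc k , p , refl , e , P , refl) =
          skipClause-wp C P W<U (λ {p'} P' → ψ , k , p' , refl , e , P' , refl)

      locate-wp : ∀ s {x₁ x₃ p Q} → p ≤ W →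
        (∀ {p' r} → Pos p' (encLit (lit (i , s)) ++ r) → Q tt (tm 0 x₂ x₃ ρ p' us)) →
        wp (locate (hi j) s) Q (tm x₁ x₂ x₃ ρ p us)
      locate-wp s {x₁} {x₃} {p} {Q} le q = go s (lookup φ i) (All.lookup short (∈-lookup i)) refl q
        where
        Goal : Bool → Clause → Set
        Goal s C = (∀ {p' r} → Pos p' (encLit (litOf C s) ++ r) → Q tt (tm 0 x₂ x₃ ρ p' us)) →
                   wp (locate (hi j) s) Q (tm x₁ x₂ x₃ ρ p us)
        branch : ℕ → Maybe Sym → Set
        branch p z = wp (if isSep z then locate₀ (hi j) else ret tt) Q (tm 0 x₂ x₃ ρ p us)
        go : ∀ s C → (1 ≤ length C) × (length C ≤ 2) → lookup φ i ≡ C → Goal s C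
        go s [] (() , _)
        go s (_ ∷ _ ∷ _ ∷ _) (_ , s≤s (s≤s ()))
        go false (l ∷ []) _ e q = locate₀-wp le (λ {p'} {r} P →
          q (subst (Pos p') (trans (cong (λ C → encClause C ++ r) e) (encClause-∷ l [] r)) P))
        go false (l ∷ l' ∷ []) _ e q = locate₀-wp le (λ {p'} {r} P →
          q (subst (Pos p') (trans (cong (λ C → encClause C ++ r) e) (encClause-∷ l (l' ∷ []) r)) P))
        go true (l ∷ []) _ e q = wp-bind (locate₀-wp le (λ {p₁} {r} P →
          wp-bind (skipLit-wp' l (subst (Pos p₁) (trans (cong (λ C → encClause C ++ r) e) (encClause-∷ l [] r)) P) W<U (λ {p₂} P₂ →
          wp-bind (wp-read (subst (branch p₂) (sym (pos-read P₂)) (locate₀-wp (pos-≤ P₂) (λ {p'} {r} P →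
            q (subst (Pos p') (trans (cong (λ C → encClause C ++ r) e) (encClause-∷ l [] r)) P)))))))))
        go true (l ∷ l' ∷ []) _ e q = wp-bind (locate₀-wp le (λ {p₁} {r} P →
          wp-bind (skipLit-wp' l (subst (Pos p₁) (trans (cong (λ C → encClause C ++ r) e) (encClause-∷ l (l' ∷ []) r)) P) W<U (λ {p₂} P₂ →
          wp-bind (wp-read (subst (branch p₂) (sym (pos-read P₂))
            (found l' (q (subst (Pos p₂) (encClause-∷ l' [] r) P₂)))))))))
          where
          found : ∀ l' {p} → Q tt (tm 0 x₂ x₃ ρ p us) → branch p (just (encBool (proj₂ l')))
          found (v , true)  q = wp-ret q
          found (v , false) q = wp-ret q

      symAt-wp : ∀ s {pre x suf x₁ x₃ p Q} → encLit (lit (i , s)) ≡ pre ++ x ∷ suf → length pre ≡ x₃ → p ≤ W →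
        (∀ {p'} → p' ≤ W → length (encLit (lit (i , s))) ≤ W → Q (just x) (tm 0 x₂ x₃ ρ p' us)) →
        wp (symAt (hi j) s) Q (tm x₁ x₂ x₃ ρ p us)
      symAt-wp s {pre} {x} {suf} {x₃ = x₃} {Q = Q} e lp le q = wp-bind (locate-wp s le λ {p₁} {r} P →
        let Lw : length (encLit (lit (i , s))) ≤ W
            Lw = ≤-trans (m≤m+n _ _) (≤-trans (≤-reflexive (sym (length-++ (encLit (lit (i , s)))))) (pos-suffix P))
        in
        wp-bind (wp-cpy t₁ t₃ (wp-bind (loopDec-wp (I r) (λ { (_ , _ , _ , _ , refl) → refl }) one
          (≤-trans (s≤s (≤-trans (≤-reflexive (sym lp)) (≤-trans (m≤m+n _ _)
             (≤-trans (≤-reflexive (sym (trans (cong length e) (length-++ pre)))) Lw)))) W<U)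
          (pre , p₁ , lp , subst (Pos p₁) (trans (cong (_++ r) e) (++-assoc pre (x ∷ suf) r)) P , refl)
          (λ { ([] , p₂ , refl , P₂ , refl) → wp-read (subst (λ z → Q z (tm 0 x₂ x₃ ρ p₂ us)) (sym (pos-read P₂)) (q (pos-≤ P₂) Lw)) })))))
        where
        I : List Sym → ℕ → St → Set
        I r y s = Σ (List Sym) λ pre → Σ ℕ λ p → length pre ≡ y × Pos p (pre ++ x ∷ suf ++ r) × s ≡ tm y x₂ x₃ ρ p us
        one : ∀ {r y s} → I r (suc y) s → wp (moveHead R) (λ _ → I r y) (s [ t₁ ↦ y ])
        one (_ ∷ pre , p , refl , P , refl) = wp-move R (pre , _ , refl , pos-next P , refl)

    module _ (j : Fin 9) (i : Fin N) (ji : V.lookup ρ j ≡ toℕ i) (s : Bool)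
             (j' : Fin 9) (i' : Fin N) (ji' : V.lookup ρ j' ≡ toℕ i') (s' : Bool) where

      private
        v = proj₁ (lit (i , s))
        v' = proj₁ (lit (i' , s'))

      module _ {Q : Bool → St → Set} where

        onward : ℕ → Maybe Sym → Maybe Sym → St → Set
        onward k a b = wp (if symEq a b
            then (if isSep a then ret (inj₂ true) else (bind (inc t₃) λ _ → ret (inj₁ tt)))
            else ret (inj₂ false)) [ (λ a' → wpI (compareNext (hi j) s (hi j') s') k a' Q) ∣ Q ]

        onward-diff : ∀ {k x y σ} → x ≢ y → Q false σ → onward k (just x) (just y) σ
        onward-diff {x = x} {y} ne q with symEq (just x) (just y) | symCmp x y
        ... | true  | same   = contradiction refl ne
        ... | false | diff _ = wp-ret q

        onward-same : ∀ {k x y x₁ x₃ p} → x ≡ y → NonSep x → x₃ < U →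
          wpI (compareNext (hi j) s (hi j') s') k tt Q (tm x₁ x₂ (suc x₃) ρ p us) →
          onward k (just x) (just y) (tm x₁ x₂ x₃ ρ p us)
        onward-same {x = s0}  refl n lt q = wp-bind (wp-inc t₃ lt (wp-ret q))
        onward-same {x = s1}  refl n lt q = wp-bind (wp-inc t₃ lt (wp-ret q))
        onward-same {x = sep} refl n lt q = ⊥-elim (n refl)

        reads : ∀ {q x y xs ys k x₁ p} → encNum v ≡ q ++ x ∷ xs → encNum v' ≡ q ++ y ∷ ys → p ≤ W →
          (∀ {p'} → p' ≤ W → suc (length q) < U → onward k (just x) (just y) (tm 0 x₂ (suc (length q)) ρ p' us)) →
          wp (compareNext (hi j) s (hi j') s' tt) [ (λ a' → wpI (compareNext (hi j) s (hi j') s') k a' Q) ∣ Q ]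
             (tm x₁ x₂ (suc (length q)) ρ p us)
        reads {q} {x} {xs = xs} eX eY le k =
          wp-bind (symAt-wp j i ji s (cong (encBool (proj₂ (lit (i , s))) ∷_) eX) refl le λ le₁ len →
          wp-bind (symAt-wp j' i' ji' s' (cong (encBool (proj₂ (lit (i' , s'))) ∷_) eY) refl le₁ λ le₂ _ →
          k le₂ (≤-trans (s≤s (≤-trans (s≤s (≤-trans (m≤m+n (length q) (length (x ∷ xs)))
            (≤-reflexive (sym (trans (cong length eX) (length-++ q)))))) len)) W<U)))

        -- `q` is the common prefix found so far, and the offset exceeds its length by one because
        -- of the polarity symbol. As no digit is `sep`, the first difference or a simultaneous
        -- `sep` settles the comparison.
        compare-wp : ∀ q xs ys {x₁ p} → All NonSep xs → All NonSep ys →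
          encℕ v ≡ q ++ xs → encℕ v' ≡ q ++ ys → p ≤ W →
          (∀ {x₁ x₃ p'} → p' ≤ W → Q ⌊ v ≟ v' ⌋ (tm x₁ x₂ x₃ ρ p' us)) →
          wpI (compareNext (hi j) s (hi j') s') (suc (length xs)) tt Q (tm x₁ x₂ (suc (length q)) ρ p us)
        compare-wp q xs ys {x₁} {p} nx ny ex ey le k = wpI-step (go xs ys nx ny ex ey (end v xs ex) (end v' ys ey))
          where
          end : ∀ v xs → encℕ v ≡ q ++ xs → encNum v ≡ q ++ (xs ++ sep ∷ [])
          end v xs e = trans (cong (_++ sep ∷ []) e) (++-assoc q xs (sep ∷ []))
          result : ∀ {b x₁ x₃ p'} → ⌊ v ≟ v' ⌋ ≡ b → p' ≤ W → Q b (tm x₁ x₂ x₃ ρ p' us)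
          result refl le = k le
          differ : ∀ {xs ys} → encℕ v ≡ q ++ xs → encℕ v' ≡ q ++ ys → xs ≢ ys → ⌊ v ≟ v' ⌋ ≡ false
          differ ex ey ne = ≟-false λ e → ne (++-cancelˡ q _ _ (trans (sym ex) (trans (cong encℕ e) ey)))
          go : ∀ xs ys → All NonSep xs → All NonSep ys → encℕ v ≡ q ++ xs → encℕ v' ≡ q ++ ys →
               encNum v ≡ q ++ (xs ++ sep ∷ []) → encNum v' ≡ q ++ (ys ++ sep ∷ []) →
               wp (compareNext (hi j) s (hi j') s' tt) [ (λ a' → wpI (compareNext (hi j) s (hi j') s') (length xs) a' Q) ∣ Q ]
                  (tm x₁ x₂ (suc (length q)) ρ p us)
          go [] [] _ _ ex ey eX eY = reads {q} eX eY le λ le' _ →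
            wp-ret (result (≟-true (encℕ-injective v v' (trans ex (sym ey)))) le')
          go [] (y ∷ ys) _ (n ∷ _) ex ey eX eY = reads {q} eX eY le λ le' _ →
            onward-diff (n ∘ sym) (result (differ ex ey λ ()) le')
          go (x ∷ xs) [] (n ∷ _) _ ex ey eX eY = reads {q} eX eY le λ le' _ →
            onward-diff n (result (differ ex ey λ ()) le')
          go (x ∷ xs) (y ∷ ys) (n ∷ nx) (_ ∷ ny) ex ey eX eY = reads {q} eX eY le λ le' lt → cmp x y n le' lt ex ey
            where
            cmp : ∀ x y {p'} → NonSep x → p' ≤ W → suc (length q) < U → encℕ v ≡ q ++ x ∷ xs → encℕ v' ≡ q ++ y ∷ ys →
                  onward (suc (length xs)) (just x) (just y) (tm 0 x₂ (suc (length q)) ρ p' us)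
            cmp x y {p'} n le' lt ex ey with sym-dec x y
            ... | inj₂ ne = onward-diff ne (result (differ ex ey (ne ∘ ∷-injectiveˡ)) le')
            ... | inj₁ refl = onward-same refl n lt
              (subst (λ l → wpI (compareNext (hi j) s (hi j') s') (suc (length xs)) tt Q (tm 0 x₂ (suc l) ρ p' us))
                     (trans (length-++ q) (+-comm _ 1))
                     (compare-wp (q ++ x ∷ []) xs ys nx ny (trans ex (sym (++-assoc q (x ∷ []) xs)))
                                 (trans ey (sym (++-assoc q (x ∷ []) ys))) le' k))

        opaque
          unfolding testLits

          testLits-wp : ∀ x {x₁ x₃ p} → p ≤ W →
            (∀ {x₁ x₃ p'} → p' ≤ W → Q (litTest x (lit (i , s)) (lit (i' , s'))) (tm x₁ x₂ x₃ ρ p' us)) →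
            wp (testLits x (hi j) s (hi j') s') Q (tm x₁ x₂ x₃ ρ p us)
          testLits-wp x le k = wp-bind (wp-cpy t₃ rZ (
            wp-bind (symAt-wp j i ji s {pre = []} refl refl le λ le₁ len →
            wp-bind (symAt-wp j' i' ji' s' {pre = []} refl refl le₁ λ {p'} le₂ _ →
            subst₂ (λ b b' → branch p' (polTest x b b')) (sym (symBit-encBool _)) (sym (symBit-encBool _))
                   (go p' _ refl le₂ len)))))
            where
            b b' : Bool
            b = proj₂ (lit (i , s))
            b' = proj₂ (lit (i' , s'))
            branch : ℕ → Bool → Set
            branch p b = wp (if b then (bind (inc t₃) λ _ → compareVars (hi j) s (hi j') s') else ret false) Q (tm 0 x₂ 0 ρ p us)
            go : ∀ p t → polTest x b b' ≡ t → p ≤ W → length (encLit (lit (i , s))) ≤ W → branch p t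
            go p false e le len = wp-ret (subst (λ t → Q (t ∧ ⌊ v ≟ v' ⌋) (tm 0 x₂ 0 ρ p us)) e (k le))
            go p true  e le len = wp-bind (wp-inc t₃ (≤-trans (s≤s z≤n) W<U) (wp-iter (U≤2U (≤-trans (s≤s
              (≤-trans (≤-trans (m≤m+n _ 1) (≤-trans (≤-reflexive (sym (length-++ (encℕ v)))) (n≤1+n _))) len)) W<U))
              (compare-wp [] (encℕ v) (encℕ v') (encℕᵇ-nonSep _) (encℕᵇ-nonSep _) refl refl le
                (λ {x₁} {x₃} {p'} le → subst (λ t → Q (t ∧ ⌊ v ≟ v' ⌋) (tm x₁ x₂ x₃ ρ p' us)) e (k le)))))

-- Recomputing the symbols of the virtual input

-- The least significant digit of suc y in bijective base 2, and the value of
-- the remaining digits.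
digit : ℕ → Sym × ℕ
digit 0             = s0 , 0
digit 1             = s1 , 0
digit (suc (suc y)) = proj₁ (digit y) , suc (proj₂ (digit y))

digit-enc : ∀ y → encℕ (suc y) ≡ proj₁ (digit y) ∷ encℕ (proj₂ (digit y))
digit-enc y = trans (cong encℕ (value y)) (spell (proj₁ (digit y)) (proj₂ (digit y)) (digit-cases y))
  where
  weightOf : Sym → ℕ
  weightOf s1 = 2
  weightOf _  = 1
  value : ∀ y → suc y ≡ weightOf (proj₁ (digit y)) + 2 * proj₂ (digit y)
  value 0 = refl
  value 1 = refl
  value (suc (suc y)) = trans (cong (2 +_) (value y)) (lem (weightOf (proj₁ (digit y))) (proj₂ (digit y)))
    where
    lem : ∀ x m → 2 + (x + 2 * m) ≡ x + 2 * (1 + m)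
    lem = solve-∀
  digit-cases : ∀ y → proj₁ (digit y) ≢ sep
  digit-cases (suc (suc y)) e = digit-cases y e
  spell : ∀ x m → x ≢ sep → encℕ (weightOf x + 2 * m) ≡ x ∷ encℕ m
  spell s0  m _ = encℕ-odd m
  spell s1  m _ = encℕ-even m
  spell sep m n = ⊥-elim (n refl)

digit-≤ : ∀ y → proj₂ (digit y) ≤ y
digit-≤ 0             = z≤n
digit-≤ 1             = z≤n
digit-≤ (suc (suc y)) = s≤s (≤-trans (digit-≤ y) (n≤1+n y))

readIn-++ˡ : ∀ xs {ys c x} → readIn xs c ≡ just x → readIn (xs ++ ys) c ≡ just x
readIn-++ˡ (_ ∷ xs) {c = zero}  e = e
readIn-++ˡ (_ ∷ xs) {c = suc c} e = readIn-++ˡ xs e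

readIn-++ʳ : ∀ xs {ys} c → readIn (xs ++ ys) (length xs + c) ≡ readIn ys c
readIn-++ʳ []       c = refl
readIn-++ʳ (_ ∷ xs) c = readIn-++ʳ xs c

concatMap-concatMap : {A B C : Set} (f : B → List C) (g : A → List B) (xs : List A) →
  concatMap f (concatMap g xs) ≡ concatMap (concatMap f ∘ g) xs
concatMap-concatMap f g []       = refl
concatMap-concatMap f g (x ∷ xs) =
  trans (concatMap-++ f (g x) (concatMap g xs)) (cong (concatMap f (g x) ++_) (concatMap-concatMap f g xs))

-- A vertex of the instance without the clause indices of its occurrences.
data Desc : Set where
  source idle sink : Desc
  blk : Bool → Bool → Bool → Desc

jN jD jK jV jC jA jB jA' jB' : Fin 9
jN  = zero
jD  = suc zero
jK  = suc (suc zero)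
jV  = suc (suc (suc zero))
jC  = suc (suc (suc (suc zero)))
jA  = suc (suc (suc (suc (suc zero))))
jB  = suc (suc (suc (suc (suc (suc zero)))))
jA' = suc (suc (suc (suc (suc (suc (suc zero))))))
jB' = suc (suc (suc (suc (suc (suc (suc (suc zero)))))))

module Emission (M : TM) where
  open Programs M

  -- An emitter produces a word symbol by symbol, but stops with the symbol
  -- whose position was initially in the register jC.
  Em : Set₁
  Em = Prog (Sym ⊎ ⊤)

  emit : Sym → Em
  emit x = bind (decr (hi jC)) λ b → ret (if b then inj₂ tt else inj₁ x)

  thenE : Sym ⊎ ⊤ → Em → Em
  thenE (inj₁ x) Q = ret (inj₁ x)
  thenE (inj₂ _) Q = Q

  infixr 5 _⨟_
  _⨟_ : Em → Em → Em
  P ⨟ Q = bind P λ e → thenE e Q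

  skip : Em
  skip = ret (inj₂ tt)

  emitL : List Sym → Em
  emitL []       = skip
  emitL (x ∷ xs) = emit x ⨟ emitL xs

  emitC : ℕ → Em
  emitC n = emitL (encNum n)

  -- Two units of `t₁` become one of `t₂`. Bijective base 2 has the digits 1 and 2, and `numBody`
  -- has already removed one unit, so remainder 0 means digit 1, written `s0`, and remainder 1 means
  -- digit 2, written `s1`.
  halveBody : ⊤ → Prog (⊤ ⊎ Sym)
  halveBody _ = bind (decr t₁) λ b → if b
    then (bind (decr t₁) λ b → if b then (bind (inc t₂) λ _ → ret (inj₁ tt)) else ret (inj₂ s1))
    else ret (inj₂ s0)

  loopE : Sym ⊎ ⊤ → ⊤ ⊎ (Sym ⊎ ⊤)
  loopE (inj₁ x) = inj₂ (inj₁ x)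
  loopE (inj₂ _) = inj₁ tt

  numBody : ⊤ → Prog (⊤ ⊎ (Sym ⊎ ⊤))
  numBody _ = bind (decr t₁) λ b → if b
    then (bind (cpy t₂ rZ) λ _ → bind (iter halveBody tt) λ x → bind (cpy t₁ t₂) λ _ → bind (emit x) λ e → ret (loopE e))
    else (bind (emit sep) λ e → ret (inj₂ e))

  emitNum : Fin 9 → Em
  emitNum j = bind (cpy t₁ (hi j)) λ _ → iter numBody tt

  forNext : Fin 9 → Sym ⊎ ⊤ → Prog (⊤ ⊎ (Sym ⊎ ⊤))
  forNext j (inj₁ x) = ret (inj₂ (inj₁ x))
  forNext j (inj₂ _) = bind (inc (hi j)) λ _ → ret (inj₁ tt)

  forBody : Fin 9 → Em → ⊤ → Prog (⊤ ⊎ (Sym ⊎ ⊤))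
  forBody j P _ = bind (eq (hi j) rL) λ b → if b then ret (inj₂ (inj₂ tt)) else (bind P λ e → forNext j e)

  forR : Fin 9 → Em → Em
  forR j P = bind (cpy (hi j) rZ) λ _ → iter (forBody j P) tt

  forBit : (Bool → Em) → Em
  forBit P = P false ⨟ P true ⨟ skip

  forV : Fin 9 → Fin 9 → (Desc → Em) → Em
  forV j j' P = P source ⨟ P idle ⨟ P sink ⨟ P sink ⨟ P sink ⨟ P sink ⨟
    forR j (forBit λ s → forR j' (forBit λ t → forBit λ p → P (blk s t p)))

  phaseE : Bool → Bool → Bool → Bool → Em
  phaseE s t false false = emitC 4
  phaseE s t true  true  = emitC 4
  phaseE s t false true  = bind (testLits true (hi jB) t (hi jA) s) λ b → emitC (if b then 4 else 1)
  phaseE s t true  false = emitC 1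

  weightE : Desc → Desc → Em
  weightE source        idle              = emitC 4
  weightE source        (blk s' t' false) =
    bind (testLits true (hi jA') s' (hi jB') (not t')) λ b → emitC (if b then 3 else 1)
  weightE idle          idle              = emitC 4
  weightE sink          sink              = emitC 4
  weightE (blk s t true) sink             =
    bind (testLits false (hi jB) t (hi jA) s) λ b → emitC (if b then 6 else 1)
  weightE (blk s t p)   (blk s' t' p')    = if not (s xor s')
    then (bind (eq (hi jA) (hi jA')) λ b → if b
      then (bind (testLits true (hi jB) t (hi jB') (not t')) λ b → if b then phaseE s t p p' else emitC 1)
      else emitC 1)
    else emitC 1
  weightE _ _ = emitC 1

  emitInput : Em
  emitInput = emitNum jN ⨟ emitNum jD ⨟ emitC 1 ⨟
    forV jA jB (λ u → forV jA' jB' (λ v → weightE u v)) ⨟ emitNum jK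

  emitted : Sym ⊎ ⊤ → Maybe Sym
  emitted (inj₁ x) = just x
  emitted (inj₂ _) = nothing

  opaque
    -- Every read restarts the emission from the first symbol, with the virtual head position from
    -- `jV` as countdown: time is spent to save space, as in the composition of logarithmic-space
    -- reductions.
    virtualRead : Prog (Maybe Sym)
    virtualRead = bind (cpy (hi jC) (hi jV)) λ _ → bind emitInput λ e → ret (emitted e)

module EmissionSpec (M : TM) (φ : CNF) (short : ShortClauses φ) (U : ℕ) (W<U : length (encCNF φ) < U)
                    (n d k v : ℕ) (us : Vec (Tape (Fin (suc (TM.nΓ M)))) (TM.tapes M)) where
  open Literals M φ short U W<U public
  open Emission M public

  file : ℕ → ℕ → ℕ → ℕ → ℕ → Vec ℕ 9
  file c a b a' b' = n ∷ d ∷ k ∷ v ∷ c ∷ a ∷ b ∷ a' ∷ b' ∷ []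

  data Env (c a b a' b' : ℕ) : St → Set where
    env : ∀ {x₁ x₂ x₃ p} → p ≤ W → Env c a b a' b' (tm x₁ x₂ x₃ (file c a b a' b') p us)

  AnyEnv : ℕ → St → Set
  AnyEnv c s = Σ ℕ λ a → Σ ℕ λ b → Σ ℕ λ a' → Σ ℕ λ b' → Env c a b a' b' s

  -- An emission that stops early abandons its loops in the middle, so nothing is claimed about the
  -- countdown and the loop registers; all other parameters persist.
  Stopped : St → Set
  Stopped s = Σ ℕ λ c → AnyEnv c s

  -- `c` symbols are to be passed over before the wanted one. Formulated with a remaining count
  -- `c'`, the condition composes along concatenation.
  EmPost : (ℕ → St → Set) → List Sym → ℕ → Sym ⊎ ⊤ → St → Set
  EmPost I ws c (inj₁ x) s = readIn ws c ≡ just x × Stopped s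
  EmPost I ws c (inj₂ _) s = Σ ℕ λ c' → c ≡ length ws + c' × I c' s

  Emits : Em → (I I' : ℕ → St → Set) → List Sym → Set
  Emits P I I' ws = ∀ {c s} → I c s → wp P (EmPost I' ws c) s

  post-app : ∀ {I' xs ys c c'} e {s} → c ≡ length xs + c' → EmPost I' ys c' e s → EmPost I' (xs ++ ys) c e s
  post-app {xs = xs} (inj₁ x) refl (r , z) = trans (readIn-++ʳ xs _) r , z
  post-app {xs = xs} {ys} (inj₂ _) refl (c″ , refl , i) =
    c″ , trans (sym (+-assoc (length xs) _ c″)) (cong (_+ c″) (sym (length-++ xs))) , i

  emits-⨟ : ∀ {P Q I I₁ I' xs ys} → Emits P I I₁ xs → Emits Q I₁ I' ys → Emits (P ⨟ Q) I I' (xs ++ ys)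
  emits-⨟ {P} {Q} {I} {I₁} {I'} {xs} {ys} hP hQ {c} i = wp-bind (wp-conseq cont (hP i))
    where
    cont : ∀ e s → EmPost I₁ xs c e s → wp (thenE e Q) (EmPost I' (xs ++ ys) c) s
    cont (inj₁ x) s (r , z)       = wp-ret (readIn-++ˡ xs r , z)
    cont (inj₂ _) s (c' , e , i') = wp-conseq (λ b s' → post-app {xs = xs} b e) (hQ i')

  emits-skip : ∀ {I} → Emits skip I I []
  emits-skip i = wp-ret (_ , refl , i)

  emits-cast : ∀ {P I I' ws ws'} → ws ≡ ws' → Emits P I I' ws → Emits P I I' ws'
  emits-cast refl h = h

  stopped : ∀ {c a b a' b' s} → Env c a b a' b' s → Stopped s
  stopped e = _ , _ , _ , _ , _ , e

  module _ {a b a' b' : ℕ} where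
    E : ℕ → St → Set
    E c s = Env c a b a' b' s

    emits-emit : ∀ x → Emits (emit x) E E (x ∷ [])
    emits-emit x (env le) = wp-bind (wp-decr (hi jC)
      (λ { refl → wp-ret (refl , stopped (env le)) })
      (λ { c' refl → wp-ret (c' , refl , env le) }))

    emits-emitL : ∀ ws → Emits (emitL ws) E E ws
    emits-emitL []       = emits-skip
    emits-emitL (x ∷ ws) = emits-⨟ (emits-emit x) (emits-emitL ws)

    emits-emitC : ∀ m → Emits (emitC m) E E (encNum m)
    emits-emitC m = emits-emitL (encNum m)

    halve-wp : ∀ y h {x₃ ρ p Q} → y + h < U →
      Q (proj₁ (digit y)) (tm 0 (proj₂ (digit y) + h) x₃ ρ p us) →
      wpI halveBody (suc y) tt Q (tm y h x₃ ρ p us)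
    halve-wp 0 h lt q = wpI-step (wp-bind (wp-decr t₁ (λ _ → wp-ret q) λ { _ () }))
    halve-wp 1 h lt q = wpI-step (wp-bind (wp-decr t₁ (λ ()) λ { _ refl →
      wp-bind (wp-decr t₁ (λ _ → wp-ret q) λ { _ () }) }))
    halve-wp (suc (suc y)) h {x₃} {ρ} {p} {Q} lt q = wpI-step (wp-bind (wp-decr t₁ (λ ()) λ { _ refl →
      wp-bind (wp-decr t₁ (λ ()) λ { _ refl →
      wp-bind (wp-inc t₂ (≤-trans (s≤s (m≤n+m h (suc (suc y)))) lt) (wp-ret (wpI-mono (n≤1+n _)
        (halve-wp y (suc h) {Q = Q} (≤-trans (s≤s (≤-trans (≤-reflexive (+-suc y h)) (n≤1+n _))) lt)
          (subst (λ z → Q (proj₁ (digit y)) (tm 0 z x₃ ρ p us)) (sym (+-suc (proj₂ (digit y)) h)) q))))) }) }))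

    -- Each digit leaves a smaller value. Counting rounds by the value is wasteful, but no logarithm
    -- enters the time bound.
    num-wp : ∀ f y {x₂ x₃ c p} → y < f → y < U → p ≤ W →
      wpI numBody f tt (EmPost E (encNum y) c) (tm y x₂ x₃ (file c a b a' b') p us)
    num-wp (suc f) zero {c = c} lt _ le = wpI-step (wp-bind (wp-decr t₁
      (λ _ → wp-bind (wp-conseq (λ _ _ q → wp-ret q) (emits-emit sep (env le))))
      λ { _ () }))
    num-wp (suc f) (suc y) {x₃ = x₃} {c} {p} (s≤s lt) lt' le = wpI-step (wp-bind (wp-decr t₁ (λ ()) λ { _ refl →
      wp-bind (wp-cpy t₂ rZ (wp-bind (wp-iter (U≤2U (<⇒≤ lt')) (halve-wp y 0
        (≤-trans (≤-reflexive (cong suc (+-identityʳ y))) (<⇒≤ lt'))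
        (wp-bind (wp-cpy t₁ t₂ (wp-bind (wp-bind (wp-decr (hi jC)
          (λ { refl → wp-ret (wp-ret (cong (λ z → readIn (z ++ sep ∷ []) 0) (digit-enc y) , stopped (env le))) })
          (λ { c' refl → wp-ret (wp-ret (wpI-conseq (cont c') (num-wp f (m + 0) (m<f f lt) m<U le))) })))))))))) }))
      where
      m = proj₂ (digit y)
      m≤y : m + 0 ≤ y
      m≤y = ≤-trans (≤-reflexive (+-identityʳ m)) (digit-≤ y)
      m<f : ∀ f → suc y ≤ f → m + 0 < f
      m<f f lt = ≤-trans (s≤s m≤y) lt
      m<U : m + 0 < U
      m<U = ≤-trans (s≤s m≤y) (<⇒≤ lt')
      cont : ∀ c' e s → EmPost E (encNum (m + 0)) c' e s → EmPost E (encNum (suc y)) (suc c') e s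
      cont c' e s q = subst (λ z → EmPost E z (suc c') e s)
        (trans (cong (λ z → proj₁ (digit y) ∷ encNum z) (+-identityʳ m)) (sym (cong (_++ sep ∷ []) (digit-enc y))))
        (post-app {xs = proj₁ (digit y) ∷ []} e refl q)

    emits-num : ∀ j {y} → (∀ {c} → V.lookup (file c a b a' b') j ≡ y) → y < U → Emits (emitNum j) E E (encNum y)
    emits-num j {y} e lt {c} (env {x₂ = x₂} {x₃} {p} le) = wp-bind (wp-cpy t₁ (hi j)
      (subst (λ z → wp (iter numBody tt) (EmPost E (encNum y) c) (tm z x₂ x₃ (file c a b a' b') p us)) (sym e)
        (wp-iter (U≤2U lt) (num-wp (suc y) y ≤-refl lt le))))

module Emitters (M : TM) (φ : CNF) (short : ShortClauses φ) (U : ℕ) (W<U : length (encCNF φ) < U)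
                (n d k v : ℕ) (us : Vec (Tape (Fin (suc (TM.nΓ M)))) (TM.tapes M)) where
  open EmissionSpec M φ short U W<U n d k v us public

  -- The four nested loops carry different invariants; this is the part of them on which the rule
  -- for a single loop depends.
  record LoopReg (j : Fin 9) (I : ℕ → ℕ → St → Set) : Set where
    field
      get  : ∀ {i c s} → I i c s → V.lookup (regs s) (hi j) ≡ i
      lim  : ∀ {i c s} → I i c s → V.lookup (regs s) rL ≡ N
      zer  : ∀ {i c s} → I i c s → I 0 c (s [ hi j ↦ V.lookup (regs s) rZ ])
      succ : ∀ {i c s} → I i c s → I (suc i) c (s [ hi j ↦ suc (V.lookup (regs s) (hi j)) ])

  N<U : N < U
  N<U = ≤-trans (s≤s (length-encCNF φ)) W<U

  module _ {j I P} (ℓ : LoopReg j I) (f : Fin N → List Sym)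
           (body : ∀ i → Emits P (I (toℕ i)) (I (toℕ i)) (f i)) where
    open LoopReg ℓ

    -- `m` rounds are left, and `g` sends them to the clause numbers from `i` on; in this form the
    -- induction follows `tabulate`.
    for-wp : ∀ m i (g : Fin m → Fin N) → (∀ k → toℕ (g k) ≡ i + toℕ k) → i + m ≡ N → ∀ {c s} → I i c s →
             wpI (forBody j P) (suc m) tt (EmPost (I N) (concatMap f (tabulate g)) c) s
    for-wp zero i g hg e {c} {s} inv = wpI-step (wp-bind (wp-eq (hi j) rL λ {b} be →
      binEq-elim (λ b → wp (if b then ret (inj₂ (inj₂ tt)) else (bind P λ e → forNext j e)) _ s) be
        (λ _ → wp-ret (c , refl , subst (λ z → I z c s) (trans (sym (+-identityʳ i)) e) inv))
        (λ ne → contradiction (trans (get inv) (trans (trans (sym (+-identityʳ i)) e) (sym (lim inv)))) ne)))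
    for-wp (suc m) i g hg e {c} {s} inv = wpI-step (wp-bind (wp-eq (hi j) rL λ {b} be →
      binEq-elim (λ b → wp (if b then ret (inj₂ (inj₂ tt)) else (bind P λ e → forNext j e)) _ s) be
        (λ eq' → contradiction (trans (sym (get inv)) (trans eq' (trans (lim inv) (sym e)))) (m≢1+m+n' i m))
        (λ _ → wp-bind (wp-conseq after (body (g zero) (subst (λ z → I z c s) (sym g0) inv))))))
      where
      g0 : toℕ (g zero) ≡ i
      g0 = trans (hg zero) (+-identityʳ i)
      m≢1+m+n' : ∀ i m → i ≢ i + suc m
      m≢1+m+n' i m e = m≢1+m+n i (trans e (+-suc i m))
      after : ∀ e' s' → EmPost (I (toℕ (g zero))) (f (g zero)) c e' s' →
              wp (forNext j e') [ (λ a' → wpI (forBody j P) (suc m) a' (EmPost (I N) (concatMap f (tabulate g)) c)) ∣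
                                  EmPost (I N) (concatMap f (tabulate g)) c ] s'
      after (inj₁ x) s' (r , z) = wp-ret (readIn-++ˡ (f (g zero)) r , z)
      after (inj₂ _) s' (c' , e' , inv') = wp-bind (wp-inc (hi j)
        (≤-trans (s≤s (≤-trans (≤-reflexive (get inv')) (<⇒≤ (FP.toℕ<n (g zero))))) N<U)
        (wp-ret (wpI-conseq (λ b s″ → post-app {xs = f (g zero)} b e')
          (for-wp m (suc i) (g ∘ suc) (λ k → trans (hg (suc k)) (+-suc i (toℕ k))) (trans (sym (+-suc i m)) e)
            (subst (λ z → I (suc z) c' _) g0 (succ inv'))))))

    emits-for : Emits (forR j P) (λ c s → Σ ℕ λ i → I i c s) (λ c s → Σ ℕ λ i → I i c s) (concatMap f (allFin N))
    emits-for (i , inv) = wp-bind (wp-cpy (hi j) rZ (wp-conseq weaken (wp-iter (U≤2U N<U)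
      (for-wp N 0 (λ k → k) (λ _ → refl) refl (zer inv)))))
      where
      weaken : ∀ {ws c} e s → EmPost (I N) ws c e s → EmPost (λ c s → Σ ℕ λ i → I i c s) ws c e s
      weaken (inj₁ x) s q             = q
      weaken (inj₂ _) s (c' , e , i') = c' , e , N , i'

  emits-bit : ∀ P {I} (f : Bool → List Sym) → (∀ b → Emits (P b) I I (f b)) → Emits (forBit P) I I (concatMap f bits)
  emits-bit P f h = emits-⨟ (h false) (emits-⨟ (h true) emits-skip)

  data Coord : Desc → Vtx → ℕ → ℕ → Set where
    source : ∀ {a b} → Coord source source a b
    idle   : ∀ {a b} → Coord idle idle a b
    sink   : ∀ {a b} → Coord sink sink a b
    blk    : ∀ {s t p} i k → Coord (blk s t p) (blk (i , s) (k , t) p) (toℕ i) (toℕ k)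

  module _ {j j'} {P : Desc → Em} {I : ℕ → ℕ → ℕ → St → Set}
           (ℓ : LoopReg j (λ a c s → Σ ℕ λ b → I a b c s)) (ℓ' : ∀ {a} → LoopReg j' (I a))
           (f : Vtx → List Sym)
           (body : ∀ {δ u a b} → Coord δ u a b → Emits (P δ) (I a b) (I a b) (f u)) where

    I* : ℕ → St → Set
    I* c s = Σ ℕ λ a → Σ ℕ λ b → I a b c s

    special : ∀ {δ u} → (∀ {a b} → Coord δ u a b) → Emits (P δ) I* I* (f u)
    special co {c} (a , b , i) = wp-conseq weaken (body co i)
      where
      weaken : ∀ {ws} e s → EmPost (I a b) ws c e s → EmPost I* ws c e s
      weaken (inj₁ x) s q            = q
      weaken (inj₂ _) s (c' , e , i) = c' , e , a , b , i

    emits-vertices : Emits (forV j j' P) I* I* (concatMap f vertices)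
    emits-vertices = emits-⨟ (special source) (emits-⨟ (special idle)
      (emits-⨟ (special sink) (emits-⨟ (special sink) (emits-⨟ (special sink) (emits-⨟ (special sink)
        (emits-cast (sym flat) (emits-for {P = rows} ℓ fᵢ λ i →
          emits-bit rowsₛ (fₛ i) λ s → emits-for {P = cols s} ℓ' (fₖ i s) λ k →
          emits-bit (colsₜ s) (fₜ i s k) λ t → emits-bit (λ p → P (blk s t p)) (fₚ i s k t) λ p → body (blk i k))))))))
      where
      colsₜ : Bool → Bool → Em
      colsₜ s t = forBit (λ p → P (blk s t p))
      cols : Bool → Em
      cols s = forBit (colsₜ s)
      rowsₛ : Bool → Em
      rowsₛ s = forR j' (cols s)
      rows : Em
      rows = forBit rowsₛ
      fₚ : Fin N → Bool → Fin N → Bool → Bool → List Sym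
      fₚ i s k t p = f (blk (i , s) (k , t) p)
      fₜ : Fin N → Bool → Fin N → Bool → List Sym
      fₜ i s k t = concatMap (fₚ i s k t) bits
      fₖ : Fin N → Bool → Fin N → List Sym
      fₖ i s k = concatMap (fₜ i s k) bits
      fₛ : Fin N → Bool → List Sym
      fₛ i s = concatMap (fₖ i s) (allFin N)
      fᵢ : Fin N → List Sym
      fᵢ i = concatMap (fₛ i) bits
      flat : concatMap f blocks ≡ concatMap fᵢ (allFin N)
      flat = trans (concatMap-concatMap f vᵢ (allFin N)) (concatMap-cong (λ i →
             trans (concatMap-concatMap f (vₛ i) bits) (concatMap-cong (λ s →
             trans (concatMap-concatMap f (vₖ i s) (allFin N)) (concatMap-cong (λ k →
             trans (concatMap-concatMap f (vₜ i s k) bits) (concatMap-cong (λ t →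
             trans (concatMap-concatMap f (vₚ i s k t) bits) (concatMap-cong (λ p →
             ++-identityʳ (fₚ i s k t p)) bits)) bits)) (allFin N))) bits)) (allFin N))

  module _ {a b a' b' : ℕ} where

    EE : ℕ → St → Set
    EE c s = Env c a b a' b' s

    emits-test : ∀ x {j s j' s'} (P : Bool → Em) (f : Bool → List Sym) i i' →
      (∀ {c} → V.lookup (file c a b a' b') j ≡ toℕ i) → (∀ {c} → V.lookup (file c a b a' b') j' ≡ toℕ i') →
      (∀ t → Emits (P t) EE EE (f t)) →
      Emits (bind (testLits x (hi j) s (hi j') s') P) EE EE (f (litTest x (lit (i , s)) (lit (i' , s'))))
    emits-test x {j} {s} {j'} {s'} P f i i' e e' h (env le) =
      wp-bind (testLits-wp j i e s j' i' e' s' x le λ le' → h _ (env le'))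

    emits-weight : ∀ {δ u ε v} → Coord δ u a b → Coord ε v a' b' → Emits (weightE δ ε) EE EE (encNum (wt u v))
    emits-weight source source = emits-emitC 1
    emits-weight source idle   = emits-emitC 4
    emits-weight source sink   = emits-emitC 1
    emits-weight source (blk {s'} {t'} {false} i' k') =
      emits-test true (λ t → emitC (if t then 3 else 1)) (λ t → encNum (if t then 3 else 1)) i' k' refl refl (λ t → emits-emitC (if t then 3 else 1))
    emits-weight source (blk {s'} {t'} {true} i' k') = emits-emitC 1
    emits-weight idle source = emits-emitC 1
    emits-weight idle idle   = emits-emitC 4
    emits-weight idle sink   = emits-emitC 1
    emits-weight idle (blk i' k') = emits-emitC 1
    emits-weight sink source = emits-emitC 1
    emits-weight sink idle   = emits-emitC 1
    emits-weight sink sink   = emits-emitC 4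
    emits-weight sink (blk i' k') = emits-emitC 1
    emits-weight (blk {p = true}  i k) source = emits-emitC 1
    emits-weight (blk {p = false} i k) source = emits-emitC 1
    emits-weight (blk {p = true}  i k) idle = emits-emitC 1
    emits-weight (blk {p = false} i k) idle = emits-emitC 1
    emits-weight (blk {s} {t} {true} i k) sink =
      emits-test false (λ t → emitC (if t then 6 else 1)) (λ t → encNum (if t then 6 else 1)) k i refl refl (λ t → emits-emitC (if t then 6 else 1))
    emits-weight (blk {p = false} i k) sink = emits-emitC 1
    emits-weight (blk {s} {t} {p} i k) (blk {s'} {t'} {p'} i' k') = cases p p'
      where
      comp = litTest true (lit (k , t)) (lit (k' , not t'))
      back = litTest true (lit (k , t)) (lit (i , s))

      phase-emits : ∀ p p' → Emits (phaseE s t p p') EE EE (encNum (phaseWt p p' back))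
      phase-emits false false = emits-emitC 4
      phase-emits true  true  = emits-emitC 4
      phase-emits false true  =
        emits-test true (λ t → emitC (if t then 4 else 1)) (λ t → encNum (if t then 4 else 1)) k i refl refl (λ t → emits-emitC (if t then 4 else 1))
      phase-emits true  false = emits-emitC 1

      inner : ∀ p p' → Emits (bind (testLits true (hi jB) t (hi jB') (not t')) λ b → if b then phaseE s t p p' else emitC 1) EE EE
                       (encNum (if comp then phaseWt p p' back else 1))
      inner p p' = emits-test true (λ b → if b then phaseE s t p p' else emitC 1)
        (λ c → encNum (if c then phaseWt p p' back else 1)) k k' refl refl
        λ { true → phase-emits p p' ; false → emits-emitC 1 }

      anchor : ∀ p p' → Emits (bind (eq (hi jA) (hi jA')) λ b → if b
                        then (bind (testLits true (hi jB) t (hi jB') (not t')) λ b → if b then phaseE s t p p' else emitC 1)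
                        else emitC 1) EE EE
                      (encNum (if ⌊ i F.≟ i' ⌋ then (if comp then phaseWt p p' back else 1) else 1))
      anchor p p' {c} {σ} (env le) = wp-bind (wp-eq (hi jA) (hi jA') λ {b} be → decide be)
        where
        decide : ∀ {b} → BinEq b (toℕ i) (toℕ i') → wp (if b
                        then (bind (testLits true (hi jB) t (hi jB') (not t')) λ b → if b then phaseE s t p p' else emitC 1)
                        else emitC 1) (EmPost EE (encNum (if ⌊ i F.≟ i' ⌋ then (if comp then phaseWt p p' back else 1) else 1)) c) σ
        decide be with i F.≟ i'
        ... | yes refl = binEq-elim (λ b → wp (if b then _ else _) _ _) be (λ _ → inner p p' (env le)) (λ ne → contradiction refl ne)
        ... | no  ne   = binEq-elim (λ b → wp (if b then _ else _) _ _) be (λ e → contradiction (FP.toℕ-injective e) ne) (λ _ → emits-emitC 1 (env le))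

      sides : ∀ p p' q → Emits (if q then (bind (eq (hi jA) (hi jA')) λ b → if b
                        then (bind (testLits true (hi jB) t (hi jB') (not t')) λ b → if b then phaseE s t p p' else emitC 1)
                        else emitC 1) else emitC 1) EE EE
                      (encNum (if q ∧ ⌊ i F.≟ i' ⌋ then (if comp then phaseWt p p' back else 1) else 1))
      sides p p' true  = anchor p p'
      sides p p' false = emits-emitC 1

      cases : ∀ p p' → Emits (weightE (blk s t p) (blk s' t' p')) EE EE
                (encNum (wt (blk (i , s) (k , t) p) (blk (i' , s') (k' , t') p')))
      cases false p' = sides false p' (not (s xor s'))
      cases true  p' = sides true  p' (not (s xor s'))

  word : List Sym
  word = encNum n ++ encNum d ++ encNum 1 ++
         concatMap (λ u → concatMap (λ v → encNum (wt u v)) vertices) vertices ++ encNum k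

  loopA' : ∀ {a b} → LoopReg jA' (λ a' c s → Σ ℕ λ b' → Env c a b a' b' s)
  loopA' = record
    { get = λ { (_ , env _) → refl } ; lim = λ { (_ , env _) → refl }
    ; zer = λ { (b' , env le) → b' , env le } ; succ = λ { (b' , env le) → b' , env le } }

  loopB' : ∀ {a b a'} → LoopReg jB' (λ b' c s → Env c a b a' b' s)
  loopB' = record
    { get = λ { (env _) → refl } ; lim = λ { (env _) → refl }
    ; zer = λ { (env le) → env le } ; succ = λ { (env le) → env le } }

  Rest : ℕ → ℕ → ℕ → St → Set
  Rest a b c s = Σ ℕ λ a' → Σ ℕ λ b' → Env c a b a' b' s

  loopA : LoopReg jA (λ a c s → Σ ℕ λ b → Rest a b c s)
  loopA = record
    { get = λ { (_ , _ , _ , env _) → refl } ; lim = λ { (_ , _ , _ , env _) → refl }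
    ; zer = λ { (b , a' , b' , env le) → b , a' , b' , env le } ; succ = λ { (b , a' , b' , env le) → b , a' , b' , env le } }

  loopB : ∀ {a} → LoopReg jB (Rest a)
  loopB = record
    { get = λ { (_ , _ , env _) → refl } ; lim = λ { (_ , _ , env _) → refl }
    ; zer = λ { (a' , b' , env le) → a' , b' , env le } ; succ = λ { (a' , b' , env le) → a' , b' , env le } }

  emits-matrix : Emits (forV jA jB (λ u → forV jA' jB' (λ v → weightE u v))) AnyEnv AnyEnv
                   (concatMap (λ u → concatMap (λ v → encNum (wt u v)) vertices) vertices)
  emits-matrix = emits-vertices {P = λ u → forV jA' jB' (weightE u)} loopA loopB (λ u → concatMap (λ v → encNum (wt u v)) vertices) λ {δ} {u} co →
    emits-vertices {P = weightE δ} loopA' loopB' (λ v → encNum (wt u v)) λ co' → emits-weight co co'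

  emits-any : ∀ {P ws} → (∀ {a b a' b'} → Emits P (EE {a} {b} {a'} {b'}) EE ws) → Emits P AnyEnv AnyEnv ws
  emits-any h {c} (a , b , a' , b' , e) = wp-conseq weaken (h e)
    where
    weaken : ∀ {ws} e s → EmPost (EE {a} {b} {a'} {b'}) ws c e s → EmPost AnyEnv ws c e s
    weaken (inj₁ x) s q            = q
    weaken (inj₂ _) s (c' , e , i) = c' , e , a , b , a' , b' , i

  emits-input : n < U → d < U → k < U → Emits emitInput AnyEnv AnyEnv word
  emits-input n< d< k< =
    emits-⨟ (emits-any (emits-num jN refl n<)) (emits-⨟ (emits-any (emits-num jD refl d<))
      (emits-⨟ (emits-any (emits-emitC 1)) (emits-⨟ emits-matrix (emits-any (emits-num jK refl k<)))))

  readIn-end : ∀ xs c → readIn xs (length xs + c) ≡ nothing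
  readIn-end []       c = refl
  readIn-end (x ∷ xs) c = readIn-end xs c

  opaque
    unfolding virtualRead

    virtualRead-wp : n < U → d < U → k < U → ∀ {s Q} → Stopped s →
      (∀ {s'} → Stopped s' → Q (readIn word v) s') → wp virtualRead Q s
    virtualRead-wp n< d< k< {Q = Q} (c , a , b , a' , b' , env le) q =
      wp-bind (wp-cpy (hi jC) (hi jV) (wp-bind (wp-conseq cont (emits-input n< d< k< (a , b , a' , b' , env le)))))
      where
      cont : ∀ e s → EmPost AnyEnv word v e s → wp (ret (emitted e)) Q s
      cont (inj₁ x) s (r , z)          = wp-ret (subst (λ y → Q y s) r (q z))
      cont (inj₂ _) s (c' , refl , i)  = wp-ret (subst (λ y → Q y s) (readIn-end word c') (q (c' , i)))

-- Simulation of the approximation algorithm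

-- State 4 is reached exactly on words beginning with the codes of 1 and 2.
scan : Fin 6 → Sym → Fin 6
scan zero s0 = suc zero
scan (suc zero) sep = suc (suc zero)
scan (suc (suc zero)) s1 = suc (suc (suc zero))
scan (suc (suc (suc zero))) sep = suc (suc (suc (suc zero)))
scan (suc (suc (suc (suc zero)))) _ = suc (suc (suc (suc zero)))
scan _ _ = suc (suc (suc (suc (suc zero))))

scanMaybe : Fin 6 → Maybe Sym → Fin 6
scanMaybe d nothing  = d
scanMaybe d (just x) = scan d x

scanned : List Sym → Fin 6
scanned = foldl scan zero

isFour : Fin 6 → Bool
isFour (suc (suc (suc (suc zero)))) = true
isFour _ = false

scan-four : ∀ xs → foldl scan (suc (suc (suc (suc zero)))) xs ≡ suc (suc (suc (suc zero)))
scan-four []       = refl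
scan-four (x ∷ xs) = scan-four xs

scan-five : ∀ xs → foldl scan (suc (suc (suc (suc (suc zero))))) xs ≡ suc (suc (suc (suc (suc zero))))
scan-five []       = refl
scan-five (x ∷ xs) = scan-five xs

scanned-two : ∀ r → isFour (scanned (encNum 1 ++ encNum 2 ++ r)) ≡ true
scanned-two r = cong isFour (scan-four r)

scanned-other : ∀ m r → m ≢ 2 → isFour (scanned (encNum 1 ++ encNum m ++ r)) ≡ false
scanned-other m r ne = cong isFour (go (encℕ m) refl (encℕᵇ-nonSep _))
  where
  two : Fin 6
  two = suc (suc zero)
  five : Fin 6
  five = suc (suc (suc (suc (suc zero))))
  go : ∀ xs → encℕ m ≡ xs → All NonSep xs → foldl scan two ((xs ++ sep ∷ []) ++ r) ≡ five
  go []               e _ = scan-five r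
  go (s0 ∷ xs)        e _ = scan-five ((xs ++ sep ∷ []) ++ r)
  go (sep ∷ xs)       e _ = scan-five ((xs ++ sep ∷ []) ++ r)
  go (s1 ∷ [])        e _ = contradiction (encℕ-injective m 2 e) ne
  go (s1 ∷ s0 ∷ xs)   e _ = scan-five ((xs ++ sep ∷ []) ++ r)
  go (s1 ∷ s1 ∷ xs)   e _ = scan-five ((xs ++ sep ∷ []) ++ r)
  go (s1 ∷ sep ∷ xs)  e (_ ∷ n ∷ _) = ⊥-elim (n refl)

module Main (M : TM) where
  open Programs M
  open Emission M

  incs : Fin 15 → ℕ → Prog ⊤
  incs r zero    = ret tt
  incs r (suc m) = bind (inc r) λ _ → incs r m

  countSym : ⊤ → Prog (⊤ ⊎ ⊤)
  countSym _ = bind readSym λ x →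
    if is-just x then (bind (moveHead R) λ _ → bind (inc rW) λ _ → ret (inj₁ tt)) else ret (inj₂ tt)

  countClause : ⊤ → Prog (⊤ ⊎ ⊤)
  countClause _ = bind readSym λ x →
    if is-just x then (bind skipClause λ _ → bind (inc rL) λ _ → ret (inj₁ tt)) else ret (inj₂ tt)

  computeN : Prog ⊤
  computeN = bind (incs (hi jN) 6) λ _ → bind (cpy (hi jA) rL) λ _ →
    loopDec (hi jA) (bind (cpy (hi jB) rL) λ _ → loopDec (hi jB) (incs (hi jN) 8))

  computeDK : Prog ⊤
  computeDK = bind (incs (hi jD) 2) λ _ → bind (incs (hi jK) 8) λ _ → bind (cpy (hi jA) rL) λ _ →
    loopDec (hi jA) (bind (incs (hi jD) 4) λ _ → incs (hi jK) 16)

  -- The length of the virtual input is never computed: its end is recognised by the blank that has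
  -- just been read.
  moveVirtual : Maybe Sym → Move → Prog ⊤
  moveVirtual x        L = bind (decr (hi jV)) λ _ → ret tt
  moveVirtual x        S = ret tt
  moveVirtual nothing  R = ret tt
  moveVirtual (just _) R = inc (hi jV)

  Control = Fin (TM.nQ M) × Fin 6

  simStep : Control → Prog (Control ⊎ Bool)
  simStep (q , d) = bind virtualRead λ x → bind (mstep q x) λ r →
    bind (moveVirtual x (proj₁ (proj₂ r))) λ _ → ret (inj₁ (proj₁ r , scanMaybe d (proj₂ (proj₂ r))))

  simBody : Control → Prog (Control ⊎ Bool)
  simBody (q , d) = if TM.halt M q then ret (inj₂ (isFour d)) else simStep (q , d)

  afterInit : Prog Bool
  afterInit = bind (iter countSym tt) λ _ → bind rewind λ _ → bind (iter countClause tt) λ _ →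
    bind computeN λ _ → bind computeDK λ _ → iter simBody (TM.start M , zero)

  opaque
    main : Prog Bool
    main = bind init-regs λ _ → afterInit

-- 6 special vertices and 2 * 2 * 2 blocks for each pair of clauses; D + 1 vertices on a walk with D
-- edges; and 4D + 4, written in terms of N.
nOf dOf kOf : ℕ → ℕ
nOf N = 6 + N * (N * 8)
dOf N = 2 + N * 4
kOf N = 8 + N * 16

module Correct (M : TM) (φ : CNF) (short : ShortClauses φ) (U : ℕ) (W<U : length (encCNF φ) < U)
               (n<U : nOf (length φ) < U) (d<U : dOf (length φ) < U) (k<U : kOf (length φ) < U) where
  open Literals M φ short U W<U
  open Main M
  open Emission M

  module Em = Emitters M φ short U W<U (nOf N) (dOf N) (kOf N)

  vw : List Sym
  vw = encNum (nOf N) ++ encNum (dOf N) ++ encNum 1 ++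
       concatMap (λ u → concatMap (λ v → encNum (wt u v)) vertices) vertices ++ encNum (kOf N)

  incs-wp : ∀ r m {s Q} x → V.lookup (regs s) r ≡ x → m + x ≤ U → Q tt (s [ r ↦ m + x ]) → wp (incs r m) Q s
  incs-wp r zero {s} {Q} x e le q = wp-ret (subst (λ ρ → Q tt (mkSt ρ (ip s) (sims s)))
    (trans (cong (regs s [ r ]≔_) (sym e)) (VP.[]≔-lookup (regs s) r)) q)
  incs-wp r (suc m) {s} {Q} x refl le q = wp-bind (wp-inc r (≤-trans (s≤s (m≤n+m x m)) le)
    (incs-wp r m (suc x) (VP.lookup∘updateAt r (regs s)) (≤-trans (≤-reflexive (+-suc m x)) le)
      (subst (λ ρ → Q tt (mkSt ρ (ip s) (sims s)))
        (trans (cong (regs s [ r ]≔_) (sym (+-suc m x))) (sym (VP.[]≔-idempotent (regs s) r))) q)))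

  N<U : N < U
  N<U = ≤-trans (s≤s (length-encCNF φ)) W<U

  module _ {us : Sims} where

    raw : ℕ → ℕ → Vec ℕ 9 → ℕ → St
    raw ℓ y ρ p = mkSt (0 ∷ 0 ∷ 0 ∷ 0 ∷ ℓ ∷ y ∷ ρ) p us

    countSym-wp : ∀ xs {p ρ Q} → Pos p xs → Q tt (raw 0 W ρ W) → wpI countSym (suc (length xs)) tt Q (raw 0 p ρ p)
    countSym-wp [] {p} {ρ} {Q} P q = wpI-step (wp-bind (wp-read
      (subst (λ x → wp (if is-just x then _ else _) [ _ ∣ Q ] (raw 0 p ρ p)) (sym (pos-read P))
        (wp-ret (subst (λ z → Q tt (raw 0 z ρ z)) (sym (trans (sym (+-identityʳ p)) (pos-len P))) q)))))
    countSym-wp (x ∷ xs) {p} {ρ} {Q} P q = wpI-step (wp-bind (wp-read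
      (subst (λ x → wp (if is-just x then _ else _) [ _ ∣ Q ] (raw 0 p ρ p)) (sym (pos-read P))
        (wp-bind (wp-move R (wp-bind (wp-inc rW
          (≤-trans (s≤s (pos-≤ P)) W<U)
          (wp-ret (subst (λ z → wpI countSym (suc (length xs)) tt Q (raw 0 z ρ (moveIn W R p)))
                         (stepped P) (countSym-wp xs (pos-next P) q))))))))))
      where
      stepped : Pos p (x ∷ xs) → moveIn W R p ≡ suc p
      stepped P = +-cancelʳ-≡ (length xs) _ _ (trans (pos-len (pos-next P)) (trans (sym (pos-len P)) (+-suc p (length xs))))

    head-just : ∀ xs {r} → Σ Sym λ x → readIn (xs ++ sep ∷ r) 0 ≡ just x
    head-just []       = sep , refl
    head-just (x ∷ xs) = x , refl

    countClause-wp : ∀ ψ {p ℓ ρ Q} → Pos p (encCNF ψ) → ℓ + length ψ ≡ N → (∀ {p'} → p' ≤ W → Q tt (raw N W ρ p')) →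
                     wpI countClause (suc (length ψ)) tt Q (raw ℓ W ρ p)
    countClause-wp [] {p} {ℓ} {ρ} {Q} P e q = wpI-step (wp-bind (wp-read
      (subst (λ x → wp (if is-just x then _ else _) [ _ ∣ Q ] (raw ℓ W ρ p)) (sym (pos-read P))
        (wp-ret (subst (λ z → Q tt (raw z W ρ p)) (sym (trans (sym (+-identityʳ ℓ)) e)) (q (pos-≤ P)))))))
    countClause-wp (C ∷ ψ) {p} {ℓ} {ρ} {Q} P e q = wpI-step (wp-bind (wp-read
      (subst (λ x → wp (if is-just x then _ else _) [ _ ∣ Q ] (raw ℓ W ρ p)) (sym (trans (pos-read P) nonempty))
        (wp-bind (skipClause-wp C P W<U λ P' → wp-bind (wp-inc rL
          (≤-trans (s≤s (≤-trans (m≤m+n ℓ _) (≤-trans (≤-reflexive e) (length-encCNF φ)))) W<U)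
          (wp-ret (countClause-wp ψ P' (trans (sym (+-suc ℓ (length ψ))) e) q))))))))
      where
      nonempty : readIn (encCNF (C ∷ ψ)) 0 ≡ just (proj₁ (head-just (concatMap encLit C)))
      nonempty = trans (cong (λ z → readIn z 0) (++-assoc (concatMap encLit C) (sep ∷ []) (encCNF ψ))) (proj₂ (head-just (concatMap encLit C)))

    computeN-wp : ∀ {p Q} → (∀ {a b} → Q tt (raw N W (nOf N ∷ 0 ∷ 0 ∷ 0 ∷ 0 ∷ a ∷ b ∷ 0 ∷ 0 ∷ []) p)) →
                  wp computeN Q (raw N W (0 ∷ 0 ∷ 0 ∷ 0 ∷ 0 ∷ 0 ∷ 0 ∷ 0 ∷ 0 ∷ []) p)
    computeN-wp {p} {Q} q = wp-bind (incs-wp (hi jN) 6 0 refl (≤-trans (m≤m+n 6 _) (<⇒≤ n<U))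
      (wp-bind (wp-cpy (hi jA) rL (loopDec-wp I (λ { (_ , _ , _ , refl) → refl }) outer N<U (6 , 0 , refl , refl)
        (λ { (x , b , e , refl) → subst (λ z → Q tt (raw N W (z ∷ _) p)) (sym (trans (sym (+-identityʳ x)) e)) q })))))
      where
      I : ℕ → St → Set
      I y s = Σ ℕ λ x → Σ ℕ λ b → x + y * (N * 8) ≡ nOf N × s ≡ raw N W (x ∷ 0 ∷ 0 ∷ 0 ∷ 0 ∷ y ∷ b ∷ 0 ∷ 0 ∷ []) p
      I′ : ℕ → ℕ → ℕ → St → Set
      I′ y X z s = Σ ℕ λ x → x + z * 8 ≡ X × s ≡ raw N W (x ∷ 0 ∷ 0 ∷ 0 ∷ 0 ∷ y ∷ z ∷ 0 ∷ 0 ∷ []) p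
      inner : ∀ {y X} → X ≤ nOf N → ∀ {z s} → I′ y X (suc z) s → wp (incs (hi jN) 8) (λ _ → I′ y X z) (s [ hi jB ↦ z ])
      inner {X = X} le {z} (x , e , refl) = incs-wp (hi jN) 8 x refl
        (≤-trans (≤-trans (m≤m+n (8 + x) (z * 8)) (≤-trans (≤-reflexive (trans (lem x (z * 8)) e)) le)) (<⇒≤ n<U))
        (8 + x , trans (lem x (z * 8)) e , refl)
        where
        lem : ∀ x y → 8 + x + y ≡ x + (8 + y)
        lem = solve-∀
      outer : ∀ {y s} → I (suc y) s → wp (bind (cpy (hi jB) rL) λ _ → loopDec (hi jB) (incs (hi jN) 8)) (λ _ → I y) (s [ hi jA ↦ y ])
      outer {y} (x , b , e , refl) = wp-bind (wp-cpy (hi jB) rL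
        (loopDec-wp (I′ y (x + N * 8)) (λ { (_ , _ , refl) → refl }) (inner (≤-trans (+-monoʳ-≤ x (m≤m+n (N * 8) _)) (≤-reflexive e))) N<U (x , refl , refl)
          (λ { (x' , e' , refl) → x' , 0 , trans (cong (_+ y * (N * 8)) (trans (sym (+-identityʳ x')) e')) (trans (+-assoc x (N * 8) _) e) , refl })))

    computeDK-wp : ∀ {p a b Q} → (∀ {a} → Q tt (raw N W (nOf N ∷ dOf N ∷ kOf N ∷ 0 ∷ 0 ∷ a ∷ b ∷ 0 ∷ 0 ∷ []) p)) →
                   wp computeDK Q (raw N W (nOf N ∷ 0 ∷ 0 ∷ 0 ∷ 0 ∷ a ∷ b ∷ 0 ∷ 0 ∷ []) p)
    computeDK-wp {p} {a} {b} {Q} q = wp-bind (incs-wp (hi jD) 2 0 refl (≤-trans (m≤m+n 2 _) (<⇒≤ d<U))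
      (wp-bind (incs-wp (hi jK) 8 0 refl (≤-trans (m≤m+n 8 _) (<⇒≤ k<U))
      (wp-bind (wp-cpy (hi jA) rL (loopDec-wp I (λ { (_ , _ , _ , _ , refl) → refl }) loop N<U (2 , 8 , refl , refl , refl)
        (λ { (x , z , e , f , refl) → subst₂ (λ x z → Q tt (raw N W (nOf N ∷ x ∷ z ∷ _) p))
               (sym (trans (sym (+-identityʳ x)) e)) (sym (trans (sym (+-identityʳ z)) f)) q })))))))
      where
      I : ℕ → St → Set
      I y s = Σ ℕ λ x → Σ ℕ λ z → x + y * 4 ≡ dOf N × z + y * 16 ≡ kOf N ×
              s ≡ raw N W (nOf N ∷ x ∷ z ∷ 0 ∷ 0 ∷ y ∷ b ∷ 0 ∷ 0 ∷ []) p
      swap : ∀ c x y → c + x + y ≡ x + (c + y)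
      swap = solve-∀
      loop : ∀ {y s} → I (suc y) s → wp (bind (incs (hi jD) 4) λ _ → incs (hi jK) 16) (λ _ → I y) (s [ hi jA ↦ y ])
      loop {y} (x , z , e , f , refl) =
        wp-bind (incs-wp (hi jD) 4 x refl (≤-trans (m≤m+n (4 + x) (y * 4)) (≤-trans (≤-reflexive (trans (swap 4 x (y * 4)) e)) (<⇒≤ d<U)))
        (incs-wp (hi jK) 16 z refl (≤-trans (m≤m+n (16 + z) (y * 16)) (≤-trans (≤-reflexive (trans (swap 16 z (y * 16)) f)) (<⇒≤ k<U)))
        (4 + x , 16 + z , trans (swap 4 x (y * 4)) e , trans (swap 16 z (y * 16)) f , refl)))

  readIn-nothing : ∀ xs {p} → p ≤ length xs → readIn xs p ≡ nothing → p ≡ length xs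
  readIn-nothing []       z≤n      _ = refl
  readIn-nothing (x ∷ xs) (s≤s le) e = cong suc (readIn-nothing xs le e)

  readIn-just : ∀ xs {p x} → readIn xs p ≡ just x → p < length xs
  readIn-just (x ∷ xs) {zero}  e = s≤s z≤n
  readIn-just (x ∷ xs) {suc p} e = s≤s (readIn-just xs e)

  ≡ᵇ-refl : ∀ n → (n ≡ᵇ n) ≡ true
  ≡ᵇ-refl zero    = refl
  ≡ᵇ-refl (suc n) = ≡ᵇ-refl n

  module Simulation (T : ℕ) (T<U : T < U) (len<U : length vw < U) (stops : Halted M (run M vw T)) where

    c : ℕ → Config M
    c = run M vw

    Final : Bool → St → Set
    Final b s = b ≡ isFour (scanned (Config.out (c T))) × sims s ≡ Config.work (c T)

    move-wp : ∀ mv {p us s} (Q : ⊤ → St → Set) → p ≤ length vw → Em.Stopped p us s →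
      (∀ {s'} → moveIn (length vw) mv p ≤ length vw → Em.Stopped (moveIn (length vw) mv p) us s' → Q tt s') →
      wp (moveVirtual (readIn vw p) mv) Q s
    move-wp L {zero} Q le (_ , _ , _ , _ , _ , EmissionSpec.env lp) q =
      wp-bind (wp-decr (hi jV) (λ _ → wp-ret (q le (_ , _ , _ , _ , _ , EmissionSpec.env lp))) λ { _ () })
    move-wp L {suc p} Q le (_ , _ , _ , _ , _ , EmissionSpec.env lp) q =
      wp-bind (wp-decr (hi jV) (λ ()) λ { _ refl → wp-ret (q (<⇒≤ le) (_ , _ , _ , _ , _ , EmissionSpec.env lp)) })
    move-wp S Q le st q = wp-ret (q le st)
    move-wp R {p} {us} {s} Q le st q with readIn vw p in e
    ... | nothing = wp-ret (q (≤-trans (≤-reflexive stay) le) (subst (λ z → Em.Stopped z us s) (sym stay) st))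
      where
      stay : moveIn (length vw) R p ≡ p
      stay = cong (λ b → if b then p else suc p)
               (trans (cong (_≡ᵇ length vw) (readIn-nothing vw le e)) (≡ᵇ-refl (length vw)))
    ... | just x with st
    ...   | (_ , _ , _ , _ , _ , EmissionSpec.env lp) = wp-inc (hi jV) (≤-trans (s≤s le) len<U)
      (via adv lt (_ , _ , _ , _ , _ , EmissionSpec.env lp) q)
      where
      via : ∀ {z s'} → z ≡ suc p → suc p ≤ length vw → Em.Stopped (suc p) us s' →
            (z ≤ length vw → Em.Stopped z us s' → Q tt s') → Q tt s'
      via refl le st q = q le st
      lt : p < length vw
      lt = readIn-just vw e
      adv : moveIn (length vw) R p ≡ suc p
      adv = cong (λ b → if b then p else suc p) (<⇒≢ᵇ lt)

    scanned-out : ∀ o x → scanned (outApp M o x) ≡ scanMaybe (scanned o) x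
    scanned-out o nothing  = refl
    scanned-out o (just x) = foldl-++ scan zero o (x ∷ [])

    -- `r` steps are left until a time at which `M` is known to have halted. Should it halt earlier,
    -- its configuration is already the final one; the extra round of fuel is for noticing the halt.
    simulate : ∀ r t → r + t ≡ T → ∀ {s} → Config.inPos (c t) ≤ length vw →
      Em.Stopped (Config.inPos (c t)) (Config.work (c t)) s →
      wpI simBody (suc r) (Config.state (c t) , scanned (Config.out (c t))) Final s
    simulate r t e {s} le st = wpI-step (go r e (TM.halt M (Config.state (c t))) refl)
      where
      q = Config.state (c t)
      d = scanned (Config.out (c t))
      x = readIn vw (Config.inPos (c t))
      δ-out = TM.δ M q x (V.map (headSym M) (Config.work (c t)))
      next-cfg = stepTo M vw δ-out (c t)
      sims≡ : ∀ {p us s} → Em.Stopped p us s → sims s ≡ us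
      sims≡ (_ , _ , _ , _ , _ , EmissionSpec.env _) = refl
      go : ∀ r → r + t ≡ T → ∀ h → TM.halt M q ≡ h →
           wp (if h then ret (inj₂ (isFour d)) else simStep (q , d)) [ (λ a' → wpI simBody r a' Final) ∣ Final ] s
      go r e true h = wp-ret (cong (λ z → isFour (scanned (Config.out z))) same-cfg , trans (sims≡ st) (cong Config.work same-cfg))
        where
        same-cfg : c t ≡ c T
        same-cfg = sym (run-halted-≤ M vw (≤-trans (m≤n+m t r) (≤-reflexive e)) h)
      go zero refl false h = contradiction (trans (sym stops) h) λ ()
      go (suc r) e false h = wp-bind (Em.virtualRead-wp _ _ n<U d<U k<U st λ where
        (_ , _ , _ , _ , _ , EmissionSpec.env lp) → wp-bind (wp-mstep q x (wp-bind
          (move-wp (proj₁ (proj₂ δ-out)) _ le (_ , _ , _ , _ , _ , EmissionSpec.env lp) λ {s'} le' st' → wp-ret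
            (subst (λ z → wpI simBody (suc r) (Config.state next-cfg , z) Final s') (scanned-out (Config.out (c t)) (proj₂ (proj₂ (proj₂ δ-out))))
              (transport s' le' st'))))))
        where
        eqn : next-cfg ≡ c (suc t)
        eqn = sym (step-running M vw (c t) h)
        transport : ∀ s' → Config.inPos next-cfg ≤ length vw →
          Em.Stopped (Config.inPos next-cfg) (Config.work next-cfg) s' →
          wpI simBody (suc r) (Config.state next-cfg , scanned (Config.out next-cfg)) Final s'
        transport s' le' st' = subst
          (λ z → Config.inPos z ≤ length vw → Em.Stopped (Config.inPos z) (Config.work z) s' →
                 wpI simBody (suc r) (Config.state z , scanned (Config.out z)) Final s')
          (sym eqn) (simulate r (suc t) (trans (+-suc r t) e)) le' st'

    us₀ : Sims
    us₀ = Config.work (initConfig M)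

    afterInit-wp : wp afterInit Final (mkSt (V.replicate 15 0) 0 us₀)
    afterInit-wp =
      wp-bind (wp-iter (U≤2U W<U) (countSym-wp (encCNF φ) pos-start
      (wp-bind (rewind-wp ≤-refl
      (wp-bind (wp-iter (U≤2U N<U) (countClause-wp φ pos-start refl λ le →
      wp-bind (computeN-wp
      (wp-bind (computeDK-wp
      (wp-iter (U≤2U T<U) (simulate T 0 (+-identityʳ T) z≤n (_ , _ , _ , _ , _ , EmissionSpec.env le)))))))))))))

    module P = Compile (suc (TM.tapes M)) nSym

    sim₀ : ∀ n → Pointwise SimTape (V.replicate n (mkTape (λ _ → zero) 0 0)) (V.replicate n (mkTape (λ _ → zero) 0 0))
    sim₀ zero    = []
    sim₀ (suc n) = simTape (λ _ → cong proj₂ dec-zero) refl z≤n z≤n ∷ sim₀ n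

    opaque
      unfolding main

      main-exec : Σ Bool λ b → Σ St λ s → Σ Mem λ m →
                  Exec (2 * U) main (P.initMem main (encCNF φ)) b m × Rep s m × Final b s
      main-exec =
        let m₁ , x , H = init-exec {us = us₀} {ip = 0} {t = mkTape (λ _ → zero) 0 0} (λ _ → refl) refl refl (sim₀ (TM.tapes M))
            b , s , m , y , R' , f = wp.exec afterInit-wp (rep H (λ r → sym (VP.lookup-replicate r 0)) (≤-trans (≤-trans (s≤s z≤n) W<U) (m≤m+n U _)))
        in b , s , m , (tt , m₁ , x , y) , R' , f

-- Weights of walks in the instance

ok : ∀ {m n} {_ : 𝔹.T (m ≤ᵇ n)} → m ≤ n
ok {m} {n} {t} = ≤ᵇ⇒≤ m n t

argmax : ∀ {m} (f : Fin (suc m) → ℕ) → Σ (Fin (suc m)) λ i → ∀ j → f j ≤ f i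
argmax {zero}  f = zero , λ { zero → ≤-refl }
argmax {suc m} f with argmax (f ∘ suc)
... | i , h with ≤-total (f zero) (f (suc i))
...   | inj₁ le = suc i , λ { zero → le ; (suc j) → h j }
...   | inj₂ le = zero , λ { zero → ≤-refl ; (suc j) → ≤-trans (h j) le }

opaque
  -- The guarantee `Approx` is conditional on an optimal value, so one has to be exhibited before it
  -- says anything. Dynamic programming on the number of remaining steps produces it.
  optimum : (x : HPP) → Σ ℕ (IsOptValue x)
  optimum x = weight x y , (y , refl) , λ where
      (js , e) → proj₂ (proj₂ (best (pred (HPP.d x)) (HPP.i₁ x))) js (suc-injective (trans e (sym d≡)))
    where
    d≡ : suc (pred (HPP.d x)) ≡ HPP.d x
    d≡ with HPP.d x | proj₁ (HPP.d-range x)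
    ... | suc _ | _ = refl
    best : ∀ D i → Σ (List (Fin (m-col x))) λ js → length js ≡ D ×
           (∀ js' → length js' ≡ D → weightFrom x i js' ≤ weightFrom x i js)
    best zero    i = [] , refl , λ { [] _ → z≤n }
    best (suc D) i with argmax (λ j → HPP.A x i j + weightFrom x j (proj₁ (best D j)))
    ... | j , h = j ∷ proj₁ (best D j) , cong suc (proj₁ (proj₂ (best D j))) , λ where
      (j' ∷ js') e → ≤-trans (+-monoʳ-≤ (HPP.A x i j') (proj₂ (proj₂ (best D j')) js' (suc-injective e))) (h j')
    y : Solution x
    y = proj₁ (best (pred (HPP.d x)) (HPP.i₁ x)) ,
        trans (cong suc (proj₁ (proj₂ (best (pred (HPP.d x)) (HPP.i₁ x))))) d≡

concatMap-lookup : {A B : Set} (f : A → List B) (xs : List A) →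
  concatMap (λ i → f (lookup xs i)) (allFin (length xs)) ≡ concatMap f xs
concatMap-lookup f xs = begin
  concatMap (f ∘ lookup xs) (allFin (length xs))          ≡⟨ concatMap-map f (lookup xs) (allFin (length xs)) ⟨
  concatMap f (map (lookup xs) (allFin (length xs)))      ≡⟨ cong (concatMap f) (map-tabulate (λ i → i) (lookup xs)) ⟩
  concatMap f (tabulate (lookup xs))                      ≡⟨ cong (concatMap f) (tabulate-lookup xs) ⟩
  concatMap f xs                                          ∎
  where open ≡-Reasoning

length-concatMap : {A B : Set} (f : A → List B) {c : ℕ} → (∀ x → length (f x) ≡ c) → ∀ xs →
  length (concatMap f xs) ≡ length xs * c
length-concatMap f h []       = refl
length-concatMap f h (x ∷ xs) = trans (length-++ (f x)) (cong₂ _+_ (h x) (length-concatMap f h xs))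

truth : (ℕ → Bool) → Literal → Bool
truth σ (v , b) = not (σ v xor b)

litTest-truth : ∀ σ x l l' → litTest x l l' ≡ true → truth σ l' ≡ truth σ l xor x
litTest-truth σ x (v , b) (v' , b') e with v ≟ v'
litTest-truth σ true  (v , true)  (v , false) e | yes refl with σ v
... | true  = refl
... | false = refl
litTest-truth σ true  (v , false) (v , true)  e | yes refl with σ v
... | true  = refl
... | false = refl
litTest-truth σ false (v , true)  (v , true)  e | yes refl with σ v
... | true  = refl
... | false = refl
litTest-truth σ false (v , false) (v , false) e | yes refl with σ v
... | true  = refl
... | false = refl
litTest-truth σ true  (v , true)  (v' , false) () | no _
litTest-truth σ true  (v , false) (v' , true)  () | no _
litTest-truth σ false (v , true)  (v' , true)  () | no _
litTest-truth σ false (v , false) (v' , false) () | no _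

truth-sat : ∀ σ l → σ (proj₁ l) ≡ proj₂ l → truth σ l ≡ true
truth-sat σ (v , b) refl with σ v
... | true  = refl
... | false = refl

module Instance (φ : CNF) (short : ShortClauses φ) where
  open Reduction φ

  length-vertices : length vertices ≡ nOf N
  length-vertices = cong (6 +_) (trans
    (length-concatMap vᵢ (λ i → length-concatMap (vₛ i) (λ s → length-concatMap (vₖ i s) (λ k →
      length-concatMap (vₜ i s k) (λ t → length-concatMap (vₚ i s k t) (λ p → refl) bits) bits) (allFin N)) bits) (allFin N))
    (trans (cong (λ m → m * (2 * (m * (2 * (2 * 1))))) (length-tabulate (λ (i : Fin N) → i))) (lem N)))
    where
    lem : ∀ m → m * (2 * (m * (2 * (2 * 1)))) ≡ m * (m * 8)
    lem = solve-∀

  wt-range : ∀ u v → 1 ≤ wt u v × wt u v ≤ 6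
  wt-range source idle = ok , ok
  wt-range source (blk x y false) with litTest true (lit x) (lit (partner y))
  ... | true  = ok , ok
  ... | false = ok , ok
  wt-range source (blk x y true) = ok , ok
  wt-range source source = ok , ok
  wt-range source sink = ok , ok
  wt-range idle source = ok , ok
  wt-range idle idle = ok , ok
  wt-range idle sink = ok , ok
  wt-range idle (blk x y p) = ok , ok
  wt-range sink source = ok , ok
  wt-range sink idle = ok , ok
  wt-range sink sink = ok , ok
  wt-range sink (blk x y p) = ok , ok
  wt-range (blk x y false) source = ok , ok
  wt-range (blk x y false) idle = ok , ok
  wt-range (blk x y false) sink = ok , ok
  wt-range (blk x y true) source = ok , ok
  wt-range (blk x y true) idle = ok , ok
  wt-range (blk x y true) sink with litTest false (lit y) (lit x)
  ... | true  = ok , ok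
  ... | false = ok , ok
  wt-range (blk x y p) (blk x' y' p') = go p p'
    where
    phase : ∀ p p' b → 1 ≤ phaseWt p p' b × phaseWt p p' b ≤ 6
    phase false false b = ok , ok
    phase false true true = ok , ok
    phase false true false = ok , ok
    phase true false b = ok , ok
    phase true true b = ok , ok
    nested : ∀ a b m → 1 ≤ m × m ≤ 6 → 1 ≤ (if a then (if b then m else 1) else 1) × (if a then (if b then m else 1) else 1) ≤ 6
    nested true  true  m h = h
    nested true  false m h = ok , ok
    nested false b     m h = ok , ok
    go : ∀ p p' → 1 ≤ wt (blk x y p) (blk x' y' p') × wt (blk x y p) (blk x' y' p') ≤ 6
    go false p' = nested (sameOcc x x') (litTest true (lit y) (lit (partner y'))) _ (phase false p' _)
    go true  p' = nested (sameOcc x x') (litTest true (lit y) (lit (partner y'))) _ (phase true p' _)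

  d≤n : dOf N ≤ length vertices
  d≤n = ≤-trans (bound N) (≤-reflexive (sym length-vertices))
    where
    bound : ∀ m → 2 + m * 4 ≤ 6 + m * (m * 8)
    bound zero    = s≤s (s≤s z≤n)
    bound (suc m) = +-mono-≤ {2} {6} {suc m * 4} {suc m * (suc m * 8)} (s≤s (s≤s z≤n))
      (*-monoʳ-≤ (suc m) (≤-trans (m≤m+n 4 4) (m≤m+n 8 (m * 8))))

  hpp : HPP
  hpp = record
    { n' = length rest
    ; A = λ i j → wt (lookup vertices i) (lookup vertices j)
    ; A-range = λ i j → proj₁ (wt-range (lookup vertices i) (lookup vertices j)) ,
        ≤-trans (proj₂ (wt-range (lookup vertices i) (lookup vertices j))) (s≤s (s≤s (s≤s (s≤s (s≤s (s≤s z≤n))))))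
    ; d = dOf N
    ; d-range = s≤s z≤n , d≤n
    ; i₁ = zero
    }

  encInput-hpp : encInput hpp (kOf N) ≡
    encNum (nOf N) ++ encNum (dOf N) ++ encNum 1 ++
    concatMap (λ u → concatMap (λ v → encNum (wt u v)) vertices) vertices ++ encNum (kOf N)
  encInput-hpp = begin
    (encNum (length vertices) ++ encNum (dOf N) ++ encNum 1 ++ rows) ++ encNum (kOf N)
      ≡⟨ ++-assoc (encNum (length vertices)) _ _ ⟩
    encNum (length vertices) ++ (encNum (dOf N) ++ encNum 1 ++ rows) ++ encNum (kOf N)
      ≡⟨ cong (encNum (length vertices) ++_) (++-assoc (encNum (dOf N)) _ _) ⟩
    encNum (length vertices) ++ encNum (dOf N) ++ (encNum 1 ++ rows) ++ encNum (kOf N)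
      ≡⟨ cong (λ z → encNum (length vertices) ++ encNum (dOf N) ++ z) (++-assoc (encNum 1) rows (encNum (kOf N))) ⟩
    encNum (length vertices) ++ encNum (dOf N) ++ encNum 1 ++ rows ++ encNum (kOf N)
      ≡⟨ cong₂ (λ m z → encNum m ++ encNum (dOf N) ++ encNum 1 ++ z ++ encNum (kOf N)) length-vertices rows≡ ⟩
    _ ∎
    where
    open ≡-Reasoning
    rows = concatMap (λ i → encRow (HPP.A hpp i)) (allFin (length vertices))
    rows≡ : rows ≡ concatMap (λ u → concatMap (λ v → encNum (wt u v)) vertices) vertices
    rows≡ = trans (concatMap-cong (λ i → concatMap-lookup (λ v → encNum (wt (lookup vertices i) v)) vertices) (allFin (length vertices)))
                  (concatMap-lookup (λ u → concatMap (λ v → encNum (wt u v)) vertices) vertices)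

  walkWt : Vtx → List Vtx → ℕ
  walkWt u []       = 0
  walkWt u (v ∷ vs) = wt u v + walkWt v vs

  weightFrom-walk : ∀ i js → weightFrom hpp i js ≡ walkWt (lookup vertices i) (map (lookup vertices) js)
  weightFrom-walk i []       = refl
  weightFrom-walk i (j ∷ js) = cong (HPP.A hpp i j +_) (weightFrom-walk j js)

  vertex-∈ : ∀ v → v ∈ vertices
  vertex-∈ source = here refl
  vertex-∈ idle   = there (here refl)
  vertex-∈ sink   = there (there (here refl))
  vertex-∈ (blk (i , s) (j , t) p) = there (there (there (there (there (there
    (∈-concatMap⁺ vᵢ (lose (∈-allFin i) (∈-concatMap⁺ (vₛ i) (lose (bit s) (∈-concatMap⁺ (vₖ i s) (lose (∈-allFin j)
      (∈-concatMap⁺ (vₜ i s j) (lose (bit t) (∈-concatMap⁺ (vₚ i s j t) (lose (bit p) (here refl))))))))))))))))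
    where
    bit : ∀ b → b ∈ bits
    bit false = here refl
    bit true  = there (here refl)

  indices : List Vtx → List (Fin (length vertices))
  indices = map (λ v → index (vertex-∈ v))

  indices-walk : ∀ vs → map (lookup vertices) (indices vs) ≡ vs
  indices-walk []       = refl
  indices-walk (v ∷ vs) = cong₂ _∷_ (sym (lookup-index (vertex-∈ v))) (indices-walk vs)

  -- The D of the construction: two paths of at most 2N implications each, and the closing edge.
  steps : ℕ
  steps = 1 + N * 4

  toSolution : ∀ vs → length vs ≡ steps → Σ (Solution hpp) λ y → weight hpp y ≡ walkWt source vs
  toSolution vs e = (indices vs , cong suc (trans (length-map _ vs) e)) ,
    trans (weightFrom-walk zero (indices vs)) (cong (walkWt source) (indices-walk vs))

  module Potential (pot : Vtx → ℕ) (edge : ∀ u v → wt u v + pot v ≤ 4 + pot u) where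
    -- Telescoping: an edge weighs at most 4 plus the drop of the potential along it, and the
    -- potential at the end is not negative.
    walk-≤ : ∀ u vs → walkWt u vs ≤ length vs * 4 + pot u
    walk-≤ u []       = z≤n
    walk-≤ u (v ∷ vs) = begin
      wt u v + walkWt v vs                  ≤⟨ +-monoʳ-≤ (wt u v) (walk-≤ v vs) ⟩
      wt u v + (length vs * 4 + pot v)      ≡⟨ swap (wt u v) (length vs * 4) (pot v) ⟩
      (wt u v + pot v) + length vs * 4      ≤⟨ +-monoˡ-≤ (length vs * 4) (edge u v) ⟩
      (4 + pot u) + length vs * 4           ≡⟨ swap' (pot u) (length vs * 4) ⟩
      4 + length vs * 4 + pot u             ∎
      where
      open ≤-Reasoning
      swap : ∀ a b c → a + (b + c) ≡ (a + c) + b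
      swap = solve-∀
      swap' : ∀ a b → (4 + a) + b ≡ 4 + b + a
      swap' = solve-∀

  -- This potential serves walks from `idle`, whatever φ is. The surplus 2 of a closing edge is
  -- charged to the blocks; a walk from `idle` or `sink` into a block enters at weight 1 and so pays
  -- for it in advance.
  pot₀ : Vtx → ℕ
  pot₀ source      = 2
  pot₀ idle        = 0
  pot₀ sink        = 0
  pot₀ (blk _ _ _) = 2

  blkWt-≤ : ∀ a b {m} → m ≤ 4 → (if a then (if b then m else 1) else 1) ≤ 4
  blkWt-≤ true  true  h = h
  blkWt-≤ true  false h = s≤s z≤n
  blkWt-≤ false b     h = s≤s z≤n

  phase-≤ : ∀ p p' b → phaseWt p p' b ≤ 4
  phase-≤ false false b     = ≤-refl
  phase-≤ false true  true  = ≤-refl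
  phase-≤ false true  false = s≤s z≤n
  phase-≤ true  false b     = s≤s z≤n
  phase-≤ true  true  b     = ≤-refl

  edge₀ : ∀ u v → wt u v + pot₀ v ≤ 4 + pot₀ u
  edge₀ source source = ok
  edge₀ source idle = ok
  edge₀ source sink = ok
  edge₀ source (blk x y false) with litTest true (lit x) (lit (partner y))
  ... | true  = ok
  ... | false = ok
  edge₀ source (blk x y true) = ok
  edge₀ idle source = ok
  edge₀ idle idle = ok
  edge₀ idle sink = ok
  edge₀ idle (blk x y p) = ok
  edge₀ sink source = ok
  edge₀ sink idle = ok
  edge₀ sink sink = ok
  edge₀ sink (blk x y p) = ok
  edge₀ (blk x y false) source = ok
  edge₀ (blk x y false) idle = ok
  edge₀ (blk x y false) sink = ok
  edge₀ (blk x y true) source = ok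
  edge₀ (blk x y true) idle = ok
  edge₀ (blk x y true) sink with litTest false (lit y) (lit x)
  ... | true  = ok
  ... | false = ok
  edge₀ (blk x y false) (blk x' y' p') = +-monoˡ-≤ 2 (blkWt-≤ (sameOcc x x') (litTest true (lit y) (lit (partner y'))) (phase-≤ false p' _))
  edge₀ (blk x y true)  (blk x' y' p') = +-monoˡ-≤ 2 (blkWt-≤ (sameOcc x x') (litTest true (lit y) (lit (partner y'))) (phase-≤ true p' _))

  idle-walk : ∀ m → walkWt idle (replicate m idle) ≡ m * 4
  idle-walk zero    = refl
  idle-walk (suc m) = cong (4 +_) (idle-walk m)

  walk-from-idle : ∀ vs → walkWt idle vs ≤ length vs * 4
  walk-from-idle vs = ≤-trans (Potential.walk-≤ pot₀ edge₀ idle vs) (≤-reflexive (+-identityʳ _))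

  sameOcc-true : ∀ x x' → sameOcc x x' ≡ true → x ≡ x'
  sameOcc-true (i , s) (i' , s') e with i F.≟ i'
  sameOcc-true (i , true)  (i , true)  e | yes refl = refl
  sameOcc-true (i , false) (i , false) e | yes refl = refl
  sameOcc-true (i , true)  (i' , true)  () | no _
  sameOcc-true (i , false) (i' , false) () | no _

  sameOcc-refl : ∀ x → sameOcc x x ≡ true
  sameOcc-refl (i , s) with i F.≟ i
  ... | no ne = contradiction refl ne
  sameOcc-refl (i , true)  | yes _ = refl
  sameOcc-refl (i , false) | yes _ = refl

  module Sat (σ : ℕ → Bool) (sat : All (Any (λ l → σ (proj₁ l) ≡ proj₂ l)) φ) where

    tr : Occ → Bool
    tr x = truth σ (lit x)

    clause-true : ∀ i → tr (i , false) ≡ true ⊎ tr (i , true) ≡ true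
    clause-true i = go (lookup φ i) (All.lookup short (∈-lookup i)) (All.lookup sat (∈-lookup i))
      where
      go : ∀ C → (1 ≤ length C) × (length C ≤ 2) → Any (λ l → σ (proj₁ l) ≡ proj₂ l) C →
           truth σ (litOf C false) ≡ true ⊎ truth σ (litOf C true) ≡ true
      go (l ∷ [])      _ (here e)         = inj₁ (truth-sat σ l e)
      go (l ∷ l' ∷ []) _ (here e)         = inj₁ (truth-sat σ l e)
      go (l ∷ l' ∷ []) _ (there (here e)) = inj₂ (truth-sat σ l' e)
      go (_ ∷ _ ∷ _ ∷ _) (_ , s≤s (s≤s ())) _

    partner-true : ∀ y → tr (partner y) ≡ false → tr y ≡ true
    partner-true (i , s) e with clause-true i
    partner-true (i , false) e | inj₁ h = h
    partner-true (i , false) e | inj₂ h = contradiction (trans (sym e) h) λ ()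
    partner-true (i , true)  e | inj₁ h = contradiction (trans (sym e) h) λ ()
    partner-true (i , true)  e | inj₂ h = h

    -- The clause of `z` holds under σ, so when its other literal is false, truth moves on to `z`.
    implied : ∀ l z → litTest true l (lit (partner z)) ≡ true → truth σ l ≡ true → tr z ≡ true
    implied l z e h = partner-true z (trans (litTest-truth σ true l _ e) (cong (_xor true) h))

    -- A block vertex is worth 0 if σ respects the walk that it claims.
    excess : Bool → Bool → Bool → ℕ
    excess a b false = if a ∧ not b then 2 else 0
    excess a b true  = if a ∨ not b then 2 else 0

    pot : Vtx → ℕ
    pot source      = 0
    pot idle        = 0
    pot sink        = 0
    pot (blk x y p) = excess (tr x) (tr y) p

    excess-≤ : ∀ a b p → excess a b p ≤ 2
    excess-≤ true  true  true  = ≤-refl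
    excess-≤ true  false true  = ≤-refl
    excess-≤ false true  true  = z≤n
    excess-≤ false false true  = ≤-refl
    excess-≤ true  true  false = z≤n
    excess-≤ true  false false = ≤-refl
    excess-≤ false true  false = z≤n
    excess-≤ false false false = z≤n

    pot-≤ : ∀ v → pot v ≤ 2
    pot-≤ source      = z≤n
    pot-≤ idle        = z≤n
    pot-≤ sink        = z≤n
    pot-≤ (blk x y p) = excess-≤ (tr x) (tr y) p

    -- An edge of weight 1 falls 3 short of the norm, more than a potential of at most 2 can make
    -- up.
    light : ∀ u v → 1 + pot v ≤ 4 + pot u
    light u v = ≤-trans (s≤s (pot-≤ v)) (≤-trans (ok {3} {4}) (m≤m+n 4 (pot u)))

    -- At weight 3 the entrance leads to potential 0, since σ respects its implication; all other
    -- edges considered here weigh 1. This one missing unit separates the satisfiable case from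
    -- idling.
    first-edge : ∀ v → v ≢ idle → wt source v + pot v ≤ 3
    first-edge source ne = ok
    first-edge idle   ne = contradiction refl ne
    first-edge sink   ne = ok
    first-edge (blk x y true) ne = s≤s (excess-≤ (tr x) (tr y) true)
    first-edge (blk x y false) ne with litTest true (lit x) (lit (partner y)) in e
    ... | false = s≤s (excess-≤ (tr x) (tr y) false)
    ... | true with tr x in ex
    ...   | false = ≤-refl
    ...   | true rewrite implied (lit x) y e ex = ≤-refl

    -- `a`, `b`, `b'` are the truth values of `x`, `y`, `y'`. Within a phase, passing from `b` to an
    -- implied `b'` cannot raise the potential. At a switch `y` is the complement of `x`: if `x` is
    -- true, `y` is false and the potential is already 2; if `x` is false, `y` and hence `y'` are
    -- true and it stays 0.
    phase-edge : ∀ p p' a b b' t → (b ≡ true → b' ≡ true) → (t ≡ true → a ≡ b xor true) →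
                 phaseWt p p' t + excess a b' p' ≤ 4 + excess a b p
    phase-edge false false true  true  b' t h g rewrite h refl = ≤-refl
    phase-edge false false true  false b' t h g = +-monoʳ-≤ 4 (excess-≤ true b' false)
    phase-edge false false false b     b' t h g = ok
    phase-edge false true  a b b' false h g = ≤-trans (s≤s (excess-≤ a b' true)) (≤-trans (ok {3} {4}) (m≤m+n 4 _))
    phase-edge false true  true  true  b' true h g = contradiction (g refl) λ ()
    phase-edge false true  true  false b' true h g = ≤-refl
    phase-edge false true  false true  b' true h g rewrite h refl = ≤-refl
    phase-edge false true  false false b' true h g = contradiction (g refl) λ ()
    phase-edge true  false a b b' t h g = ≤-trans (s≤s (excess-≤ a b' false)) (≤-trans (ok {3} {4}) (m≤m+n 4 _))
    phase-edge true  true  true  b     b' t h g = ≤-refl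
    phase-edge true  true  false true  b' t h g rewrite h refl = ≤-refl
    phase-edge true  true  false false b' t h g = +-monoʳ-≤ 4 (excess-≤ false b' true)

    blk-edge : ∀ x y p x' y' p' →
      (if sameOcc x x' then (if litTest true (lit y) (lit (partner y')) then phaseWt p p' (litTest true (lit y) (lit x)) else 1) else 1)
      + pot (blk x' y' p') ≤ 4 + pot (blk x y p)
    blk-edge x y p x' y' p' with sameOcc x x' in e
    ... | false = light (blk x y p) (blk x' y' p')
    ... | true with litTest true (lit y) (lit (partner y')) in e'
    ...   | false = light (blk x y p) (blk x' y' p')
    ...   | true rewrite sym (sameOcc-true x x' e) =
      phase-edge p p' (tr x) (tr y) (tr y') (litTest true (lit y) (lit x)) (implied (lit y) y' e')
        (litTest-truth σ true (lit y) (lit x))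

    edge : ∀ u v → wt u v + pot v ≤ 4 + pot u
    edge source source = ok
    edge source idle = ok
    edge source sink = ok
    edge source (blk x y p) = ≤-trans (first-edge (blk x y p) λ ()) (ok)
    edge idle source = ok
    edge idle idle = ok
    edge idle sink = ok
    edge idle (blk x y p) = light idle (blk x y p)
    edge sink source = ok
    edge sink idle = ok
    edge sink sink = ok
    edge sink (blk x y p) = light sink (blk x y p)
    edge (blk x y false) source = light (blk x y false) source
    edge (blk x y false) idle = light (blk x y false) idle
    edge (blk x y false) sink = light (blk x y false) sink
    edge (blk x y true) source = light (blk x y true) source
    edge (blk x y true) idle = light (blk x y true) idle
    edge (blk x y true) sink with litTest false (lit y) (lit x) in e
    ... | false = light (blk x y true) sink
    -- The literals of `x` and `y` coincide, so the block has potential 2 whatever their truth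
    -- value; this pays for the surplus of the weight 6.
    ... | true with tr x | tr y | litTest-truth σ false (lit y) (lit x) e
    ...   | true  | true  | _ = ≤-refl
    ...   | false | false | _ = ≤-refl
    edge (blk x y false) (blk x' y' p') = blk-edge x y false x' y' p'
    edge (blk x y true)  (blk x' y' p') = blk-edge x y true x' y' p'

    walk-sat : ∀ v vs → v ≢ idle → walkWt source (v ∷ vs) ≤ 3 + length vs * 4
    walk-sat v vs ne = begin
      wt source v + walkWt v vs              ≤⟨ +-monoʳ-≤ (wt source v) (Potential.walk-≤ pot edge v vs) ⟩
      wt source v + (length vs * 4 + pot v)  ≡⟨ swap (wt source v) (length vs * 4) (pot v) ⟩
      (wt source v + pot v) + length vs * 4  ≤⟨ +-monoˡ-≤ (length vs * 4) (first-edge v ne) ⟩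
      3 + length vs * 4                      ∎
      where
      open ≤-Reasoning
      swap : ∀ a b c → a + (b + c) ≡ (a + c) + b
      swap = solve-∀

-- Paths in the implication graph and satisfying assignments

walk-length : ∀ a b m → 1 + (a + (1 + (b + (1 + m)))) ≡ 1 + (1 + a + (1 + b) + m)
walk-length = solve-∀

walk-weight : ∀ a b m → 3 + (a * 4 + (4 + (b * 4 + (6 + m * 4)))) ≡ 1 + (1 + (1 + a + (1 + b) + m)) * 4
walk-weight = solve-∀

neg : Literal → Literal
neg (v , b) = v , not b

neg-neg : ∀ a → neg (neg a) ≡ a
neg-neg (v , true)  = refl
neg-neg (v , false) = refl

neg≢ : ∀ a → neg a ≢ a
neg≢ (v , true)  ()
neg≢ (v , false) ()

litTest-neg : ∀ a → litTest true a (neg a) ≡ true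
litTest-neg (v , true)  = ≟-true refl
litTest-neg (v , false) = ≟-true refl

litTest-refl : ∀ a → litTest false a a ≡ true
litTest-refl (v , true)  = ≟-true refl
litTest-refl (v , false) = ≟-true refl

litTest→neg : ∀ a b → litTest true a b ≡ true → b ≡ neg a
litTest→neg (v , b) (v' , b') e with v ≟ v'
litTest→neg (v , true)  (v , false)  e | yes refl = refl
litTest→neg (v , false) (v , true)   e | yes refl = refl
litTest→neg (v , true)  (v' , true)  () | no _
litTest→neg (v , true)  (v' , false) () | no _
litTest→neg (v , false) (v' , true)  () | no _
litTest→neg (v , false) (v' , false) () | no _

_≟ˡ_ : (a b : Literal) → Dec (a ≡ b)
_≟ˡ_ = ≡-dec _≟_ BP._≟_

module Implications (φ : CNF) where
  open Reduction φ

  -- Path a zs b: b follows from a by clauses whose second occurrences are zs.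
  data Path : Literal → List Occ → Literal → Set where
    []  : ∀ {a} → Path a [] a
    _∷_ : ∀ {a z zs b} → litTest true a (lit (partner z)) ≡ true → Path (lit z) zs b → Path a (z ∷ zs) b

  path-[] : ∀ {a b} → Path a [] b → b ≡ a
  path-[] [] = refl

  Reach : Literal → Literal → Set
  Reach a b = Σ (List Occ) λ zs → Path a zs b

  path-++ : ∀ {a b c zs ws} → Path a zs b → Path b ws c → Path a (zs ++ ws) c
  path-++ []      q = q
  path-++ (e ∷ p) q = e ∷ path-++ p q

  reach-trans : ∀ {a b c} → Reach a b → Reach b c → Reach a c
  reach-trans (_ , p) (_ , q) = _ , path-++ p q

  partner-partner : ∀ z → partner (partner z) ≡ z
  partner-partner (i , true)  = refl
  partner-partner (i , false) = refl

  -- Contraposition: each clause is an implication in two directions, and `partner` exchanges them.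
  skew : ∀ {a b zs} → Path a zs b → Reach (neg b) (neg a)
  skew [] = [] , []
  skew {a} (_∷_ {z = z} e p) = reach-trans (skew p)
    (subst (Reach (neg (lit z))) (litTest→neg a _ e) (partner z ∷ [] ,
      subst (λ l → litTest true (neg (lit z)) (lit l) ≡ true) (sym (partner-partner z))
        (subst (λ l → litTest true (neg (lit z)) l ≡ true) (neg-neg (lit z)) (litTest-neg (neg (lit z)))) ∷ []))

  path-take : ∀ {a zs b} → Path a zs b → ∀ i → Path a (take (suc (toℕ i)) zs) (lit (lookup zs i))
  path-take (e ∷ p) zero    = e ∷ []
  path-take (e ∷ p) (suc i) = e ∷ path-take p i

  path-drop : ∀ {a zs b} → Path a zs b → ∀ i → Path (lit (lookup zs i)) (drop (suc (toℕ i)) zs) b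
  path-drop (e ∷ p) zero    = p
  path-drop (e ∷ p) (suc i) = path-drop p i

  occIndex : Occ → Fin (N * 2)
  occIndex (i , s) = F.combine i (side s)
    where
    side : Bool → Fin 2
    side true  = zero
    side false = suc zero

  occIndex-injective : ∀ x y → occIndex x ≡ occIndex y → x ≡ y
  occIndex-injective (i , s) (j , t) e with FP.combine-injective i _ j _ e
  occIndex-injective (i , true)  (i , true)  e | refl , _ = refl
  occIndex-injective (i , false) (i , false) e | refl , _ = refl
  occIndex-injective (i , true)  (i , false) e | refl , ()
  occIndex-injective (i , false) (i , true)  e | refl , ()

  -- There are 2N occurrences, so a longer path visits one of them twice, and the detour between the
  -- two visits can be cut out.
  shorten : ∀ {a b} zs → Acc _<_ (length zs) → Path a zs b → Σ (List Occ) λ ws → length ws ≤ N * 2 × Path a ws b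
  shorten {a} {b} zs (acc rs) p with N * 2 <? length zs
  ... | no  le = zs , ≮⇒≥ le , p
  ... | yes lt with FP.pigeonhole lt (occIndex ∘ lookup zs)
  ...   | i , j , i<j , e = shorten ws (rs shorter) (path-++ (path-take p i)
            (subst (λ z → Path (lit z) (drop (suc (toℕ j)) zs) b) (sym (occIndex-injective _ _ e)) (path-drop p j)))
    where
    ws = take (suc (toℕ i)) zs ++ drop (suc (toℕ j)) zs
    shorter : length ws < length zs
    shorter = begin-strict
      length ws                                            ≡⟨ length-++ (take (suc (toℕ i)) zs) ⟩
      length (take (suc (toℕ i)) zs) + length (drop (suc (toℕ j)) zs)
        ≡⟨ cong₂ _+_ (length-take (suc (toℕ i)) zs) (length-drop (suc (toℕ j)) zs) ⟩
      (suc (toℕ i) ⊓ length zs) + (length zs ∸ suc (toℕ j))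
        ≤⟨ +-monoˡ-≤ _ (m⊓n≤m (suc (toℕ i)) (length zs)) ⟩
      suc (toℕ i) + (length zs ∸ suc (toℕ j))              <⟨ +-monoˡ-< _ (s≤s i<j) ⟩
      suc (toℕ j) + (length zs ∸ suc (toℕ j))              ≡⟨ m+[n∸m]≡n (FP.toℕ<n j) ⟩
      length zs                                            ∎
      where open ≤-Reasoning

  short-path : ∀ {a b} → Reach a b → Σ (List Occ) λ ws → length ws ≤ N * 2 × Path a ws b
  short-path (zs , p) = shorten zs (<-wellFounded _) p

  Via : ℕ → Literal → Literal → Occ → Set
  Via n a b z = litTest true a (lit (partner z)) ≡ true × Σ (List Occ) λ zs → length zs ≤ n × Path (lit z) zs b

  within : ∀ n a b → Dec (Σ (List Occ) λ zs → length zs ≤ n × Path a zs b)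
  via : ∀ n a b z → Dec (Via n a b z)
  via n a b z with litTest true a (lit (partner z)) BP.≟ true | within n (lit z) b
  ... | no ne | _     = no (ne ∘ proj₁)
  ... | yes e | yes h = yes (e , h)
  ... | yes e | no nh = no (nh ∘ proj₂)
  within zero a b with a ≟ˡ b
  ... | yes refl = yes ([] , z≤n , [])
  ... | no  ne   = no λ { ([] , _ , []) → ne refl }
  within (suc n) a b with a ≟ˡ b
  ... | yes refl = yes ([] , z≤n , [])
  ... | no  ne with FP.any? (λ i → via n a b (i , false) ⊎-dec via n a b (i , true))
  ...   | yes (i , inj₁ (e , zs , le , p)) = yes ((i , false) ∷ zs , s≤s le , e ∷ p)
  ...   | yes (i , inj₂ (e , zs , le , p)) = yes ((i , true) ∷ zs , s≤s le , e ∷ p)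
  ...   | no nh = no λ where
    ([] , _ , []) → ne refl
    ((i , false) ∷ zs , s≤s le , e ∷ p) → nh (i , inj₁ (e , zs , le , p))
    ((i , true)  ∷ zs , s≤s le , e ∷ p) → nh (i , inj₂ (e , zs , le , p))

  -- Searching up to the length bound of `short-path` is exhaustive. Decidability is what makes the
  -- assignment below a Boolean function.
  reach? : ∀ a b → Dec (Reach a b)
  reach? a b = map′ (λ { (zs , _ , p) → zs , p }) short-path (within (N * 2) a b)

  module Assignment (consistent : ∀ x → Reach (lit x) (neg (lit x)) → Reach (neg (lit x)) (lit x) → ⊥) where

    last-occ : ∀ z {b zs} → Path (lit z) zs b → Σ Occ λ y → lit y ≡ b
    last-occ z []                  = z , refl
    last-occ z (_∷_ {z = y} e p) = last-occ y p

    occurs : ∀ {a b zs} → Path a zs b → a ≢ b → Σ Occ λ z → lit z ≡ b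
    occurs []                  ne = contradiction refl ne
    occurs (_∷_ {z = z} e p) ne = last-occ z p

    -- `consistent` is about occurring literals only, but `a` ends a nonempty path, the one from
    -- `neg a`, and therefore occurs.
    no-cycle : ∀ a → Reach a (neg a) → Reach (neg a) a → ⊥
    no-cycle a r r' with occurs (proj₂ r') (neg≢ a)
    ... | z , refl = consistent z r r'

    -- The literals forced to be true by the choices `rs` made so far.
    Closure : List Literal → Literal → Set
    Closure rs u = Any (λ r → Reach r u) rs

    Coherent : List Literal → Set
    Coherent rs = ∀ u → Closure rs u → Closure rs (neg u) → ⊥

    closure-trans : ∀ {rs u v} → Closure rs u → Reach u v → Closure rs v
    closure-trans c r = Any.map (λ r' → reach-trans r' r) c

    back : ∀ {b u} → Reach b (neg u) → Reach u (neg b)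
    back {b} {u} (_ , p) = subst (λ z → Reach z (neg b)) (neg-neg u) (skew p)

    -- If both `u` and `neg u` were forced, contraposing one of the two paths from `b` would give a
    -- path to `neg b`, either from `b` itself or from an earlier choice.
    add : ∀ {rs} b → Coherent rs → ¬ Reach b (neg b) → ¬ Closure rs (neg b) → Coherent (b ∷ rs)
    add b co nr nc u (here r)  (here r')  = nr (reach-trans r (back r'))
    add b co nr nc u (there c) (here r')  = nc (closure-trans c (back r'))
    add b co nr nc u (here r)  (there c') = nc (closure-trans c' (proj₁ (skew' r) , proj₂ (skew' r)))
      where
      skew' : Reach b u → Reach (neg u) (neg b)
      skew' (_ , p) = skew p
    add b co nr nc u (there c) (there c') = co u c c'

    Decides : List Literal → Literal → Set
    Decides rs a = Closure rs a ⊎ Closure rs (neg a)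

    closure? : ∀ rs u → Dec (Closure rs u)
    closure? rs u = Any.any? (λ r → reach? r u) rs

    -- A literal not yet decided is chosen to be true unless it implies its complement. In that case
    -- the complement is chosen, and `no-cycle` keeps the complement from implying the literal in
    -- turn.
    extend : ∀ rs → Coherent rs → ∀ a →
             Σ (List Literal) λ rs' → Coherent rs' × Decides rs' a × (∀ {u} → Closure rs u → Closure rs' u)
    extend rs co a with closure? rs a | closure? rs (neg a)
    ... | yes c | _     = rs , co , inj₁ c , λ c → c
    ... | no _  | yes c = rs , co , inj₂ c , λ c → c
    ... | no nc | no nc' with reach? a (neg a)
    ...   | no  nr = a ∷ rs , add a co nr nc' , inj₁ (here ([] , [])) , there
    ...   | yes r  = neg a ∷ rs , add (neg a) co
              (λ r' → no-cycle a r (subst (Reach (neg a)) (neg-neg a) r'))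
              (λ c → nc (subst (Closure rs) (neg-neg a) c)) , inj₂ (here ([] , [])) , there

    decideAll : ∀ ls → Σ (List Literal) λ rs → Coherent rs × (∀ {l} → l ∈ ls → Decides rs l)
    decideAll [] = [] , (λ _ ()) , λ ()
    decideAll (l ∷ ls) with decideAll ls
    ... | rs , co , h with extend rs co l
    ...   | rs' , co' , d , mono = rs' , co' , λ { (here refl) → d ; (there m) → lift (h m) }
      where
      lift : ∀ {l} → Decides rs l → Decides rs' l
      lift (inj₁ c) = inj₁ (mono c)
      lift (inj₂ c) = inj₂ (mono c)

    satisfiable : ShortClauses φ → Satisfiable φ
    satisfiable short = σ , All.tabulate (λ {C} m → subst (Any holds) (sym (lookup-index m)) (clause (index m)))
      where
      literals : List Literal
      -- Deciding the first literal of each clause is enough: if it is false, the clause itself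
      -- forces the second.
      literals = map (λ i → lit (i , false)) (allFin N)
      chosen = decideAll literals
      rs = proj₁ chosen
      σ : ℕ → Bool
      -- A variable on which nothing is forced becomes false.
      σ v = does (closure? rs (v , true))
      holds : Literal → Set
      holds l = σ (proj₁ l) ≡ proj₂ l
      true→ : ∀ l → Closure rs l → holds l
      true→ (v , true) c with closure? rs (v , true)
      ... | yes _ = refl
      ... | no nc = contradiction c nc
      true→ (v , false) c with closure? rs (v , true)
      ... | yes c' = ⊥-elim (proj₁ (proj₂ chosen) (v , true) c' c)
      ... | no _   = refl
      member : ∀ C s → (1 ≤ length C) × (length C ≤ 2) → holds (litOf C s) → Any holds C
      member (l ∷ [])      s     _ h = here h
      member (l ∷ l' ∷ []) false _ h = here h
      member (l ∷ l' ∷ []) true  _ h = there (here h)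
      member (_ ∷ _ ∷ _ ∷ _) s (_ , s≤s (s≤s ())) h
      clause : ∀ i → Any holds (lookup φ i)
      clause i with proj₂ (proj₂ chosen) (∈-map⁺ (λ i → lit (i , false)) (∈-allFin i))
      ... | inj₁ c = member (lookup φ i) false (All.lookup short (∈-lookup i)) (true→ _ c)
      ... | inj₂ c = member (lookup φ i) true (All.lookup short (∈-lookup i)) (true→ _ (closure-trans c
              ((i , true) ∷ [] , subst (λ l → litTest true (neg (lit (i , false))) l ≡ true) (neg-neg _) (litTest-neg (neg (lit (i , false)))) ∷ [])))

  module Walks (short : ShortClauses φ) where
    open Instance φ short

    track : Occ → Bool → List Occ → List Vtx
    track x p = map (λ z → blk x z p)

    same-step : ∀ x y z p → litTest true (lit y) (lit (partner z)) ≡ true → wt (blk x y p) (blk x z p) ≡ 4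
    same-step x y z true  e rewrite sameOcc-refl x | e = refl
    same-step x y z false e rewrite sameOcc-refl x | e = refl

    track-wt : ∀ x p y {b} zs vs → Path (lit y) zs b →
      Σ Occ λ y' → lit y' ≡ b × walkWt (blk x y p) (track x p zs ++ vs) ≡ length zs * 4 + walkWt (blk x y' p) vs
    track-wt x p y [] vs [] = y , refl , refl
    track-wt x p y (z ∷ zs) vs (e ∷ q) with track-wt x p z zs vs q
    ... | y' , l , eq = y' , l , cong₂ _+_ (same-step x y z p e) eq

    switch : ∀ x y z → lit y ≡ neg (lit x) → litTest true (neg (lit x)) (lit (partner z)) ≡ true →
             wt (blk x y false) (blk x z true) ≡ 4
    switch x y z l e rewrite sameOcc-refl x | l | e
      | subst (λ l → litTest true (neg (lit x)) l ≡ true) (neg-neg (lit x)) (litTest-neg (neg (lit x))) = refl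

    sinks : ∀ m → walkWt sink (replicate m sink) ≡ m * 4
    sinks zero    = refl
    sinks (suc m) = cong (4 +_) (sinks m)

    -- Both paths are nonempty because a literal differs from its complement; their first edges
    -- serve as the entrance and as the switch of phase. The balance against 4 per edge is -1 for
    -- the entrance and +2 for the closing edge.
    heavy-walk : ∀ x → Reach (lit x) (neg (lit x)) → Reach (neg (lit x)) (lit x) →
                 Σ (List Vtx) λ vs → length vs ≡ steps × walkWt source vs ≡ 1 + steps * 4
    heavy-walk x r r' with short-path r | short-path r'
    ... | [] , _ , p | _ = contradiction (path-[] p) (neg≢ (lit x))
    ... | _ ∷ _ , _ , _ | [] , _ , p = contradiction (path-[] p) (neg≢ (lit x) ∘ sym)
    ... | z ∷ zs , le , e ∷ p | w ∷ ws , le' , e' ∷ p' = vs , length-vs , weight-vs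
      where
      m = N * 4 ∸ (suc (length zs) + suc (length ws))
      m≡ : suc (length zs) + suc (length ws) + m ≡ N * 4
      m≡ = m+[n∸m]≡n (≤-trans (+-mono-≤ le le') (≤-reflexive (lem N)))
        where
        lem : ∀ n → n * 2 + n * 2 ≡ n * 4
        lem = solve-∀
      tail₂ = sink ∷ replicate m sink
      tail₁ = blk x w true ∷ track x true ws ++ tail₂
      vs = blk x z false ∷ track x false zs ++ tail₁
      length-vs : length vs ≡ steps
      length-vs = begin
        suc (length (track x false zs ++ tail₁))
          ≡⟨ cong suc (trans (length-++ (track x false zs)) (cong₂ _+_ (length-map _ zs)
               (cong suc (trans (length-++ (track x true ws)) (cong₂ _+_ (length-map _ ws) (cong suc (length-replicate m))))))) ⟩
        suc (length zs + suc (length ws + suc m))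
          ≡⟨ walk-length (length zs) (length ws) m ⟩
        suc (suc (length zs) + suc (length ws) + m)
          ≡⟨ cong suc m≡ ⟩
        steps ∎
        where open ≡-Reasoning
      t₁ = track-wt x false z zs tail₁ p
      t₂ = track-wt x true w ws tail₂ p'
      first : wt source (blk x z false) ≡ 3
      first rewrite e = refl
      last : wt (blk x (proj₁ t₂) true) sink ≡ 6
      last rewrite proj₁ (proj₂ t₂) | litTest-refl (lit x) = refl
      weight-vs : walkWt source vs ≡ 1 + steps * 4
      weight-vs = begin
        wt source (blk x z false) + walkWt (blk x z false) (track x false zs ++ tail₁)
          ≡⟨ cong₂ _+_ first (proj₂ (proj₂ t₁)) ⟩
        3 + (length zs * 4 + (wt (blk x (proj₁ t₁) false) (blk x w true) + walkWt (blk x w true) (track x true ws ++ tail₂)))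
          ≡⟨ cong (λ y → 3 + (length zs * 4 + y)) (cong₂ _+_ (switch x (proj₁ t₁) w (proj₁ (proj₂ t₁)) e') (proj₂ (proj₂ t₂))) ⟩
        3 + (length zs * 4 + (4 + (length ws * 4 + (wt (blk x (proj₁ t₂) true) sink + walkWt sink (replicate m sink)))))
          ≡⟨ cong (λ y → 3 + (length zs * 4 + (4 + (length ws * 4 + y)))) (cong₂ _+_ last (sinks m)) ⟩
        3 + (length zs * 4 + (4 + (length ws * 4 + (6 + m * 4))))
          ≡⟨ walk-weight (length zs) (length ws) m ⟩
        1 + (1 + (suc (length zs) + suc (length ws) + m)) * 4
          ≡⟨ cong (λ y → 1 + (1 + y) * 4) m≡ ⟩
        1 + steps * 4 ∎
        where open ≡-Reasoning

-- Counting variables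

count : ℕ → List ℕ → ℕ
count v xs = length (filter (_≟ v) xs)

others : ℕ → List ℕ → List ℕ
others y = filter (λ u → ¬? (u ≟ y))

count-yes : ∀ {v x} xs → x ≡ v → count v (x ∷ xs) ≡ suc (count v xs)
count-yes {v} xs e = cong length (filter-accept (_≟ v) {xs = xs} e)

count-no : ∀ {v x} xs → x ≢ v → count v (x ∷ xs) ≡ count v xs
count-no {v} xs ne = cong length (filter-reject (_≟ v) {xs = xs} ne)

others-yes : ∀ {y x} xs → x ≡ y → others y (x ∷ xs) ≡ others y xs
others-yes {y} xs e = filter-reject (λ u → ¬? (u ≟ y)) {xs = xs} (λ ne → ne e)

others-no : ∀ {y x} xs → x ≢ y → others y (x ∷ xs) ≡ x ∷ others y xs
others-no {y} xs ne = filter-accept (λ u → ¬? (u ≟ y)) {xs = xs} ne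

count-split : ∀ y xs → length xs ≡ count y xs + length (others y xs)
count-split y [] = refl
count-split y (x ∷ xs) with x ≟ y
... | yes e = trans (cong suc (count-split y xs)) (sym (cong₂ _+_ (count-yes xs e) (cong length (others-yes xs e))))
... | no ne = trans (cong suc (count-split y xs)) (trans (sym (+-suc (count y xs) _))
                (sym (cong₂ _+_ (count-no xs ne) (cong length (others-no xs ne)))))

count-others : ∀ v y xs → count v (others y xs) ≤ count v xs
count-others v y [] = z≤n
count-others v y (x ∷ xs) with x ≟ y
... | yes e = ≤-trans (≤-reflexive (cong (count v) (others-yes xs e))) (≤-trans (count-others v y xs) grow)
  where
  grow : count v xs ≤ count v (x ∷ xs)
  grow with x ≟ v
  ... | yes e' = ≤-trans (n≤1+n _) (≤-reflexive (sym (count-yes xs e')))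
  ... | no ne' = ≤-reflexive (sym (count-no xs ne'))
... | no ne with x ≟ v
...   | yes e' = ≤-trans (≤-reflexive (trans (cong (count v) (others-no xs ne)) (count-yes _ e')))
                   (≤-trans (s≤s (count-others v y xs)) (≤-reflexive (sym (count-yes xs e'))))
...   | no ne' = ≤-trans (≤-reflexive (trans (cong (count v) (others-no xs ne)) (count-no _ ne')))
                   (≤-trans (count-others v y xs) (≤-reflexive (sym (count-no xs ne'))))

covered-length : ∀ ys xs → (∀ {x} → x ∈ xs → x ∈ ys) → (∀ v → count v xs ≤ 3) → length xs ≤ length ys * 3
covered-length [] [] cov _ = z≤n
covered-length [] (x ∷ xs) cov _ with cov (here refl)
... | ()
covered-length (y ∷ ys) xs cov h = begin
  length xs                             ≡⟨ count-split y xs ⟩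
  count y xs + length (others y xs)     ≤⟨ +-mono-≤ (h y) (covered-length ys (others y xs) cov'
                                             (λ v → ≤-trans (count-others v y xs) (h v))) ⟩
  3 + length ys * 3                     ∎
  where
  open ≤-Reasoning
  cov' : ∀ {x} → x ∈ others y xs → x ∈ ys
  cov' {x} m with ∈-filter⁻ (λ u → ¬? (u ≟ y)) {xs = xs} m
  ... | m' , ne with cov m'
  ...   | here e   = contradiction e ne
  ...   | there m″ = m″

clauses≤literals : ∀ φ → ShortClauses φ → length φ ≤ length (concat φ)
clauses≤literals []      []             = z≤n
clauses≤literals (C ∷ φ) ((le , _) ∷ h) =
  ≤-trans (+-mono-≤ le (clauses≤literals φ h)) (≤-reflexive (sym (length-++ C)))

-- Here the bounded number of occurrences enters: it makes N, and with it `k`, linear in the number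
-- of variables.
clauses≤3vars : ∀ φ → Is2SAT₃ φ → length φ ≤ m-vbl φ * 3
clauses≤3vars φ (short , occ≤) = ≤-trans (clauses≤literals φ short)
  (≤-trans (≤-reflexive (sym (length-map proj₁ (concat φ))))
    (covered-length (deduplicate _≟_ (vars φ)) (vars φ) (∈-deduplicate⁺ _≟_) occ≤))

-- Logarithms of polynomially bounded functions

n<2^1+log : ∀ n → n < 2 ^ suc ⌊log₂ n ⌋
n<2^1+log n with n <? 2 ^ suc ⌊log₂ n ⌋
... | yes lt = lt
... | no nlt = contradiction (≤-trans (≤-reflexive (sym (⌊log₂[2^n]⌋≡n (suc ⌊log₂ n ⌋)))) (⌊log₂⌋-mono-≤ (≮⇒≥ nlt))) (n≮n _)

log-2^ : ∀ {n c} → n ≤ 2 ^ c → ⌊log₂ n ⌋ ≤ c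
log-2^ {n} {c} le = ≤-trans (⌊log₂⌋-mono-≤ le) (≤-reflexive (⌊log₂[2^n]⌋≡n c))

2+n≤ : ∀ z → 2 + z ≤ 2 ^ (2 * suc ⌊log₂ z ⌋)
2+n≤ z = begin
  2 + z                                                ≡⟨ refl ⟩
  1 + suc z                                            ≤⟨ +-mono-≤ (m^n>0 2 (suc ⌊log₂ z ⌋)) (n<2^1+log z) ⟩
  2 ^ suc ⌊log₂ z ⌋ + 2 ^ suc ⌊log₂ z ⌋                ≡⟨ cong (2 ^ suc ⌊log₂ z ⌋ +_) (sym (+-identityʳ _)) ⟩
  2 ^ (1 + suc ⌊log₂ z ⌋)                              ≤⟨ ^-monoʳ-≤ 2 (+-mono-≤ (s≤s (z≤n {⌊log₂ z ⌋})) ≤-refl) ⟩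
  2 ^ (suc ⌊log₂ z ⌋ + suc ⌊log₂ z ⌋)                  ≡⟨ cong (λ e → 2 ^ (suc ⌊log₂ z ⌋ + e)) (sym (+-identityʳ _)) ⟩
  2 ^ (2 * suc ⌊log₂ z ⌋)                              ∎
  where open ≤-Reasoning

poly-log : ∀ {f} → Poly f → Σ ℕ λ c → ∀ z → f z ≤ 2 ^ (c * suc ⌊log₂ z ⌋)
poly-log (c , h) = 2 * c , λ z → ≤-trans (h z) (≤-trans (^-monoˡ-≤ c (2+n≤ z))
  (≤-reflexive (trans (^-*-assoc 2 (2 * suc ⌊log₂ z ⌋) c) (cong (2 ^_) (lem (suc ⌊log₂ z ⌋) c)))))
  where
  lem : ∀ a c → (2 * a) * c ≡ (2 * c) * a
  lem = solve-∀

*-^ : ∀ c a b → (a * b) ^ c ≡ a ^ c * b ^ c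
*-^ zero    a b = refl
*-^ (suc c) a b = trans (cong (a * b *_) (*-^ c a b)) (lem a b (a ^ c) (b ^ c))
  where
  lem : ∀ a b x y → (a * b) * (x * y) ≡ (a * x) * (b * y)
  lem = solve-∀

-- Since 2 + v is at most 3v for v at least 1, the coefficient 3 ^ c works there; the same number
-- also exceeds the exponent c and, as additive constant, covers v = 0.
poly→polyBound : ∀ {f} → Poly f → Σ ℕ λ p → ∀ z → f z ≤ polyBound p z
poly→polyBound {f} (c , h) = 3 ^ c , bound
  where
  bound : ∀ z → f z ≤ polyBound (3 ^ c) z
  bound zero = ≤-trans (h 0) (≤-trans (^-monoˡ-≤ c (n≤1+n 2)) (m≤n+m (3 ^ c) _))
  bound (suc z) = begin
    f (suc z)                                ≤⟨ h (suc z) ⟩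
    (3 + z) ^ c                              ≤⟨ ^-monoˡ-≤ c (≤-trans (+-monoʳ-≤ 3 (m≤n*m z 3)) (≤-reflexive (sym (*-suc 3 z)))) ⟩
    (3 * suc z) ^ c                          ≡⟨ *-^ c 3 (suc z) ⟩
    3 ^ c * suc z ^ c                        ≤⟨ *-monoʳ-≤ (3 ^ c) (^-monoʳ-≤ (suc z) (exp c)) ⟩
    3 ^ c * suc z ^ (3 ^ c)                  ≤⟨ m≤m+n _ _ ⟩
    polyBound (3 ^ c) (suc z)                ∎
    where
    open ≤-Reasoning
    exp : ∀ c → c ≤ 3 ^ c
    exp c = ≤-trans (n≤2^n c) (^-monoˡ-≤ c (n≤1+n 2))

polylog-≥ : ∀ c z → suc c * suc ⌊log₂ z ⌋ ≤ polylog (suc c) z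
polylog-≥ c z = begin
  suc c * suc l                     ≡⟨ *-suc (suc c) l ⟩
  suc c + suc c * l                 ≡⟨ +-comm (suc c) _ ⟩
  suc c * l + suc c                 ≤⟨ +-monoˡ-≤ (suc c) (*-monoʳ-≤ (suc c) (pow l)) ⟩
  suc c * l ^ suc c + suc c         ∎
  where
  open ≤-Reasoning
  l = ⌊log₂ z ⌋
  pow : ∀ l → l ≤ l ^ suc c
  pow zero    = z≤n
  pow (suc l) = m≤m*n (suc l) (suc l ^ c) {{m^n≢0 (suc l) c}}

-- Space bounds are stated for cubes; this adds two of them without extracting cube roots.
cube-+ : ∀ x y → (x + y) ^ 3 ≤ 8 * (x ^ 3 + y ^ 3)
cube-+ x y = begin
  (x + y) ^ 3              ≤⟨ ^-monoˡ-≤ 3 (+-mono-≤ (m≤m⊔n x y) (m≤n⊔m x y)) ⟩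
  ((x ⊔ y) + (x ⊔ y)) ^ 3    ≡⟨ lem (x ⊔ y) ⟩
  8 * (x ⊔ y) ^ 3          ≤⟨ *-monoʳ-≤ 8 (go (≤-total x y)) ⟩
  8 * (x ^ 3 + y ^ 3)      ∎
  where
  open ≤-Reasoning
  lem : ∀ a → (a + a) * ((a + a) * ((a + a) * 1)) ≡ 8 * (a * (a * (a * 1)))
  lem = solve-∀
  go : x ≤ y ⊎ y ≤ x → (x ⊔ y) ^ 3 ≤ x ^ 3 + y ^ 3
  go (inj₁ le) rewrite m≤n⇒m⊔n≡n le = m≤n+m (y ^ 3) (x ^ 3)
  go (inj₂ le) rewrite m≥n⇒m⊔n≡m le = m≤m+n (x ^ 3) (y ^ 3)

-- Length of the virtual input

length-encℕᵇ : ∀ m → length (encℕ m) ≤ m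
length-encℕᵇ m = ≤-trans (go (toBin m)) (≤-reflexive (ofBin-toBin m))
  where
  go : ∀ b → length (encℕᵇ b) ≤ ofBin b
  go 0ᵇ       = z≤n
  go 2[1+ b ] = ≤-trans (s≤s (go b)) (m≤m+n (suc (ofBin b)) _)
  go 1+[2 b ] = s≤s (≤-trans (go b) (m≤m+n (ofBin b) _))

length-encNum : ∀ m → length (encNum m) ≤ suc m
length-encNum m = ≤-trans (≤-reflexive (trans (length-++ (encℕ m)) (+-comm _ 1))) (s≤s (length-encℕᵇ m))

length-concatMap-≤ : {A B : Set} (f : A → List B) {c : ℕ} → (∀ x → length (f x) ≤ c) → ∀ xs →
  length (concatMap f xs) ≤ length xs * c
length-concatMap-≤ f h []       = z≤n
length-concatMap-≤ f h (x ∷ xs) =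
  ≤-trans (≤-reflexive (length-++ (f x))) (+-mono-≤ (h x) (length-concatMap-≤ f h xs))

all-concatMap : {A B : Set} {P : B → Set} (f : A → List B) → (∀ x → All P (f x)) → ∀ xs → All P (concatMap f xs)
all-concatMap f h []       = []
all-concatMap f h (x ∷ xs) = ++⁺ (h x) (all-concatMap f h xs)

-- An upper bound that grants `suc m` symbols to the code of `m`: hence 7 for a weight of at most 6.
-- The summand 2 is the code of the start index 1.
inputLen : ℕ → ℕ
inputLen N = suc (nOf N) + (suc (dOf N) + (2 + (nOf N * (nOf N * 7) + suc (kOf N))))

nOf-mono : ∀ {a b} → a ≤ b → nOf a ≤ nOf b
nOf-mono le = +-monoʳ-≤ 6 (*-mono-≤ le (*-monoˡ-≤ 8 le))

dOf-mono : ∀ {a b} → a ≤ b → dOf a ≤ dOf b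
dOf-mono le = +-monoʳ-≤ 2 (*-monoˡ-≤ 4 le)

kOf-mono : ∀ {a b} → a ≤ b → kOf a ≤ kOf b
kOf-mono le = +-monoʳ-≤ 8 (*-monoˡ-≤ 16 le)

inputLen-mono : ∀ {a b} → a ≤ b → inputLen a ≤ inputLen b
inputLen-mono le = +-mono-≤ (s≤s (nOf-mono le)) (+-mono-≤ (s≤s (dOf-mono le)) (+-monoʳ-≤ 2
  (+-mono-≤ (*-mono-≤ (nOf-mono le) (*-monoˡ-≤ 7 (nOf-mono le))) (s≤s (kOf-mono le)))))

polyBound-mono : ∀ p {a b} → a ≤ b → polyBound p a ≤ polyBound p b
polyBound-mono p le = +-monoˡ-≤ p (*-monoʳ-≤ p (^-monoˡ-≤ p le))

nOf-poly : Poly nOf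
nOf-poly = poly-+ (poly-const 6) (poly-* poly-id (poly-* poly-id (poly-const 8)))

dOf-poly : Poly dOf
dOf-poly = poly-+ (poly-const 2) (poly-* poly-id (poly-const 4))

kOf-poly : Poly kOf
kOf-poly = poly-+ (poly-const 8) (poly-* poly-id (poly-const 16))

inputLen-poly : Poly inputLen
inputLen-poly = poly-+ (poly-+ (poly-const 1) nOf-poly) (poly-+ (poly-+ (poly-const 1) dOf-poly) (poly-+ (poly-const 2)
  (poly-+ (poly-* nOf-poly (poly-* nOf-poly (poly-const 7))) (poly-+ (poly-const 1) kOf-poly))))

-- Correctness and resources of the resulting machine for 2SAT

ApproxWith : TM → ℕ → ℕ → Set
ApproxWith M p c = ∀ (x : HPP) (k : ℕ) → 1 ≤ k →
  let w = encInput x k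
      fin = run M w (polyBound p (length w + k)) in
  Halted M fin
  × Σ (Solution x) (λ y → Config.out fin ≡ encSolution x y × Approx x k y)
  × (∀ t → space M (run M w t) ^ 3 ≤ c * k * suc ⌊log₂ m-col x ⌋ ^ 3)

module Reduce (M : TM) (p c : ℕ) (approx : ApproxWith M p c) where

  open Main M
  open Registers M 15 using (nSym)
  open Compile (suc (TM.tapes M)) nSym

  M' : TM
  M' = toTM main

  -- One polynomial above everything that is stored in a register or counted by a loop: the length
  -- of φ, the three parameters, the virtual head position and the simulated time.
  bound : ℕ → ℕ
  bound z = 1 + (z + (nOf z + (dOf z + (kOf z + (inputLen z + polyBound p (inputLen z + kOf z))))))

  bound-poly : Poly bound
  bound-poly = poly-+ (poly-const 1) (poly-+ poly-id (poly-+ nOf-poly (poly-+ dOf-poly (poly-+ kOf-poly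
    (poly-+ inputLen-poly (poly-+ (poly-* (poly-const p) (poly-^ p (poly-+ inputLen-poly kOf-poly))) (poly-const p)))))))

  time-poly : Poly (λ z → Machine.cost (suc (TM.tapes M)) nSym main (2 * bound z))
  time-poly = poly-∘ (Machine.cost-poly (suc (TM.tapes M)) nSym main) (poly-* (poly-const 2) bound-poly)

  time : Σ ℕ λ p' → ∀ z → Machine.cost (suc (TM.tapes M)) nSym main (2 * bound z) ≤ polyBound p' z
  time = poly→polyBound time-poly

  module _ (φ : CNF) (is2 : Is2SAT₃ φ) where
    short = proj₁ is2
    open Reduction φ using (N; vertices; wt; source; idle; sink; Vtx; rest; vᵢ; vₛ; vₖ; vₜ; vₚ; bits)
    open Instance φ short

    z = length (encCNF φ)
    k = kOf N
    vw = encInput hpp k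
    T = polyBound p (length vw + k)
    U = bound z

    N≤z : N ≤ z
    N≤z = length-encCNF φ

    vw-length : length vw ≤ inputLen z
    vw-length = ≤-trans (≤-trans (≤-reflexive (cong length encInput-hpp)) parts) (inputLen-mono N≤z)
      where
      row : ∀ u → length (concatMap (λ v → encNum (wt u v)) vertices) ≤ nOf N * 7
      row u = ≤-trans (length-concatMap-≤ (λ v → encNum (wt u v)) (λ v → ≤-trans (length-encNum (wt u v)) (s≤s (proj₂ (wt-range u v)))) vertices)
                      (*-monoˡ-≤ 7 (≤-reflexive length-vertices))
      matrix = concatMap (λ u → concatMap (λ v → encNum (wt u v)) vertices) vertices
      parts : length (encNum (nOf N) ++ encNum (dOf N) ++ encNum 1 ++ matrix ++ encNum k) ≤ inputLen N
      parts = begin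
        length (encNum (nOf N) ++ encNum (dOf N) ++ encNum 1 ++ matrix ++ encNum k)
          ≡⟨ length-++ (encNum (nOf N)) ⟩
        length (encNum (nOf N)) + length (encNum (dOf N) ++ encNum 1 ++ matrix ++ encNum k)
          ≤⟨ +-mono-≤ (length-encNum (nOf N)) (≤-trans (≤-reflexive (length-++ (encNum (dOf N)))) (+-mono-≤ (length-encNum (dOf N))
             (+-monoʳ-≤ 2 (≤-trans (≤-reflexive (length-++ matrix)) (+-mono-≤
               (≤-trans (length-concatMap-≤ (λ u → concatMap (λ v → encNum (wt u v)) vertices) row vertices) (*-monoˡ-≤ (nOf N * 7) (≤-reflexive length-vertices)))
               (length-encNum k)))))) ⟩
        inputLen N ∎
        where open ≤-Reasoning

    W<U : z < U
    W<U = s≤s (m≤m+n z _)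
    n<U : nOf N < U
    n<U = s≤s (≤-trans (nOf-mono N≤z) (≤-trans (m≤m+n (nOf z) _) (m≤n+m _ z)))
    d<U : dOf N < U
    d<U = s≤s (≤-trans (dOf-mono N≤z) (≤-trans (m≤m+n (dOf z) _) (≤-trans (m≤n+m _ (nOf z)) (m≤n+m _ z))))
    k<U : kOf N < U
    k<U = s≤s (≤-trans (kOf-mono N≤z) (≤-trans (m≤m+n (kOf z) _) (≤-trans (m≤n+m _ (dOf z)) (≤-trans (m≤n+m _ (nOf z)) (m≤n+m _ z)))))
    len<U : length vw < U
    len<U = s≤s (≤-trans vw-length (≤-trans (m≤m+n (inputLen z) _) (≤-trans (m≤n+m _ (kOf z)) (≤-trans (m≤n+m _ (dOf z)) (≤-trans (m≤n+m _ (nOf z)) (m≤n+m _ z))))))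
    T<U : T < U
    T<U = s≤s (≤-trans (polyBound-mono p (+-mono-≤ vw-length (kOf-mono N≤z)))
            (≤-trans (m≤n+m _ (inputLen z)) (≤-trans (m≤n+m _ (kOf z)) (≤-trans (m≤n+m _ (dOf z)) (≤-trans (m≤n+m _ (nOf z)) (m≤n+m _ z))))))

    module C = Correct M φ short U W<U n<U d<U k<U

    answer = approx hpp k (s≤s z≤n)

    module Sim = C.Simulation T T<U (subst (λ u → length u < U) encInput-hpp len<U)
                   (subst (λ u → Halted M (run M u T)) encInput-hpp (proj₁ answer))

    b   = proj₁ Sim.main-exec
    s   = proj₁ (proj₂ Sim.main-exec)
    m   = proj₁ (proj₂ (proj₂ Sim.main-exec))
    end = cfg main (encCNF φ) (inj₂ b) m

    finished : Σ ℕ λ n → n ≤ Machine.cost (suc (TM.tapes M)) nSym main (2 * U) × run M' (encCNF φ) n ≡ end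
    finished = run-exec main (encCNF φ) {2 * U} (proj₁ (proj₂ (proj₂ (proj₂ Sim.main-exec))))

    halted : Halted M' (run M' (encCNF φ) (proj₁ finished))
    halted = subst (Halted M') (sym (proj₂ (proj₂ finished))) (cfg-halted main (encCNF φ) b m)

    final : run M' (encCNF φ) (polyBound (proj₁ time) z) ≡ end
    final = trans (run-halted-≤ M' (encCNF φ) (≤-trans (proj₁ (proj₂ finished)) (proj₂ time z)) halted) (proj₂ (proj₂ finished))

    final-halted : Halted M' (run M' (encCNF φ) (polyBound (proj₁ time) z))
    final-halted = subst (Halted M') (sym final) (cfg-halted main (encCNF φ) b m)

    final-accept : TM.accept M' (Config.state (run M' (encCNF φ) (polyBound (proj₁ time) z))) ≡ b
    final-accept = trans (cong (λ c → TM.accept M' (Config.state c)) final) (cfg-accept main (encCNF φ) b m)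

    sol = proj₁ (proj₁ (proj₂ answer))

    b≡ : b ≡ isFour (scanned (encSolution hpp sol))
    b≡ = trans (proj₁ (proj₂ (proj₂ (proj₂ (proj₂ (proj₂ Sim.main-exec))))))
           (cong (isFour ∘ scanned) (trans (cong (λ u → Config.out (run M u T)) (sym encInput-hpp)) (proj₁ (proj₂ (proj₁ (proj₂ answer))))))

    opt = proj₁ (optimum hpp)

    opt-≥ : ∀ vs → length vs ≡ steps → walkWt source vs ≤ opt
    opt-≥ vs e = ≤-trans (≤-reflexive (sym (proj₂ (toSolution vs e)))) (proj₂ (proj₂ (optimum hpp)) (proj₁ (toSolution vs e)))

    near : k * opt ≤ suc k * weight hpp sol
    near = proj₁ (proj₂ (proj₂ (proj₁ (proj₂ answer))) opt (proj₂ (optimum hpp)))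

    k≡ : k ≡ 4 + steps * 4
    k≡ = lem N
      where
      lem : ∀ n → 8 + n * 16 ≡ 4 + (1 + n * 4) * 4
      lem = solve-∀

    -- For s < k one has (k + 1) s < k (s + 1), so a deficit of one unit is beyond the tolerance.
    -- With s = 4D this concerns an optimum above idling; `too-light'` is the analogue for a
    -- solution one unit below idling.
    too-light : ∀ {s k v w} → s < k → k * v ≤ suc k * w → suc s ≤ v → w ≤ s → ⊥
    too-light {s} {k} {v} {w} s<k h hv hw = n≮n s (≤-trans s<k (+-cancelʳ-≤ (k * s) k s (begin
      k + k * s       ≡⟨ sym (*-suc k s) ⟩
      k * suc s       ≤⟨ *-monoʳ-≤ k hv ⟩
      k * v           ≤⟨ h ⟩
      suc k * w       ≤⟨ *-monoʳ-≤ (suc k) hw ⟩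
      s + k * s       ∎)))
      where open ≤-Reasoning

    too-light' : ∀ {s k v w} → s < k → k * v ≤ suc k * w → s ≤ v → suc w ≤ s → ⊥
    too-light' {s} {k} {v} {w} s<k h hv hw = n≮n k (≤-trans (+-cancelʳ-≤ (k * s) (suc k) s (begin
      suc k + k * s       ≤⟨ +-monoʳ-≤ (suc k) (≤-trans (*-monoʳ-≤ k hv) h) ⟩
      suc k + suc k * w   ≡⟨ sym (*-suc (suc k) w) ⟩
      suc k * suc w       ≤⟨ *-monoʳ-≤ (suc k) hw ⟩
      s + k * s           ∎)) (<⇒≤ s<k))
      where open ≤-Reasoning

    s<k : steps * 4 < k
    s<k = ≤-trans (s≤s (m≤n+m (steps * 4) 3)) (≤-reflexive (sym k≡))

    not-idle : ∀ j → toℕ j ≢ 1 → lookup vertices j ≢ idle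
    not-idle zero ne = λ ()
    not-idle (suc zero) ne = contradiction refl ne
    not-idle (suc (suc j)) ne = All.lookup others-not-idle (∈-lookup j)
      where
      others-not-idle : All (_≢ idle) (sink ∷ sink ∷ sink ∷ sink ∷ Reduction.blocks φ)
      others-not-idle = (λ ()) ∷ (λ ()) ∷ (λ ()) ∷ (λ ()) ∷
        all-concatMap vᵢ (λ i → all-concatMap (vₛ i) (λ s → all-concatMap (vₖ i s) (λ k → all-concatMap (vₜ i s k) (λ t →
          all-concatMap (vₚ i s k t) (λ p → (λ ()) ∷ []) bits) bits) (allFin N)) bits) (allFin N)

    Verdict : List (Fin (length vertices)) → Set
    Verdict js = let r = isFour (scanned (concatMap encIdx (HPP.i₁ hpp ∷ js))) in
                 (r ≡ true → Satisfiable φ) × (Satisfiable φ → r ≡ true)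

    tail-length : ∀ {js : List (Fin (length vertices))} → suc (suc (length js)) ≡ dOf N →
                  length (map (lookup vertices) js) ≡ N * 4
    tail-length {js} e = trans (length-map (lookup vertices) js) (suc-injective (suc-injective e))

    idle-optimum : steps * 4 ≤ opt
    idle-optimum = ≤-trans (≤-reflexive (sym (cong (4 +_) (idle-walk (N * 4)))))
      (opt-≥ (idle ∷ replicate (N * 4) idle) (cong suc (length-replicate (N * 4))))

    -- A solution through `idle` weighs at most 4D. A literal equivalent to its complement would
    -- raise the optimum to 4D + 1, out of reach, so there is none and an assignment can be built.
    verdict-idle : ∀ js → suc (suc (length js)) ≡ dOf N → k * opt ≤ suc k * weightFrom hpp zero (suc zero ∷ js) →
                   Verdict (suc zero ∷ js)
    verdict-idle js e h = (λ _ → Implications.Assignment.satisfiable φ consistent short) , λ _ → scanned-two (concatMap encIdx js)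
      where
      light : weightFrom hpp zero (suc zero ∷ js) ≤ steps * 4
      light = ≤-trans (≤-reflexive (weightFrom-walk zero (suc zero ∷ js)))
        (+-monoʳ-≤ 4 (≤-trans (walk-from-idle (map (lookup vertices) js)) (≤-reflexive (cong (_* 4) (tail-length {js} e)))))
      consistent : ∀ x → Implications.Reach φ (Reduction.lit φ x) (neg (Reduction.lit φ x)) →
                   Implications.Reach φ (neg (Reduction.lit φ x)) (Reduction.lit φ x) → ⊥
      consistent x r r' = let vs , len , wt≡ = Implications.Walks.heavy-walk φ short x r r' in
        too-light s<k h (≤-trans (≤-reflexive (sym wt≡)) (opt-≥ vs len)) light

    -- Idling gives an optimum of at least 4D; a satisfying assignment would hold this solution to
    -- 4D - 1, which is too little.
    verdict-other : ∀ j js → toℕ j ≢ 1 → suc (suc (length js)) ≡ dOf N → k * opt ≤ suc k * weightFrom hpp zero (j ∷ js) →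
                    Verdict (j ∷ js)
    verdict-other j js ne e h =
      (λ r → contradiction (trans (sym r) (scanned-other (suc (toℕ j)) (concatMap encIdx js) (ne ∘ suc-injective))) λ ()) ,
      λ { (σ , sat) → ⊥-elim (too-light' s<k h idle-optimum (light σ sat)) }
      where
      light : ∀ σ → All (Any (λ l → σ (proj₁ l) ≡ proj₂ l)) φ → suc (weightFrom hpp zero (j ∷ js)) ≤ steps * 4
      light σ sat = s≤s (≤-trans (≤-reflexive (weightFrom-walk zero (j ∷ js)))
        (≤-trans (Sat.walk-sat σ sat (lookup vertices j) (map (lookup vertices) js) (not-idle j ne))
          (≤-reflexive (cong (λ l → 3 + l * 4) (tail-length {js} e)))))

    verdict : ∀ js → suc (length js) ≡ dOf N → k * opt ≤ suc k * weightFrom hpp zero js → Verdict js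
    verdict (j ∷ js) e h = dispatch j (toℕ j ≟ 1) h
      where
      dispatch : ∀ j → Dec (toℕ j ≡ 1) → k * opt ≤ suc k * weightFrom hpp zero (j ∷ js) → Verdict (j ∷ js)
      dispatch (suc zero) (yes refl) h = verdict-idle js e h
      dispatch j          (no ne)    h = verdict-other j js ne e h

    decided : (b ≡ true → Satisfiable φ) × (Satisfiable φ → b ≡ true)
    decided = let to , from = verdict (proj₁ sol) (proj₂ sol) near
              in (λ e → to (trans (sym b≡) e)) , λ h → trans b≡ (from h)

  ℓ : ℕ → ℕ
  ℓ z = suc ⌊log₂ z ⌋

  regLog : Σ ℕ λ c → ∀ z → 2 * bound z ≤ 2 ^ (c * ℓ z)
  regLog = poly-log (poly-* (poly-const 2) bound-poly)

  nLog : Σ ℕ λ c → ∀ z → nOf z ≤ 2 ^ (c * ℓ z)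
  nLog = poly-log nOf-poly

  -- The register tape contributes the first cube and the work tapes of `M` the second; 8 comes from
  -- `cube-+` and 48 from `k-vars`.
  K : ℕ
  K = 8 * ((2 + proj₁ regLog) ^ 3 + c * 48 * (1 + proj₁ nLog) ^ 3)

  tapes-space : ∀ {Γ Δ : Set} {n} {ts : Vec (Tape Γ) n} {us : Vec (Tape Δ) n} →
    Pointwise (λ t u → Tape.maxpos t ≤ Tape.maxpos u) ts us →
    V.foldr (λ _ → ℕ) (λ t s → suc (Tape.maxpos t) + s) 0 ts ≤ V.foldr (λ _ → ℕ) (λ t s → suc (Tape.maxpos t) + s) 0 us
  tapes-space []       = z≤n
  tapes-space (h ∷ hs) = +-mono-≤ (s≤s h) (tapes-space hs)

  -- X is the register tape, Y the space of `M`, q a logarithm of the input length. X is free of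
  -- `sm` and is absorbed because the factor `suc sm` is at least 1.
  space-arith : ∀ X Y sm k q Λ c a e → X ≤ a * q → Y ^ 3 ≤ c * k * Λ ^ 3 → Λ ≤ e * q → k ≤ 48 * suc sm →
                (X + Y) ^ 3 ≤ suc sm * (8 * (a ^ 3 + c * 48 * e ^ 3) * q) ^ 3
  space-arith X Y sm k q Λ c a e hX hY hΛ hk = begin
    (X + Y) ^ 3                                                          ≤⟨ cube-+ X Y ⟩
    8 * (X ^ 3 + Y ^ 3)                                                  ≤⟨ *-monoʳ-≤ 8 (+-mono-≤ X³ Y³) ⟩
    8 * (suc sm * (a ^ 3 * q ^ 3) + c * (48 * suc sm) * (e ^ 3 * q ^ 3))  ≡⟨ collect (suc sm) (a ^ 3) (q ^ 3) c (e ^ 3) ⟩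
    suc sm * (κ * q ^ 3)                                                 ≤⟨ *-monoʳ-≤ (suc sm) (*-monoˡ-≤ (q ^ 3) (cube-≥ κ)) ⟩
    suc sm * (κ ^ 3 * q ^ 3)                                             ≡⟨ cong (suc sm *_) (sym (*-^ 3 κ q)) ⟩
    suc sm * (κ * q) ^ 3                                                 ∎
    where
    open ≤-Reasoning
    κ = 8 * (a ^ 3 + c * 48 * e ^ 3)
    cube-≥ : ∀ n → n ≤ n ^ 3
    cube-≥ zero    = z≤n
    cube-≥ (suc n) = m≤m*n (suc n) (suc n ^ 2) {{m^n≢0 (suc n) 2}}
    X³ : X ^ 3 ≤ suc sm * (a ^ 3 * q ^ 3)
    X³ = ≤-trans (^-monoˡ-≤ 3 hX) (≤-trans (≤-reflexive (*-^ 3 a q)) (m≤m+n _ _))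
    Y³ : Y ^ 3 ≤ c * (48 * suc sm) * (e ^ 3 * q ^ 3)
    Y³ = ≤-trans hY (*-mono-≤ (*-monoʳ-≤ c hk) (≤-trans (^-monoˡ-≤ 3 hΛ) (≤-reflexive (*-^ 3 e q))))
    collect : ∀ s a l c e → 8 * (s * (a * l) + c * (48 * s) * (e * l)) ≡ s * (8 * (a + c * 48 * e) * l)
    collect = solve-∀

  module _ (φ : CNF) (is2 : Is2SAT₃ φ) where
    open Reduction φ using (N)

    w = encCNF φ
    lw = ℓ (length w)

    ℓ-absorb : ∀ a c l → a + c * suc l ≤ (a + c) * suc l
    ℓ-absorb a c l = ≤-trans (+-monoˡ-≤ (c * suc l) (m≤m*n a (suc l))) (≤-reflexive (sym (*-distribʳ-+ (suc l) a c)))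

    register-space : ∀ n → 2 ^ n ≤ 2 * bound (length w) → 2 + n ≤ (2 + proj₁ regLog) * lw
    register-space n h = ≤-trans (+-monoʳ-≤ 2 (≤-trans (≤-reflexive (sym (⌊log₂[2^n]⌋≡n n)))
      (log-2^ (≤-trans h (proj₂ regLog (length w)))))) (ℓ-absorb 2 (proj₁ regLog) ⌊log₂ length w ⌋)

    col-log : suc ⌊log₂ m-col (Instance.hpp φ (proj₁ is2)) ⌋ ≤ (1 + proj₁ nLog) * lw
    col-log = ≤-trans (s≤s (log-2^ (≤-trans (≤-reflexive (Instance.length-vertices φ (proj₁ is2)))
      (≤-trans (nOf-mono (length-encCNF φ)) (proj₂ nLog (length w)))))) (ℓ-absorb 1 (proj₁ nLog) ⌊log₂ length w ⌋)

    k-vars : kOf N ≤ 48 * suc (m-vbl φ)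
    k-vars = ≤-trans (+-monoʳ-≤ 8 (*-monoˡ-≤ 16 (clauses≤3vars φ is2)))
      (≤-trans (+-monoˡ-≤ _ (m≤m+n 8 40)) (≤-reflexive (lem (m-vbl φ))))
      where
      lem : ∀ m → 48 + m * 3 * 16 ≡ 48 * (1 + m)
      lem = solve-∀

    end-space : space M' (end φ is2) ^ 3 ≤ suc (m-vbl φ) * (K * lw) ^ 3
    end-space = go (m φ is2) (proj₁ (proj₂ (proj₂ (proj₂ (proj₂ (Sim.main-exec φ is2))))))
                   (proj₂ (proj₂ (proj₂ (proj₂ (proj₂ (proj₂ (Sim.main-exec φ is2)))))))
      where
      open Registers M 15 using (St; sims; module Logic)
      open Logic w (bound (length w)) using (Rep; rep)
      open Simulator M 15 using (Γ; MTape; Holds; holds; RegTape; SimTape)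
      y = run M (Correct.vw M φ (proj₁ is2) (U φ is2) (W<U φ is2) (n<U φ is2) (d<U φ is2) (k<U φ is2)) (T φ is2)
      y-space : space M y ^ 3 ≤ c * kOf N * suc ⌊log₂ m-col (Instance.hpp φ (proj₁ is2)) ⌋ ^ 3
      y-space = subst (λ u → space M (run M u (T φ is2)) ^ 3 ≤ c * kOf N * suc ⌊log₂ m-col (Instance.hpp φ (proj₁ is2)) ⌋ ^ 3)
                  (Instance.encInput-hpp φ (proj₁ is2)) (proj₂ (proj₂ (answer φ is2)) (T φ is2))
      weaken : ∀ {n} {ts : Vec (Tape Γ) n} {us : Vec MTape n} → Pointwise SimTape ts us → Pointwise (λ t u → Tape.maxpos t ≤ Tape.maxpos u) ts us
      weaken []       = []
      weaken (x ∷ xs) = SimTape.maxpos≤ x ∷ weaken xs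
      go : ∀ {s} m → Rep s m → sims s ≡ Config.work y → space M' (cfg main w (inj₂ (b φ is2)) m) ^ 3 ≤ suc (m-vbl φ) * (K * lw) ^ 3
      go {s} m (rep {cs} (holds {t} {ts} r sim) _ short) refl = ≤-trans
        (^-monoˡ-≤ 3 (+-mono-≤ (s≤s (RegTape.maxpos≤ r)) (tapes-space (weaken sim))))
        (space-arith (2 + length cs) (space M y) (m-vbl φ) (kOf N) lw _ c (2 + proj₁ regLog) (1 + proj₁ nLog)
          (register-space (length cs) short) y-space col-log k-vars)

    space-bound : ∀ t → space M' (run M' w t) ^ 3 ≤ suc (m-vbl φ) ^ 1 * polylog (suc K) (length w) ^ 3
    space-bound t = begin
      space M' (run M' w t) ^ 3                        ≤⟨ ^-monoˡ-≤ 3 (space-≤-halted M' w {proj₁ (finished φ is2)} (halted φ is2) t) ⟩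
      space M' (run M' w (proj₁ (finished φ is2))) ^ 3 ≡⟨ cong (λ c → space M' c ^ 3) (proj₂ (proj₂ (finished φ is2))) ⟩
      space M' (end φ is2) ^ 3                         ≤⟨ end-space ⟩
      suc (m-vbl φ) * (K * lw) ^ 3                     ≤⟨ *-mono-≤ (≤-reflexive (sym (*-identityʳ (suc (m-vbl φ)))))
                                                            (^-monoˡ-≤ 3 (≤-trans (*-monoˡ-≤ lw (n≤1+n K)) (polylog-≥ K (length w)))) ⟩
      suc (m-vbl φ) ^ 1 * polylog (suc K) (length w) ^ 3 ∎
      where open ≤-Reasoning

  -- The exponent 1/3 of `k` becomes the exponent of the number of variables, as `k` is linear in
  -- it.
  solves : Solves2SAT₃ M' 1 3 (suc K)
  solves = proj₁ time , λ φ is2 → final-halted φ is2 ,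
    (λ acc → proj₁ (decided φ is2) (trans (sym (final-accept φ is2)) acc)) ,
    (λ sat → trans (final-accept φ is2) (proj₂ (decided φ is2) sat)) ,
    space-bound φ is2

theorem8 : LSH → ¬ Σ TM ApproxHPP
theorem8 lsh (M , p , c , approx) = lsh 1 3 (s≤s z≤n) (s≤s (s≤s z≤n)) (suc (Reduce.K M p c approx))
  (Reduce.M' M p c approx , Reduce.solves M p c approx)
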